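{- Let $r\ge1$ and let $k_0,\dots,k_r$ be nonnegative integers, and put $n=1+k_0+\cdots+k_r$. The number of $r$-permutations $\pi$ of $[n]$ such that $S(S(\pi))$ is the identity permutation $12\cdots n$ and such that $\pi$ has exactly $k_i$ descents of type $i$ for each $i=0,\dots,r$, equals $$\frac{1}{n^2}\prod_{i=0}^r\frac{n}{n-k_i}\binom{2n-1-k_i}{k_i}.$$
   Context: An $r$-permutation of a finite set $A$ of positive integers is a word in which each element of $A$ appears exactly $r$ times such that whenever $i<j<k$ and $a_i=a_k$ we have $a_j\le a_i$; for $A=[n]$ it is an $r$-permutation of $[n]$. Stack sorting $S$: on words with distinct letters, $S(\emptyset)=\emptyset$ and $S(\pi_lm\pi_r)=S(\pi_l)S(\pi_r)m$ where $m$ is the largest letter; on a nonempty $r$-permutation $\pi$ with largest letter $m$, written $\pi=\alpha_1m\alpha_2m\cdots m\alpha_{r+1}$, $S(\pi)=S(\alpha_1)\cdots S(\alpha_{r+1})m$ (a word with distinct letters), and $S(\emptyset)=\emptyset$. A letter $a$ of $\pi$ is a type $i$ descent ($1\le i\le r$) if the $i$th occurrence of $a$ is immediately followed by a smaller letter, and a type $0$ descent if the first occurrence of $a$ immediately follows a smaller letter. -}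

module Defs where

open import Data.Nat using (ℕ; zero; suc; _+_; _*_; _∸_; _^_; _≤ᵇ_; _<ᵇ_; _≡ᵇ_; _⊔_)
open import Data.Nat.Combinatorics using (_C_)
open import Data.Bool using (Bool; true; false; _∧_; if_then_else_)
open import Data.List using (List; []; _∷_; [_]; _++_; length; map; concat; concatMap; filterᵇ; upTo; tabulate; allFin)
open import Data.Bool.ListAction using (all)
open import Data.Nat.ListAction using (sum)
open import Data.Maybe using (Maybe; just; nothing)
open import Data.Fin using (Fin; toℕ)
open import Data.Product using (_×_; _,_)

-- Words are lists of positive integers.
Word : Set
Word = List ℕ

range : ℕ → List ℕ
range n = map suc (upTo n)

allBelow : ℕ → (ℕ → Bool) → Bool
allBelow b p = all p (upTo b)

at : Word → ℕ → Maybe ℕ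
at []      _       = nothing
at (x ∷ _) zero    = just x
at (_ ∷ w) (suc j) = at w j

-- letter at position j with default 0 (only used for positions < length)
at0 : Word → ℕ → ℕ
at0 w j with at w j
... | just x  = x
... | nothing = 0

occ : ℕ → Word → ℕ
occ a []      = 0
occ a (x ∷ w) = if a ≡ᵇ x then suc (occ a w) else occ a w

lettersIn : ℕ → Word → Bool
lettersIn n w = all (λ x → (1 ≤ᵇ x) ∧ (x ≤ᵇ n)) w

patternOK : Word → Bool
patternOK w =
  allBelow (length w) λ i → allBelow (length w) λ j → allBelow (length w) λ k →
    if (i <ᵇ j) ∧ (j <ᵇ k) ∧ (at0 w i ≡ᵇ at0 w k)
    then at0 w j ≤ᵇ at0 w i
    else true

isRPerm : ℕ → ℕ → Word → Bool
isRPerm r n w = lettersIn n w ∧ all (λ a → occ a w ≡ᵇ r) (range n) ∧ patternOK w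

maxL : Word → ℕ
maxL []      = 0
maxL (x ∷ w) = x ⊔ maxL w

splitFirst : ℕ → Word → Word × Word
splitFirst m []      = [] , []
splitFirst m (x ∷ w) with x ≡ᵇ m
... | true  = [] , w
... | false with splitFirst m w
...   | l , r = (x ∷ l) , r

-- Stack sorting on words with distinct letters, with fuel:
-- S(∅) = ∅, S(π_l m π_r) = S(π_l) S(π_r) m, m the largest letter.
stackSortD : ℕ → Word → Word
stackSortD zero    _           = []
stackSortD (suc f) []          = []
stackSortD (suc f) w@(_ ∷ _) with splitFirst (maxL w) w
... | l , r = stackSortD f l ++ stackSortD f r ++ [ maxL w ]

-- S on words with distinct letters (fuel = length suffices)
S : Word → Word
S w = stackSortD (length w) w

consHead : ℕ → List Word → List Word
consHead x []       = [ x ∷ [] ]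
consHead x (s ∷ ss) = (x ∷ s) ∷ ss

splitAll : ℕ → Word → List Word
splitAll m []      = [ [] ]
splitAll m (x ∷ w) = if x ≡ᵇ m then [] ∷ splitAll m w else consHead x (splitAll m w)

stackSortR : ℕ → Word → Word
stackSortR zero    _         = []
stackSortR (suc f) []        = []
stackSortR (suc f) w@(_ ∷ _) = concat (map (stackSortR f) (splitAll (maxL w) w)) ++ [ maxL w ]

Sᵣ : Word → Word
Sᵣ w = stackSortR (length w) w

eqW : Word → Word → Bool
eqW []      []      = true
eqW (x ∷ u) (y ∷ v) = (x ≡ᵇ y) ∧ eqW u v
eqW _       _       = false

-- 0-based position of the i-th (1-based) occurrence of a in w
nthOcc : ℕ → ℕ → Word → Maybe ℕ
nthOcc a i []      = nothing
nthOcc a i (x ∷ w) =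
  if a ≡ᵇ x
  then (if i ≡ᵇ 1 then just 0 else incr (nthOcc a (i ∸ 1) w))
  else incr (nthOcc a i w)
  where
  incr : Maybe ℕ → Maybe ℕ
  incr (just p) = just (suc p)
  incr nothing  = nothing

smallerThan : Maybe ℕ → ℕ → Bool
smallerThan (just y) a = y <ᵇ a
smallerThan nothing  a = false

isDescent : Word → ℕ → ℕ → Bool
isDescent w a zero with nthOcc a 1 w
... | just (suc p) = smallerThan (at w p) a
... | _            = false
isDescent w a (suc i) with nthOcc a (suc i) w
... | just p  = smallerThan (at w (suc p)) a
... | nothing = false

descCount : ℕ → Word → ℕ → ℕ
descCount n w i = length (filterᵇ (λ a → isDescent w a i) (range n))

words : ℕ → ℕ → List Word
words n zero    = [ [] ]
words n (suc L) = concatMap (λ a → map (a ∷_) (words n L)) (range n)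

nOf : (r : ℕ) → (Fin (suc r) → ℕ) → ℕ
nOf r k = 1 + sum (tabulate k)

counted : (r : ℕ) → (Fin (suc r) → ℕ) → Word → Bool
counted r k w =
  isRPerm r (nOf r k) w
  ∧ eqW (S (Sᵣ w)) (range (nOf r k))
  ∧ all (λ i → descCount (nOf r k) w (toℕ i) ≡ᵇ k i) (allFin (suc r))

countPerms : (r : ℕ) → (Fin (suc r) → ℕ) → ℕ
countPerms r k = length (filterᵇ (counted r k) (words (nOf r k) (r * nOf r k)))

{-# OPTIONS --safe #-}
module Submission where

-- Let F be the generating function of the r-permutations π with S(S(π)) = id, where z marks
-- the number of letters, xᵢ the descents of type i and u the direct-sum components of S(π).
-- Removing the largest letter splits π into α₀, …, α_r.  As S(α₀) ⋯ S(α_r) has to avoid 231,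
-- a nonempty αᵢ is glued in front of αᵢ₊₁, …, α_r at one of the cuts between their
-- components, so that
--   Gᵢ = Gᵢ₊₁ + xᵢ F (u Gᵢ₊₁(u) − Gᵢ₊₁(1)) / (u − 1),   G_{r+1} = 1,   F = z u G₀.
-- Put bᵢ = xᵢ T (1 − bᵢ)², T ∏ (1 − bᵢ)² = z and u = (1 + ω) / ∏ (1 + bᵢ ω).  Up to explicit
-- factors the step from Gᵢ₊₁ to Gᵢ is then the operator 1 + bᵢ² + bᵢ (ω + δ), where
-- δ f = (f − f(0)) / ω.  These operators commute, which makes the system solvable, and at
-- ω = 0 one finds F = T (1 − Σ bᵢ).  Hence z dF/dz = T, and Lagrange inversion gives
-- n² [zⁿ] F = [T ^ (n − 1)] ∏ (1 − bᵢ) ^ (−2n), a product of Lucas numbers.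

-- The obstacle is the unknown `G(1)` in the division by `u − 1`. In the variable `ω` one has
-- `u = 1` at `ω = 0` and `u − 1 = ω · δ u`, so the quotient becomes `δ (u G) / δ u`, in which
-- `G(1)` no longer appears. The factor `F` cancels the remaining `δ u`, because `u` is chosen such
-- that `F / δ u = T (1 + ω) ∏ (1 + bᵢ ω)`. What is left to check is one identity: the product of
-- all operators, applied to `1 / ((1 + ω) ∏ (1 + bᵢ ω))`, is `δ u / u`. It expresses that
-- `F = z u G₀` is compatible with this choice. The solution is thus written down and verified. It
-- describes the words because the equations determine the coefficients in `z` one after the other,
-- just as the lists of words are generated. The closed form lives in series in `T` and `ω`, where
-- `z` is an element and not a variable; hence expansions in powers of `z` are a relation that
-- carries its remainders.

open import Level using (0ℓ)
open import Algebra using (CommutativeRing; RawRing)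
import Algebra.Properties.AbelianGroup as AbelianGroupProperties
import Algebra.Properties.CommutativeSemiring.Exp as CommutativePowers
import Algebra.Properties.Ring as RingProperties
import Algebra.Properties.Semiring.Exp as Powers
import Algebra.Properties.Semiring.Mult as Multiples
import Algebra.Properties.Semiring.Mult.TCOptimised as OptimisedMultiples
import Algebra.Solver.Ring
open import Algebra.Solver.Ring.AlmostCommutativeRing using (fromCommutativeRing; _-Raw-AlmostCommutative⟶_)
open import Data.Bool using (Bool; true; false; _∧_; if_then_else_)
open import Data.Bool.ListAction using (all)
open import Data.Empty using (⊥-elim)
open import Data.Fin using (Fin; zero; suc; toℕ)
open import Data.Integer as ℤ using (ℤ)
import Data.Integer.Properties as ℤₚ
open import Data.List using (List; []; _∷_; map; tabulate)
import Data.List.Properties as Listₚ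
open import Data.List.Relation.Unary.All as All using (All; []; _∷_)
import Data.List.Relation.Unary.All.Properties as Allₚ
open import Data.Maybe using (Maybe; just; nothing)
open import Data.Nat as ℕ using (ℕ; zero; suc; _≡ᵇ_)
open import Data.Nat.ListAction using (sum; product)
import Data.Nat.Properties as ℕₚ
import Data.Nat.Solver as ℕSolver
open import Data.Product using (_×_; _,_; proj₁; proj₂; ∃-syntax)
open import Data.Product.Properties using (≡-dec)
open import Data.Sum using (_⊎_; inj₁; inj₂; [_,_]′)
open import Relation.Binary.PropositionalEquality as ≡ using (_≡_; _≢_)
import Relation.Binary.Reasoning.Setoid as SetoidReasoning
open import Relation.Nullary using (¬_; yes; no)

-- Solving ring identities with integer coefficients

-- The solver's coefficients are pairs (a , b) of naturals standing for a − b.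
module IntegerSolver (R : CommutativeRing 0ℓ 0ℓ) where
  open CommutativeRing R
  open Multiples semiring using (×-homo-+; ×1-homo-*) renaming (_×_ to _·_)
  open OptimisedMultiples semiring using (×ᵤ≈×) renaming (_×_ to _·ᵒ_)
  open RingProperties ring using (-‿distribˡ-*; -‿distribʳ-*; -‿involutive)
  open AbelianGroupProperties +-abelianGroup using (⁻¹-∙-comm)
  open SetoidReasoning setoid

  private
    -- All operations of `differences` preserve pairs with a zero entry. On these, equal integers
    -- are equal pairs, so `equal?` may compare them propositionally.
    normalise : ℕ × ℕ → ℕ × ℕ
    normalise (suc a , suc b) = normalise (a , b)
    normalise p               = p

    differences : RawRing 0ℓ 0ℓ
    differences = record
      { Carrier = ℕ × ℕ
      ; _≈_ = _≡_
      ; _+_ = λ (a , b) (c , d) → normalise (a ℕ.+ c , b ℕ.+ d)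
      ; _*_ = λ (a , b) (c , d) → normalise (a ℕ.* c ℕ.+ b ℕ.* d , a ℕ.* d ℕ.+ b ℕ.* c)
      ; -_ = λ (a , b) → b , a
      ; 0# = 0 , 0
      ; 1# = 1 , 0
      }

    difference : ℕ × ℕ → Carrier
    difference (a , b) = (a · 1#) + (- (b · 1#))

    -- Agrees with difference, but makes the constants (0 , 0) and (1 , 0) reduce to 0# and 1#.
    ⟦_⟧ᵈ : ℕ × ℕ → Carrier
    ⟦ a , zero ⟧ᵈ  = a ·ᵒ 1#
    ⟦ a , suc b ⟧ᵈ = difference (a , suc b)

    ⟦⟧ᵈ-difference : ∀ p → ⟦ p ⟧ᵈ ≈ difference p
    ⟦⟧ᵈ-difference (a , suc b) = refl
    ⟦⟧ᵈ-difference (a , zero) = begin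
      a ·ᵒ 1#             ≈⟨ sym (×ᵤ≈× a 1#) ⟩
      a · 1#              ≈⟨ sym (+-identityʳ _) ⟩
      (a · 1#) + 0#       ≈⟨ +-congˡ (trans (sym (-‿inverseʳ 0#)) (+-identityˡ _)) ⟩
      (a · 1#) + (- 0#)   ∎

    interchange : ∀ a b c d → (a + b) + (c + d) ≈ (a + c) + (b + d)
    interchange a b c d = begin
      (a + b) + (c + d) ≈⟨ +-assoc a b (c + d) ⟩
      a + (b + (c + d)) ≈⟨ +-congˡ (sym (+-assoc b c d)) ⟩
      a + ((b + c) + d) ≈⟨ +-congˡ (+-congʳ (+-comm b c)) ⟩
      a + ((c + b) + d) ≈⟨ +-congˡ (+-assoc c b d) ⟩
      a + (c + (b + d)) ≈⟨ sym (+-assoc a c (b + d)) ⟩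
      (a + c) + (b + d) ∎

    sub-+ : ∀ a b c d → (a + c) + (- (b + d)) ≈ (a + (- b)) + (c + (- d))
    sub-+ a b c d = begin
      (a + c) + (- (b + d))       ≈⟨ +-congˡ (sym (⁻¹-∙-comm b d)) ⟩
      (a + c) + ((- b) + (- d))   ≈⟨ interchange a c (- b) (- d) ⟩
      (a + (- b)) + (c + (- d))   ∎

    difference-normalise : ∀ p → difference (normalise p) ≈ difference p
    difference-normalise (zero  , b)     = refl
    difference-normalise (suc a , zero)  = refl
    difference-normalise (suc a , suc b) = trans (difference-normalise (a , b)) (begin
      (a · 1#) + (- (b · 1#))                      ≈⟨ sym (+-identityˡ _) ⟩
      0# + ((a · 1#) + (- (b · 1#)))               ≈⟨ +-congʳ (sym (-‿inverseʳ 1#)) ⟩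
      (1# + (- 1#)) + ((a · 1#) + (- (b · 1#)))    ≈⟨ sym (sub-+ 1# 1# (a · 1#) (b · 1#)) ⟩
      (1# + (a · 1#)) + (- (1# + (b · 1#)))        ∎)

    sub-* : ∀ a b c d → (a * c + b * d) + (- (a * d + b * c)) ≈ (a + (- b)) * (c + (- d))
    sub-* a b c d = begin
      (a * c + b * d) + (- (a * d + b * c))
        ≈⟨ sub-+ (a * c) (a * d) (b * d) (b * c) ⟩
      (a * c + (- (a * d))) + (b * d + (- (b * c)))
        ≈⟨ +-cong (+-congˡ (-‿distribʳ-* a d))
                  (trans (+-comm _ _) (+-cong (-‿distribˡ-* b c)
                    (trans (sym (-‿involutive _)) (trans (-‿cong (-‿distribʳ-* b d)) (-‿distribˡ-* b (- d)))))) ⟩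
      (a * c + a * (- d)) + ((- b) * c + (- b) * (- d))
        ≈⟨ +-cong (sym (distribˡ a c (- d))) (sym (distribˡ (- b) c (- d))) ⟩
      a * (c + (- d)) + (- b) * (c + (- d)) ≈⟨ sym (distribʳ (c + (- d)) a (- b)) ⟩
      (a + (- b)) * (c + (- d)) ∎

    morphism : differences -Raw-AlmostCommutative⟶ fromCommutativeRing R
    morphism = record
      { ⟦_⟧ = ⟦_⟧ᵈ
      ; +-homo = λ p@(a , b) q@(c , d) → lift₂ _+_ +-cong p q (a ℕ.+ c , b ℕ.+ d) (trans
          (+-cong (×-homo-+ 1# a c) (-‿cong (×-homo-+ 1# b d))) (sub-+ _ _ _ _))
      ; *-homo = λ p@(a , b) q@(c , d) → lift₂ _*_ *-cong p q (a ℕ.* c ℕ.+ b ℕ.* d , a ℕ.* d ℕ.+ b ℕ.* c) (trans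
          (+-cong (trans (×-homo-+ 1# (a ℕ.* c) (b ℕ.* d)) (+-cong (×1-homo-* a c) (×1-homo-* b d)))
                  (-‿cong (trans (×-homo-+ 1# (a ℕ.* d) (b ℕ.* c)) (+-cong (×1-homo-* a d) (×1-homo-* b c)))))
          (sub-* _ _ _ _))
      ; -‿homo = λ p@(a , b) → trans (⟦⟧ᵈ-difference (b , a)) (trans (begin
          (b · 1#) + (- (a · 1#))          ≈⟨ +-comm _ _ ⟩
          (- (a · 1#)) + (b · 1#)          ≈⟨ +-congˡ (sym (-‿involutive _)) ⟩
          (- (a · 1#)) + (- (- (b · 1#)))  ≈⟨ ⁻¹-∙-comm _ _ ⟩
          - ((a · 1#) + (- (b · 1#)))      ∎) (-‿cong (sym (⟦⟧ᵈ-difference p))))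
      ; 0-homo = refl
      ; 1-homo = refl
      }
      where
      lift₂ : ∀ (_∙_ : Carrier → Carrier → Carrier) → (∀ {a b c d} → a ≈ b → c ≈ d → (a ∙ c) ≈ (b ∙ d)) →
              ∀ p q s → difference s ≈ (difference p ∙ difference q) → ⟦ normalise s ⟧ᵈ ≈ (⟦ p ⟧ᵈ ∙ ⟦ q ⟧ᵈ)
      lift₂ _∙_ ∙-cong p q s eq = trans (⟦⟧ᵈ-difference (normalise s)) (trans (trans (difference-normalise s) eq)
        (sym (∙-cong (⟦⟧ᵈ-difference p) (⟦⟧ᵈ-difference q))))

    equal? : ∀ p q → Maybe (⟦ p ⟧ᵈ ≈ ⟦ q ⟧ᵈ)
    equal? p q with ≡-dec ℕ._≟_ ℕ._≟_ p q
    ... | yes p≡q = just (reflexive (≡.cong ⟦_⟧ᵈ p≡q))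
    ... | no _    = nothing

  open Algebra.Solver.Ring differences (fromCommutativeRing R) morphism equal? public
    using (solve; _:+_; _:*_; :-_; _:-_; _:=_)
  open Algebra.Solver.Ring differences (fromCommutativeRing R) morphism equal? using (Polynomial; con)

  :0 :1 : ∀ {n} → Polynomial n
  :0 = con (0 , 0)
  :1 = con (1 , 0)

-- Formal power series: ring structure, fixed points, inverses

module PowerSeries (R : CommutativeRing 0ℓ 0ℓ) where
  open CommutativeRing R
    renaming (Carrier to A; _≈_ to _≈ᴿ_; _+_ to _+ᴿ_; _*_ to _*ᴿ_; -_ to -ᴿ_; 0# to 0ᴿ; 1# to 1ᴿ)
  open IntegerSolver R
  open SetoidReasoning setoid

  Series : Set
  Series = ℕ → A

  infix 4 _≋_
  -- Being a record, it lets unification recover `f` and `g` from the type of a proof; bare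
  -- pointwise equality would unfold and lose them.
  record _≋_ (f g : Series) : Set where
    constructor mk≋
    field coeff : ∀ n → f n ≈ᴿ g n
  open _≋_ public

  infixl 6 _⊕_
  infixl 7 _⊛_ _⊙_

  _⊕_ : Series → Series → Series
  (f ⊕ g) n = f n +ᴿ g n

  ⊝_ : Series → Series
  (⊝ f) n = -ᴿ f n

  δ : Series → Series
  δ f n = f (suc n)

  const : A → Series
  const a zero    = a
  const a (suc n) = 0ᴿ

  var : Series
  var zero          = 0ᴿ
  var (suc zero)    = 1ᴿ
  var (suc (suc n)) = 0ᴿ

  _⊙_ : A → Series → Series
  (a ⊙ f) n = a *ᴿ f n

  -- The Cauchy product, read off from `f = f 0 + var · δ f`. In place of finite sums there is an
  -- induction on the degree in which the left factor is shifted.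
  _⊛_ : Series → Series → Series
  (f ⊛ g) zero    = f 0 *ᴿ g 0
  (f ⊛ g) (suc n) = f 0 *ᴿ g (suc n) +ᴿ (δ f ⊛ g) n

  private
    ⊛-cong′ : ∀ n {f f′ g g′} → (∀ k → f k ≈ᴿ f′ k) → (∀ k → g k ≈ᴿ g′ k) → (f ⊛ g) n ≈ᴿ (f′ ⊛ g′) n
    ⊛-cong′ zero    p q = *-cong (p 0) (q 0)
    ⊛-cong′ (suc n) p q = +-cong (*-cong (p 0) (q (suc n))) (⊛-cong′ n (λ k → p (suc k)) q)

    ⊛-zeroˡ : ∀ n {f} g → (∀ k → f k ≈ᴿ 0ᴿ) → (f ⊛ g) n ≈ᴿ 0ᴿ
    ⊛-zeroˡ zero    g p = trans (*-congʳ (p 0)) (zeroˡ _)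
    ⊛-zeroˡ (suc n) g p = trans (+-cong (trans (*-congʳ (p 0)) (zeroˡ _)) (⊛-zeroˡ n g (λ k → p (suc k))))
      (+-identityˡ _)

    ⊛-distribʳ : ∀ n h f g → ((f ⊕ g) ⊛ h) n ≈ᴿ (f ⊛ h) n +ᴿ (g ⊛ h) n
    ⊛-distribʳ zero    h f g = distribʳ _ _ _
    ⊛-distribʳ (suc n) h f g = trans
      (+-cong (distribʳ _ _ _) (⊛-distribʳ n h (δ f) (δ g)))
      (solve 4 (λ a b c d → (a :+ b) :+ (c :+ d) := (a :+ c) :+ (b :+ d)) refl _ _ _ _)

    ⊙-⊛ : ∀ n a f g → ((a ⊙ f) ⊛ g) n ≈ᴿ a *ᴿ (f ⊛ g) n
    ⊙-⊛ zero    a f g = *-assoc _ _ _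
    ⊙-⊛ (suc n) a f g = trans (+-cong (*-assoc _ _ _) (⊙-⊛ n a (δ f) g)) (sym (distribˡ _ _ _))

    -- Splits off the last term of the Cauchy sum, where the definition splits off the first;
    -- comparing the two gives commutativity.
    ⊛-lastʳ : ∀ n f g → (f ⊛ g) (suc n) ≈ᴿ f (suc n) *ᴿ g 0 +ᴿ (f ⊛ δ g) n
    ⊛-lastʳ zero    f g = +-comm _ _
    ⊛-lastʳ (suc n) f g = trans (+-congˡ (⊛-lastʳ n (δ f) g))
      (solve 3 (λ a b c → a :+ (b :+ c) := b :+ (a :+ c)) refl _ _ _)

    ⊛-comm : ∀ n f g → (f ⊛ g) n ≈ᴿ (g ⊛ f) n
    ⊛-comm zero    f g = *-comm _ _
    ⊛-comm (suc n) f g = trans (+-cong (*-comm _ _) (⊛-comm n (δ f) g)) (sym (⊛-lastʳ n g f))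

    ⊛-assoc : ∀ n f g h → ((f ⊛ g) ⊛ h) n ≈ᴿ (f ⊛ (g ⊛ h)) n
    ⊛-assoc zero    f g h = *-assoc _ _ _
    ⊛-assoc (suc n) f g h = begin
      (f 0 *ᴿ g 0) *ᴿ h (suc n) +ᴿ (δ (f ⊛ g) ⊛ h) n
        ≈⟨ +-congˡ (⊛-distribʳ n h (f 0 ⊙ δ g) (δ f ⊛ g)) ⟩
      (f 0 *ᴿ g 0) *ᴿ h (suc n) +ᴿ (((f 0 ⊙ δ g) ⊛ h) n +ᴿ ((δ f ⊛ g) ⊛ h) n)
        ≈⟨ +-congˡ (+-cong (⊙-⊛ n (f 0) (δ g) h) (⊛-assoc n (δ f) g h)) ⟩
      (f 0 *ᴿ g 0) *ᴿ h (suc n) +ᴿ (f 0 *ᴿ (δ g ⊛ h) n +ᴿ (δ f ⊛ (g ⊛ h)) n)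
        ≈⟨ solve 5 (λ a b c d e → (a :* b) :* c :+ (a :* d :+ e) := a :* (b :* c :+ d) :+ e) refl _ _ _ _ _ ⟩
      f 0 *ᴿ (g 0 *ᴿ h (suc n) +ᴿ (δ g ⊛ h) n) +ᴿ (δ f ⊛ (g ⊛ h)) n ∎

    ⊛-identityˡ : ∀ n f → (const 1ᴿ ⊛ f) n ≈ᴿ f n
    ⊛-identityˡ zero    f = *-identityˡ _
    ⊛-identityˡ (suc n) f = trans (+-cong (*-identityˡ _) (⊛-zeroˡ n f (λ _ → refl))) (+-identityʳ _)

  ring⟦⟧ : CommutativeRing 0ℓ 0ℓ
  ring⟦⟧ = record
    { Carrier = Series ; _≈_ = _≋_ ; _+_ = _⊕_ ; _*_ = _⊛_ ; -_ = ⊝_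
    ; 0# = const 0ᴿ ; 1# = const 1ᴿ
    ; isCommutativeRing = record
      { isRing = record
        { +-isAbelianGroup = record
          { isGroup = record
            { isMonoid = record
              { isSemigroup = record
                { isMagma = record
                  { isEquivalence = record
                    { refl = mk≋ λ _ → refl
                    ; sym = λ p → mk≋ λ n → sym (coeff p n)
                    ; trans = λ p q → mk≋ λ n → trans (coeff p n) (coeff q n)
                    }
                  ; ∙-cong = λ p q → mk≋ λ n → +-cong (coeff p n) (coeff q n)
                  }
                ; assoc = λ f g h → mk≋ λ n → +-assoc _ _ _
                }
              ; identity = (λ f → mk≋ λ { zero → +-identityˡ _ ; (suc n) → +-identityˡ _ })
                         , (λ f → mk≋ λ { zero → +-identityʳ _ ; (suc n) → +-identityʳ _ })
              }
            ; inverse = (λ f → mk≋ λ { zero → -‿inverseˡ _ ; (suc n) → -‿inverseˡ _ })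
                      , (λ f → mk≋ λ { zero → -‿inverseʳ _ ; (suc n) → -‿inverseʳ _ })
            ; ⁻¹-cong = λ p → mk≋ λ n → -‿cong (coeff p n)
            }
          ; comm = λ f g → mk≋ λ n → +-comm _ _
          }
        ; *-cong = λ p q → mk≋ λ n → ⊛-cong′ n (coeff p) (coeff q)
        ; *-assoc = λ f g h → mk≋ λ n → ⊛-assoc n f g h
        ; *-identity = (λ f → mk≋ λ n → ⊛-identityˡ n f)
                     , (λ f → mk≋ λ n → trans (⊛-comm n f (const 1ᴿ)) (⊛-identityˡ n f))
        ; distrib = (λ h f g → mk≋ λ n → trans (⊛-comm n h (f ⊕ g)) (trans (⊛-distribʳ n h f g)
                      (+-cong (⊛-comm n f h) (⊛-comm n g h))))
                  , (λ h f g → mk≋ λ n → ⊛-distribʳ n h f g)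
        }
      ; *-comm = λ f g → mk≋ λ n → ⊛-comm n f g
      }
    }

  open CommutativeRing ring⟦⟧ public using () renaming
    (refl to ≋-refl; sym to ≋-sym; trans to ≋-trans; setoid to ≋-setoid)

  var-⊛ : ∀ f n → (var ⊛ f) (suc n) ≈ᴿ f n
  var-⊛ f zero = solve 2 (λ a b → :0 :* a :+ :1 :* b := b) refl _ _
  var-⊛ f (suc n) = trans (+-cong (zeroˡ _)
    (trans (⊛-cong′ (suc n) {δ var} {const 1ᴿ} {f} (λ { zero → refl ; (suc _) → refl }) (λ _ → refl))
    (⊛-identityˡ (suc n) f)))
                          (+-identityˡ _)

  var-⊛₀ : ∀ f → (var ⊛ f) 0 ≈ᴿ 0ᴿ
  var-⊛₀ f = zeroˡ _

  const-⊛ : ∀ a f n → (const a ⊛ f) n ≈ᴿ a *ᴿ f n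
  const-⊛ a f zero    = refl
  const-⊛ a f (suc n) = trans (+-congˡ (⊛-zeroˡ n f (λ _ → refl))) (+-identityʳ _)

  const-cong : ∀ {a b} → a ≈ᴿ b → const a ≋ const b
  const-cong p = mk≋ λ { zero → p ; (suc n) → refl }

  const-+ : ∀ a b → const (a +ᴿ b) ≋ const a ⊕ const b
  const-+ a b = mk≋ λ { zero → refl ; (suc n) → sym (+-identityʳ _) }

  const-* : ∀ a b → const (a *ᴿ b) ≋ const a ⊛ const b
  const-* a b = mk≋ λ { zero → refl ; (suc n) → sym (trans (const-⊛ a (const b) (suc n)) (zeroʳ _)) }

  const-neg : ∀ a → const (-ᴿ a) ≋ ⊝ (const a)
  const-neg a = mk≋ λ { zero → refl ; (suc n) → solve 0 (:0 := :- :0) refl }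

  private
    ⊛-local : ∀ n {f f′ g g′} → (∀ k → k ℕ.≤ n → f k ≈ᴿ f′ k) → (∀ k → k ℕ.≤ n → g k ≈ᴿ g′ k) →
      (f ⊛ g) n ≈ᴿ (f′ ⊛ g′) n
    ⊛-local zero    p q = *-cong (p 0 ℕ.z≤n) (q 0 ℕ.z≤n)
    ⊛-local (suc n) p q = +-cong (*-cong (p 0 ℕ.z≤n) (q (suc n) ℕₚ.≤-refl))
      (⊛-local n (λ k k≤n → p (suc k) (ℕ.s≤s k≤n)) (λ k k≤n → q k (ℕₚ.m≤n⇒m≤1+n k≤n)))

  Agree : ℕ → Series → Series → Set
  Agree n f g = ∀ k → k ℕ.< n → f k ≈ᴿ g k

  -- Contraction in the `var`-adic sense. Inverses and the branches `bᵢ` are both obtained as fixed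
  -- points of such maps.
  Contraction : (Series → Series) → Set
  Contraction Φ = ∀ f g n → Agree n f g → Φ f n ≈ᴿ Φ g n

  module _ (Φ : Series → Series) (contr : Contraction Φ) where
    private
      iter : ℕ → Series
      iter zero    = const 0ᴿ
      iter (suc k) = Φ (iter k)

      contr′ : ∀ f g n → Agree n f g → Agree (suc n) (Φ f) (Φ g)
      contr′ f g n p k (ℕ.s≤s k≤n) = contr f g k (λ j j<k → p j (ℕₚ.<-≤-trans j<k k≤n))

      step : ∀ k → Agree k (iter k) (iter (suc k))
      step zero    _ ()
      step (suc k) = contr′ _ _ k (step k)

      stable : ∀ d k j → j ℕ.< k → iter k j ≈ᴿ iter (d ℕ.+ k) j
      stable zero    k j j<k = refl
      stable (suc d) k j j<k = trans (stable d k j j<k) (step (d ℕ.+ k) j (ℕₚ.<-≤-trans j<k (ℕₚ.m≤n+m k d)))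

    fix : Series
    -- Iterate `k` is final below degree `k`, so coefficient `n` is settled after `n + 1` rounds.
    fix n = iter (suc n) n

    fix-eq : fix ≋ Φ fix
    fix-eq = mk≋ λ n → contr (iter n) fix n (λ k k<n → sym (trans
      (stable (n ℕ.∸ suc k) (suc k) k ℕₚ.≤-refl)
      (reflexive (≡.cong (λ m → iter m k) (ℕₚ.m∸n+n≡m k<n)))))

  var-contraction : ∀ (Φ : Series → Series) → (∀ f g n → Agree (suc n) f g → Φ f n ≈ᴿ Φ g n) →
    Contraction (λ f → var ⊛ Φ f)
  var-contraction Φ local f g zero    p = trans (var-⊛₀ (Φ f)) (sym (var-⊛₀ (Φ g)))
  var-contraction Φ local f g (suc n) p = trans (var-⊛ (Φ f) n) (trans (local f g n p) (sym (var-⊛ (Φ g) n)))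

  private
    agree≤ : ∀ {n f g} → Agree (suc n) f g → ∀ k → k ℕ.≤ n → f k ≈ᴿ g k
    agree≤ p k k≤n = p k (ℕ.s≤s k≤n)

  ⊛-agree : ∀ {n f f′ g g′} → Agree (suc n) f f′ → Agree (suc n) g g′ → (f ⊛ g) n ≈ᴿ (f′ ⊛ g′) n
  ⊛-agree {n} p q = ⊛-local n (agree≤ p) (agree≤ q)

  ⊛-agree< : ∀ {n f f′ g g′} → Agree n f f′ → Agree n g g′ → Agree n (f ⊛ g) (f′ ⊛ g′)
  ⊛-agree< p q k k<n = ⊛-local k (λ j j≤k → p j (ℕₚ.≤-<-trans j≤k k<n)) (λ j j≤k → q j (ℕₚ.≤-<-trans j≤k k<n))

  module Inverse (f : Series) (a : A) (unit : f 0 *ᴿ a ≈ᴿ 1ᴿ) where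
    private
      Φ : Series → Series
      -- Multiply `f g = 1` by `a`, the inverse of `f 0`, and insert `f = f 0 + var · δ f`: then
      -- `g = a − var · a · (δ f · g)`.
      Φ g = const a ⊕ (var ⊛ (⊝ (a ⊙ (δ f ⊛ g))))

      Φ-contr : Contraction Φ
      Φ-contr g h n p = +-congˡ (var-contraction (λ g → ⊝ (a ⊙ (δ f ⊛ g)))
        (λ g h n p → -‿cong (*-congˡ (⊛-agree {n} {δ f} (λ _ _ → refl) p))) g h n p)

    inv : Series
    inv = fix Φ Φ-contr

    inv-eq : f ⊛ inv ≋ const 1ᴿ
    inv-eq = mk≋ λ
      { zero → trans (*-congˡ inv₀) unit
      ; (suc n) → begin
          f 0 *ᴿ inv (suc n) +ᴿ (δ f ⊛ inv) n
            ≈⟨ +-congʳ (*-congˡ (trans (coeff (fix-eq Φ Φ-contr) (suc n))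
              (+-congˡ (var-⊛ (⊝ (a ⊙ (δ f ⊛ inv))) n)))) ⟩
          f 0 *ᴿ (0ᴿ +ᴿ (-ᴿ (a *ᴿ (δ f ⊛ inv) n))) +ᴿ (δ f ⊛ inv) n
            ≈⟨ solve 3 (λ x a y → x :* (:0 :+ (:- (a :* y))) :+ y := y :* (:1 :- x :* a)) refl _ _ _ ⟩
          (δ f ⊛ inv) n *ᴿ (1ᴿ +ᴿ (-ᴿ (f 0 *ᴿ a))) ≈⟨ *-congˡ (trans (+-congˡ (-‿cong unit)) (-‿inverseʳ _)) ⟩
          (δ f ⊛ inv) n *ᴿ 0ᴿ ≈⟨ zeroʳ _ ⟩
          0ᴿ ∎
      }
      where
      inv₀ : inv 0 ≈ᴿ a
      inv₀ = trans (coeff (fix-eq Φ Φ-contr) 0) (trans (+-congˡ (var-⊛₀ (⊝ (a ⊙ (δ f ⊛ inv))))) (+-identityʳ _))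

-- Divided differences and the kernel of the functional equation

module DividedDifferences (L : CommutativeRing 0ℓ 0ℓ) where
  private module L = CommutativeRing L
  open PowerSeries L public
    using (Series; δ; const; const-cong; const-+; const-*; const-neg; const-⊛; var-⊛; mk≋; coeff; module Inverse)
    renaming (var to ω)
  open CommutativeRing (PowerSeries.ring⟦⟧ L) public
  open IntegerSolver (PowerSeries.ring⟦⟧ L) public
  open SetoidReasoning setoid

  δ-cong : ∀ {f g} → f ≈ g → δ f ≈ δ g
  δ-cong p = mk≋ λ n → coeff p (suc n)

  -- Leibniz rule of a divided difference at 0: divide `f g − f(0) g(0) = f(0) (g − g(0)) + (f −
  -- f(0)) g` by `ω`.
  δ-* : ∀ f g → δ (f * g) ≈ const (f 0) * δ g + δ f * g
  δ-* f g = mk≋ λ n → L.+-congʳ (L.sym (const-⊛ (f 0) (δ g) n))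

  δ-ω* : ∀ f → δ (ω * f) ≈ f
  δ-ω* f = mk≋ (var-⊛ f)

  δ-const* : ∀ a f → δ (const a * f) ≈ const a * δ f
  δ-const* a f = mk≋ λ n → L.trans (const-⊛ a f (suc n)) (L.sym (const-⊛ a (δ f) n))

  δ-1 : δ 1# ≈ 0#
  δ-1 = mk≋ λ { zero → L.refl ; (suc n) → L.refl }

  lin : L.Carrier → Series
  lin b = 1# + const b * ω

  private
    lin₀ : ∀ b → lin b 0 L.* L.1# L.≈ L.1#
    lin₀ b = L.trans (L.*-identityʳ _) (L.trans (L.+-congˡ (L.zeroʳ _)) (L.+-identityʳ _))

    one+ω₀ : (1# + ω) 0 L.* L.1# L.≈ L.1#
    one+ω₀ = L.trans (L.*-identityʳ _) (L.+-identityʳ _)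

  linInv : L.Carrier → Series
  linInv b = Inverse.inv (lin b) L.1# (lin₀ b)

  lin-linInv : ∀ b → lin b * linInv b ≈ 1#
  lin-linInv b = Inverse.inv-eq (lin b) L.1# (lin₀ b)

  q : Series
  q = Inverse.inv (1# + ω) L.1# one+ω₀

  q-eq : (1# + ω) * q ≈ 1#
  q-eq = Inverse.inv-eq (1# + ω) L.1# one+ω₀

  Π : List L.Carrier → Series
  Π []       = 1#
  Π (b ∷ bs) = lin b * Π bs

  Πinv : List L.Carrier → Series
  Πinv []       = 1#
  Πinv (b ∷ bs) = linInv b * Πinv bs

  Π-Πinv : ∀ bs → Π bs * Πinv bs ≈ 1#
  Π-Πinv []       = *-identityˡ _
  Π-Πinv (b ∷ bs) = begin
    lin b * Π bs * (linInv b * Πinv bs)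
      ≈⟨ solve 4 (λ a b c d → a :* b :* (c :* d) := (a :* c) :* (b :* d)) refl _ _ _ _ ⟩
    lin b * linInv b * (Π bs * Πinv bs) ≈⟨ *-cong (lin-linInv b) (Π-Πinv bs) ⟩
    1# * 1# ≈⟨ *-identityˡ _ ⟩
    1# ∎

  -- The series `1 / ((1 + ω) ∏ (1 + b ω))` on which the commuting operators act.
  h : List L.Carrier → Series
  h []       = q
  h (b ∷ bs) = linInv b * h bs

  h-eq : ∀ bs → (1# + ω) * Π bs * h bs ≈ 1#
  h-eq []       = trans (*-congʳ (*-identityʳ _)) q-eq
  h-eq (b ∷ bs) = begin
    (1# + ω) * (lin b * Π bs) * (linInv b * h bs)
      ≈⟨ solve 5 (λ w a b c d → w :* (a :* b) :* (c :* d) := (a :* c) :* (w :* b :* d)) refl _ _ _ _ _ ⟩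
    lin b * linInv b * ((1# + ω) * Π bs * h bs) ≈⟨ *-cong (lin-linInv b) (h-eq bs) ⟩
    1# * 1# ≈⟨ *-identityˡ _ ⟩
    1# ∎

  X : Series → Series
  X f = ω * f + δ f

  -- O b = (1 + b δ) ∘ (1 + b ω) is a polynomial in X, so these operators commute.
  O : L.Carrier → Series → Series
  O b f = (1# + const b * const b) * f + const b * X f

  O-cong : ∀ b {f g} → f ≈ g → O b f ≈ O b g
  O-cong b p = +-cong (*-congˡ p) (*-congˡ (+-cong (*-congˡ p) (δ-cong p)))

  O-+ : ∀ b f g → O b (f + g) ≈ O b f + O b g
  O-+ b f g = solve 6 (λ b w f g df dg →
      (:1 :+ b :* b) :* (f :+ g) :+ b :* (w :* (f :+ g) :+ (df :+ dg))
      := ((:1 :+ b :* b) :* f :+ b :* (w :* f :+ df)) :+ ((:1 :+ b :* b) :* g :+ b :* (w :* g :+ dg)))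
    refl (const b) ω f g (δ f) (δ g)

  O-const : ∀ b a f → O b (const a * f) ≈ const a * O b f
  O-const b a f = trans (+-congˡ (*-congˡ (+-congˡ (δ-const* a f))))
    (solve 5 (λ b w a f df →
      (:1 :+ b :* b) :* (a :* f) :+ b :* (w :* (a :* f) :+ a :* df)
      := a :* ((:1 :+ b :* b) :* f :+ b :* (w :* f :+ df)))
    refl (const b) ω (const a) f (δ f))

  O-X : ∀ b f → O b (X f) ≈ X (O b f)
  O-X b f = begin
    (1# + const b * const b) * X f + const b * (ω * X f + δ (X f))
      ≈⟨ solve 5 (λ b w x y dx → (:1 :+ b :* b) :* (w :* x :+ y) :+ b :* (w :* (w :* x :+ y) :+ dx)
           := w :* ((:1 :+ b :* b) :* x :+ b :* (w :* x :+ y)) :+ ((:1 :+ b :* b) :* y :+ b :* dx))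
         refl (const b) ω f (δ f) (δ (X f)) ⟩
    ω * O b f + ((1# + const b * const b) * δ f + const b * δ (X f))
      ≈⟨ +-congˡ (+-cong (trans (*-congʳ 1+b²) (trans (sym (δ-const* _ f)) (δ-cong (*-congʳ (sym 1+b²)))))
        (sym (δ-const* b (X f)))) ⟩
    ω * O b f + δ (O b f) ∎
    where
    1+b² : 1# + const b * const b ≈ const (L.1# L.+ b L.* b)
    1+b² = sym (trans (const-+ _ _) (+-congˡ (const-* b b)))

  prodO : List L.Carrier → Series → Series
  prodO []       f = f
  prodO (b ∷ bs) f = O b (prodO bs f)

  prodO-cong : ∀ bs {f g} → f ≈ g → prodO bs f ≈ prodO bs g
  prodO-cong []       p = p
  prodO-cong (b ∷ bs) p = O-cong b (prodO-cong bs p)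

  prodO-+ : ∀ bs f g → prodO bs (f + g) ≈ prodO bs f + prodO bs g
  prodO-+ []       f g = refl
  prodO-+ (b ∷ bs) f g = trans (O-cong b (prodO-+ bs f g)) (O-+ b _ _)

  prodO-const : ∀ bs a f → prodO bs (const a * f) ≈ const a * prodO bs f
  prodO-const []       a f = refl
  prodO-const (b ∷ bs) a f = trans (O-cong b (prodO-const bs a f)) (O-const b a _)

  prodO-neg : ∀ bs f → prodO bs (- f) ≈ - prodO bs f
  prodO-neg bs f = begin
    prodO bs (- f)             ≈⟨ prodO-cong bs (neg f) ⟩
    prodO bs (const (L.- L.1#) * f) ≈⟨ prodO-const bs _ f ⟩
    const (L.- L.1#) * prodO bs f   ≈⟨ sym (neg _) ⟩
    - prodO bs f ∎
    where
    neg : ∀ g → - g ≈ const (L.- L.1#) * g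
    neg g = trans (solve 1 (λ g → :- g := (:- :1) :* g) refl g) (*-congʳ (sym (const-neg L.1#)))

  prodO-X : ∀ bs f → prodO bs (X f) ≈ X (prodO bs f)
  prodO-X []       f = refl
  prodO-X (b ∷ bs) f = trans (O-cong b (prodO-X bs f)) (O-X b _)

  O-prodO : ∀ b bs f → O b (prodO bs f) ≈ prodO bs (O b f)
  O-prodO b []        f = refl
  O-prodO b (b′ ∷ bs) f = trans (swap (prodO bs f)) (O-cong b′ (O-prodO b bs f))
    where
    swap : ∀ g → O b (O b′ g) ≈ O b′ (O b g)
    swap g = begin
      O b (O b′ g) ≈⟨ +-cong refl (*-congˡ (sym (O-X b′ g))) ⟩
      (1# + const b * const b) * O b′ g + const b * O b′ (X g)
        ≈⟨ solve 5 (λ b c g xg y → (:1 :+ b :* b) :* ((:1 :+ c :* c) :* g :+ c :* xg)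
          :+ b :* ((:1 :+ c :* c) :* xg :+ c :* y)
            := (:1 :+ c :* c) :* ((:1 :+ b :* b) :* g :+ b :* xg) :+ c :* ((:1 :+ b :* b) :* xg :+ b :* y))
           refl (const b) (const b′) g (X g) (X (X g)) ⟩
      (1# + const b′ * const b′) * O b g + const b′ * O b (X g)
        ≈⟨ +-congˡ (*-congˡ (O-X b g)) ⟩
      O b′ (O b g) ∎

  private
    δ-lin* : ∀ b f → δ (lin b * f) ≈ δ f + const b * f
    δ-lin* b f = begin
      δ (lin b * f) ≈⟨ δ-cong (solve 3 (λ b w f → (:1 :+ b :* w) :* f := f :+ b :* (w :* f)) refl (const b) ω f) ⟩
      δ f + δ (const b * (ω * f)) ≈⟨ +-congˡ (trans (δ-const* b _) (*-congˡ (δ-ω* f))) ⟩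
      δ f + const b * f ∎

    lin-h : ∀ b bs → lin b * h (b ∷ bs) ≈ h bs
    lin-h b bs = trans (sym (*-assoc _ _ _)) (trans (*-congʳ (lin-linInv b)) (*-identityˡ _))

    δh-eq : ∀ b bs → δ (h bs) ≈ δ (h (b ∷ bs)) + const b * h (b ∷ bs)
    δh-eq b bs = trans (δ-cong (sym (lin-h b bs))) (δ-lin* b _)

    -- `O b` is `1 + b δ` after `1 + b ω`, and the inner factor turns `h (b ∷ bs)` into `h bs`.
    O-h : ∀ b bs → O b (h (b ∷ bs)) ≈ h bs + const b * δ (h bs)
    O-h b bs = begin
      O b y ≈⟨ solve 4 (λ b w y dy → (:1 :+ b :* b) :* y :+ b :* (w :* y :+ dy)
                 := (:1 :+ b :* w) :* y :+ b :* (dy :+ b :* y)) refl _ _ _ _ ⟩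
      lin b * y + const b * (δ y + const b * y) ≈⟨ +-cong (lin-h b bs) (*-congˡ (sym (δh-eq b bs))) ⟩
      h bs + const b * δ (h bs) ∎
      where y = h (b ∷ bs)

    -- `O b` and `δ` commute only up to a constant, since `δ (ω f) − ω · δ f` is `f 0`; here that
    -- constant is hidden in `ω · δ (h bs) − h bs`. By `δh-eq` and `lin-h` the claim becomes a ring
    -- identity in `y`, `δ y` and `δ (δ y)`.
    O-δh : ∀ b bs → O b (δ (h (b ∷ bs))) ≈ δ (h bs) + const b * (X (δ (h bs)) + - h bs)
    O-δh b bs = sym (begin
      δ (h bs) + const b * (ω * δ (h bs) + δ (δ (h bs)) + - h bs)
        ≈⟨ +-cong e₁ (*-congˡ (+-cong (+-cong (*-congˡ e₁) (trans (δ-cong e₁) (+-congˡ (δ-const* b y))))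
          (-‿cong (sym (lin-h b bs))))) ⟩
      δ y + const b * y + const b * (ω * (δ y + const b * y) + (δ (δ y) + const b * δ y) + - (lin b * y))
        ≈⟨ solve 5 (λ b w y dy ddy →
             dy :+ b :* y :+ b :* (w :* (dy :+ b :* y) :+ (ddy :+ b :* dy) :+ (:- ((:1 :+ b :* w) :* y)))
             := (:1 :+ b :* b) :* dy :+ b :* (w :* dy :+ ddy)) refl _ _ _ _ _ ⟩
      O b (δ y) ∎)
      where
      y = h (b ∷ bs)
      e₁ = δh-eq b bs

    δq : δ q ≈ - q
    δq = begin
      δ q ≈⟨ solve 2 (λ a b → a := (a :+ b) :+ (:- b)) refl _ _ ⟩
      (δ q + q) + - q ≈⟨ +-congʳ (sym (trans (δ-cong (solve 2 (λ w q → (:1 :+ w) :* q := q :+ w :* q) refl ω q))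
                                       (+-congˡ (δ-ω* q)))) ⟩
      δ ((1# + ω) * q) + - q ≈⟨ +-congʳ (trans (δ-cong q-eq) δ-1) ⟩
      0# + - q ≈⟨ +-identityˡ _ ⟩
      - q ∎

  -- Proved together because O b (h (b ∷ bs)) involves h bs and δ (h bs), and
  -- O b (δ (h (b ∷ bs))) involves them and X (δ (h bs)).
  mutual
    prodO-h : ∀ bs → prodO bs (h bs) ≈ - δ (Π bs * q)
    prodO-h [] = sym (trans (-‿cong (trans (δ-cong (*-identityˡ q)) δq)) (solve 1 (λ q → :- (:- q) := q) refl q))
    prodO-h (b ∷ bs) = begin
      O b (prodO bs (h (b ∷ bs)))              ≈⟨ O-prodO b bs _ ⟩
      prodO bs (O b (h (b ∷ bs)))              ≈⟨ prodO-cong bs (O-h b bs) ⟩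
      prodO bs (h bs + const b * δ (h bs))     ≈⟨ trans (prodO-+ bs _ _) (+-congˡ (prodO-const bs b _)) ⟩
      prodO bs (h bs) + const b * prodO bs (δ (h bs)) ≈⟨ +-cong (prodO-h bs) (*-congˡ (prodO-δh bs)) ⟩
      - δ (Π bs * q) + const b * (- (Π bs * q))
        ≈⟨ solve 3 (λ d b p → (:- d) :+ b :* (:- p) := :- (d :+ b :* p)) refl _ _ _ ⟩
      - (δ (Π bs * q) + const b * (Π bs * q))
        ≈⟨ -‿cong (sym (trans (δ-cong (*-assoc (lin b) (Π bs) q)) (δ-lin* b (Π bs * q)))) ⟩
      - δ (lin b * Π bs * q) ∎

    prodO-δh : ∀ bs → prodO bs (δ (h bs)) ≈ - (Π bs * q)
    prodO-δh [] = trans δq (-‿cong (sym (*-identityˡ q)))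
    prodO-δh (b ∷ bs) = begin
      O b (prodO bs (δ (h (b ∷ bs))))          ≈⟨ O-prodO b bs _ ⟩
      prodO bs (O b (δ (h (b ∷ bs))))          ≈⟨ prodO-cong bs (O-δh b bs) ⟩
      prodO bs (δ (h bs) + const b * (X (δ (h bs)) + - h bs))
        ≈⟨ trans (prodO-+ bs _ _) (+-congˡ
          (trans (prodO-const bs b _) (*-congˡ
          (trans (prodO-+ bs _ _) (+-cong (prodO-X bs _) (prodO-neg bs _)))))) ⟩
      prodO bs (δ (h bs)) + const b * (X (prodO bs (δ (h bs))) + - prodO bs (h bs))
        ≈⟨ +-cong (prodO-δh bs) (*-congˡ (+-cong (+-cong (*-congˡ (prodO-δh bs)) (δ-cong (prodO-δh bs)))
          (-‿cong (prodO-h bs)))) ⟩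
      - (Π bs * q) + const b * (ω * (- (Π bs * q)) + (- δ (Π bs * q)) + - (- δ (Π bs * q)))
        ≈⟨ solve 5 (λ b w p q d → (:- (p :* q)) :+ b :* (w :* (:- (p :* q)) :+ (:- d) :+ (:- (:- d)))
             := :- ((:1 :+ b :* w) :* p :* q)) refl _ _ _ _ _ ⟩
      - (lin b * Π bs * q) ∎

module Kernel (L : CommutativeRing 0ℓ 0ℓ) (T : CommutativeRing.Carrier L) where
  private module L where
    open CommutativeRing L public
    open IntegerSolver L public
  open DividedDifferences L
  open SetoidReasoning setoid

  -- `xT` is the equation `b = x T (1 − b)²` written with `B = 1 / (1 − b)`. The ring and `T` are
  -- arbitrary here; actual solutions are constructed over power series in `T`.
  record Branch : Set where
    field
      x b B : L.Carrier
      B-inv : B L.* (L.1# L.+ (L.- b)) L.≈ L.1#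
      xT    : x L.* T L.≈ b L.* (B L.* B)
  open Branch public

  bs : List Branch → List L.Carrier
  bs = map b

  Z : List Branch → L.Carrier
  Z []       = L.1#
  Z (p ∷ ps) = (L.1# L.+ (L.- b p)) L.* (L.1# L.+ (L.- b p)) L.* Z ps

  C : List Branch → L.Carrier
  C []       = L.1#
  C (p ∷ ps) = B p L.* B p L.* C ps

  Z-C : ∀ ps → Z ps L.* C ps L.≈ L.1#
  Z-C []       = L.*-identityˡ _
  Z-C (p ∷ ps) = L.trans
    (L.solve 4 (λ e z g c → e L.:* e L.:* z L.:* (g L.:* g L.:* c) L.:= (g L.:* e) L.:* (g L.:* e) L.:* (z L.:* c))
      L.refl _ _ _ _)
    (L.trans (L.*-cong (L.*-cong (B-inv p) (B-inv p)) (Z-C ps))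
      (L.trans (L.*-congʳ (L.*-identityˡ _)) (L.*-identityˡ _)))

  -- The catalytic variable u counting components is (1 + ω) / Π, so that u = 1 at ω = 0.
  module Solution (ps : List Branch) where
    U : Series
    U = (1# + ω) * Πinv (bs ps)

    z : L.Carrier
    z = T L.* Z ps

    -- The operators come from a suffix of `ps`, but `h` from all of it: `u` is fixed throughout,
    -- while each step from `Gᵢ₊₁` to `Gᵢ` contributes one more operator.
    k : List Branch → Series
    k suf = prodO (bs suf) (h (bs ps))

    U-Π : U * Π (bs ps) ≈ 1# + ω
    U-Π = begin
      (1# + ω) * Πinv (bs ps) * Π (bs ps) ≈⟨ solve 3 (λ a b c → a :* b :* c := a :* (c :* b)) refl _ _ _ ⟩
      (1# + ω) * (Π (bs ps) * Πinv (bs ps)) ≈⟨ *-congˡ (Π-Πinv (bs ps)) ⟩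
      (1# + ω) * 1# ≈⟨ *-identityʳ _ ⟩
      1# + ω ∎

    U-Πq : U * (Π (bs ps) * q) ≈ 1#
    U-Πq = trans (sym (*-assoc _ _ _)) (trans (*-congʳ U-Π) q-eq)

    Πinv₀ : ∀ cs → Πinv cs 0 L.≈ L.1#
    Πinv₀ []       = L.refl
    Πinv₀ (c ∷ cs) = L.trans (L.*-cong (linInv₀ c) (Πinv₀ cs)) (L.*-identityˡ _)
      where
      linInv₀ : ∀ c → linInv c 0 L.≈ L.1#
      linInv₀ c = L.trans (L.solve 2 (λ c i → i L.:= (L.:1 L.:+ c L.:* L.:0) L.:* i) L.refl c (linInv c 0))
                          (coeff (lin-linInv c) 0)

    U₀ : U 0 L.≈ L.1#
    U₀ = L.trans (L.*-cong (L.+-identityʳ _) (Πinv₀ (bs ps))) (L.*-identityˡ _)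

    -- Since `Π q` is `1 / U` and `U 0 = 1`, applying `δ` to `U · Π q = 1` gives
    -- `δ U · Π q = − δ (Π q)`, and this is the value that `prodO-h` finds for all operators applied
    -- to `h`.
    δU-Πq : δ U * (Π (bs ps) * q) ≈ k ps
    δU-Πq = begin
      δ U * Πq ≈⟨ solve 2 (λ a d → a := (d :+ a) :+ (:- d)) refl _ _ ⟩
      (δ Πq + δ U * Πq) + - δ Πq
        ≈⟨ +-congʳ (+-congʳ (trans (sym (*-identityˡ _)) (*-congʳ (const-cong (L.sym U₀))))) ⟩
      (const (U 0) * δ Πq + δ U * Πq) + - δ Πq ≈⟨ +-congʳ (trans (sym (δ-* U Πq)) (trans (δ-cong U-Πq) δ-1)) ⟩
      0# + - δ Πq ≈⟨ +-identityˡ _ ⟩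
      - δ Πq ≈⟨ sym (prodO-h (bs ps)) ⟩
      k ps ∎
      where Πq = Π (bs ps) * q

    sumb : List Branch → L.Carrier
    sumb []         = L.0#
    sumb (p ∷ suf)  = b p L.+ sumb suf

    private
      Π₀ : ∀ suf → Π (bs suf) 0 L.≈ L.1#
      Π₀ []        = L.refl
      Π₀ (p ∷ suf) = L.trans (L.*-congˡ (Π₀ suf))
        (L.solve 1 (λ c → (L.:1 L.:+ c L.:* L.:0) L.:* L.:1 L.:= L.:1) L.refl _)

      Π₁ : ∀ suf → Π (bs suf) 1 L.≈ sumb suf
      Π₁ []        = L.refl
      Π₁ (p ∷ suf) = L.trans (L.+-congˡ (L.*-congˡ (Π₀ suf))) (L.trans
        (L.solve 2 (λ c s → (L.:1 L.:+ c L.:* L.:0) L.:* s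
             L.:+ (L.:0 L.:+ (c L.:* L.:1 L.:+ L.:0 L.:* L.:0)) L.:* L.:1 L.:= c L.:+ s)
          L.refl (b p) (Π (bs suf) 1))
        (L.+-congˡ (Π₁ suf)))

      q₀ : q 0 L.≈ L.1#
      q₀ = L.trans (L.solve 1 (λ a → a L.:= (L.:1 L.:+ L.:0) L.:* a) L.refl _) (coeff q-eq 0)

      q₁ : q 1 L.≈ (L.- L.1#)
      q₁ = L.trans (L.solve 2 (λ a c → c L.:= ((L.:1 L.:+ L.:0) L.:* c L.:+ (L.:0 L.:+ L.:1) L.:* a) L.:+ (L.:- a))
        L.refl (q 0) (q 1))
        (L.trans (L.+-cong (coeff q-eq 1) (L.-‿cong q₀)) (L.+-identityˡ _))

    k₀ : k ps 0 L.≈ L.1# L.+ (L.- sumb ps)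
    k₀ = L.trans (coeff (prodO-h (bs ps)) 0) (L.trans
      (L.-‿cong (L.+-cong (L.*-cong (Π₀ ps) q₁) (L.*-cong (Π₁ ps) q₀)))
      (L.solve 1 (λ s → L.:- (L.:1 L.:* (L.:- L.:1) L.:+ s L.:* L.:1) L.:= L.:1 L.:+ (L.:- s)) L.refl _))

    U₁ : U 1 L.≈ L.1# L.+ (L.- sumb ps)
    U₁ = L.trans (L.sym (L.trans (L.*-congˡ (L.trans (L.*-cong (Π₀ ps) q₀) (L.*-identityʳ _))) (L.*-identityʳ _)))
                  (L.trans (coeff δU-Πq 0) k₀)

    -- From `U 0 = 1` follows `U − 1 = ω · δ U`, so division by `u − 1` is `δ` followed by division
    -- by `δ U`. The constant term `1 − Σ b` of `δ U` becomes invertible once the branches are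
    -- series in `T` without constant term.
    module WithInverse (s⁻¹ : Series) (s-inv : δ U * s⁻¹ ≈ 1#) where
      -- (u G(u) − G(1)) / (u − 1)
      Ψ : Series → Series
      Ψ G = s⁻¹ * δ (U * G)

      G : List Branch → Series
      G suf = (1# + ω) * Π (bs ps) * (const (C suf) * k suf)

      F : Series
      F = const T * ((1# + ω) * (1# + ω) * k ps)

      G-[] : G [] ≈ 1#
      G-[] = trans (*-congˡ (*-identityˡ _)) (h-eq (bs ps))

      -- `F` contains the factor `k ps = δ U / U`, which absorbs the division by `δ U` in `Ψ`.
      F-s⁻¹ : F * s⁻¹ ≈ const T * ((1# + ω) * Π (bs ps))
      F-s⁻¹ = begin
        const T * ((1# + ω) * (1# + ω) * k ps) * s⁻¹
          ≈⟨ *-congʳ (*-congˡ (*-congˡ (sym δU-Πq))) ⟩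
        const T * ((1# + ω) * (1# + ω) * (δ U * (Π (bs ps) * q))) * s⁻¹
          ≈⟨ solve 6 (λ t w s p q i → t :* (w :* w :* (s :* (p :* q))) :* i := t :* (w :* p) :* (w :* q)
            :* (s :* i)) refl _ _ _ _ _ _ ⟩
        const T * ((1# + ω) * Π (bs ps)) * ((1# + ω) * q) * (δ U * s⁻¹)
          ≈⟨ trans (*-cong (trans (*-congˡ q-eq) (*-identityʳ _)) s-inv) (*-identityʳ _) ⟩
        const T * ((1# + ω) * Π (bs ps)) ∎

      F-eq : F ≈ const z * (U * G ps)
      F-eq = sym (begin
        const z * (U * ((1# + ω) * Π (bs ps) * (const (C ps) * k ps)))
          ≈⟨ *-congʳ (const-* T (Z ps)) ⟩
        const T * const (Z ps) * (U * ((1# + ω) * Π (bs ps) * (const (C ps) * k ps)))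
          ≈⟨ solve 7 (λ t z u w p c k → t :* z :* (u :* (w :* p :* (c :* k))) := t :* (w :* (u :* p) :* k)
            :* (z :* c)) refl _ _ _ _ _ _ _ ⟩
        const T * ((1# + ω) * (U * Π (bs ps)) * k ps) * (const (Z ps) * const (C ps))
          ≈⟨ *-cong (*-congˡ (*-congʳ (*-congˡ U-Π))) (trans (sym (const-* _ _)) (const-cong (Z-C ps))) ⟩
        const T * ((1# + ω) * (1# + ω) * k ps) * 1# ≈⟨ *-identityʳ _ ⟩
        F ∎)

      private
        U-G : ∀ suf → δ (U * G suf) ≈ const (C suf) * (δ (k suf) + ((1# + 1#) * k suf + ω * k suf))
        U-G suf = begin
          δ (U * ((1# + ω) * Π (bs ps) * (const (C suf) * k suf)))
            ≈⟨ δ-cong (solve 5 (λ u w p c k → u :* (w :* p :* (c :* k)) := c :* (w :* (u :* p) :* k))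
              refl _ _ _ _ _) ⟩
          δ (const (C suf) * ((1# + ω) * (U * Π (bs ps)) * k suf)) ≈⟨ δ-const* _ _ ⟩
          const (C suf) * δ ((1# + ω) * (U * Π (bs ps)) * k suf)
            ≈⟨ *-congˡ (δ-cong (trans (*-congʳ (*-congˡ U-Π))
                 (solve 2 (λ w k → (:1 :+ w) :* (:1 :+ w) :* k
                   := k :+ w :* ((:1 :+ :1) :* k :+ w :* k)) refl ω (k suf)))) ⟩
          const (C suf) * (δ (k suf) + δ (ω * ((1# + 1#) * k suf + ω * k suf)))
            ≈⟨ *-congˡ (+-congˡ (δ-ω* _)) ⟩
          const (C suf) * (δ (k suf) + ((1# + 1#) * k suf + ω * k suf)) ∎

      -- Writing `1 = B² (1 − b)²` in the first summand and `x T = b B²` in the second makes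
      -- `(1 + ω) · Π · C suf · B²` a common factor. What remains is
      -- `(1 − b)² k + b (δ k + 2 k + ω k)`, where `2 b k` cancels and `O b k` is left.
      G-∷ : ∀ p suf → G (p ∷ suf) ≈ G suf + const (x p) * (F * Ψ (G suf))
      G-∷ p suf = sym (begin
        G suf + const (x p) * (F * (s⁻¹ * δ (U * G suf)))
          ≈⟨ +-congˡ (*-congˡ (trans (sym (*-assoc _ _ _)) (*-cong F-s⁻¹ (U-G suf)))) ⟩
        G suf + const (x p) * (const T * ((1# + ω) * Π (bs ps)) * (const (C suf) * K))
          ≈⟨ +-cong (*-congˡ (*-congˡ k-B)) (trans
               (solve 6 (λ x t w p c k → x :* (t :* (w :* p) :* (c :* k)) := (x :* t) :* (w :* p :* (c :* k)))
                 refl _ _ _ _ _ _)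
               (*-congʳ xT′)) ⟩
        (1# + ω) * Π (bs ps) * (const (C suf) * ((B₁ * e * (B₁ * e)) * k₁)) + (b₁ * (B₁ * B₁))
          * ((1# + ω) * Π (bs ps) * (const (C suf) * K))
          ≈⟨ solve 7 (λ w p c g b k dk →
               (:1 :+ w) :* p :* (c :* ((g :* (:1 :+ :- b) :* (g :* (:1 :+ :- b))) :* k))
               :+ (b :* (g :* g)) :* ((:1 :+ w) :* p :* (c :* (dk :+ ((:1 :+ :1) :* k :+ w :* k))))
               := (:1 :+ w) :* p :* (g :* g :* c :* ((:1 :+ b :* b) :* k :+ b :* (w :* k :+ dk))))
             refl ω (Π (bs ps)) (const (C suf)) B₁ b₁ k₁ (δ k₁) ⟩
        (1# + ω) * Π (bs ps) * (B₁ * B₁ * const (C suf) * k (p ∷ suf))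
          ≈⟨ *-congˡ (*-congʳ (sym (trans (const-* _ _) (*-congʳ (const-* _ _))))) ⟩
        G (p ∷ suf) ∎)
        where
        k₁ = k suf
        b₁ = const (b p)
        B₁ = const (B p)
        e = 1# + - b₁
        K = δ k₁ + ((1# + 1#) * k₁ + ω * k₁)
        B-e : B₁ * e ≈ 1#
        B-e = trans (*-congˡ (sym (trans (const-+ _ _) (+-congˡ (const-neg _)))))
                    (trans (sym (const-* _ _)) (const-cong (B-inv p)))
        k-B : k₁ ≈ (B₁ * e * (B₁ * e)) * k₁
        k-B = sym (trans (*-congʳ (trans (*-cong B-e B-e) (*-identityˡ _))) (*-identityˡ _))
        xT′ : const (x p) * const T ≈ b₁ * (B₁ * B₁)
        xT′ = trans (sym (const-* _ _)) (trans (const-cong (xT p)) (trans (const-* _ _) (*-congˡ (const-* _ _))))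

      F₀ : F 0 L.≈ T L.* k ps 0
      F₀ = L.*-congˡ (L.solve 1 (λ k → (L.:1 L.:+ L.:0) L.:* (L.:1 L.:+ L.:0) L.:* k L.:= k) L.refl _)

-- Expansions in powers of z and Lagrange inversion

-- f = a 0 + a 1 z + ⋯ + a (N ∸ 1) z ^ (N ∸ 1) + O(z ^ N).
module Expansion (R : CommutativeRing 0ℓ 0ℓ) (z : CommutativeRing.Carrier R) where
  open CommutativeRing R hiding (zero)
  open PowerSeries R using (Series; _⊛_; δ; const; _⊕_; _⊙_)
  open IntegerSolver R

  data Expands : ℕ → Carrier → Series → Set where
    done : ∀ {f a} → Expands zero f a
    more : ∀ {N f a} g → f ≈ a 0 + z * g → Expands N g (δ a) → Expands (suc N) f a

  expands-cong : ∀ {N f g a c} → f ≈ g → (∀ n → n ℕ.< N → a n ≈ c n) → Expands N f a → Expands N g c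
  expands-cong p q done          = done
  expands-cong p q (more f′ eq e) = more f′ (trans (sym p) (trans eq (+-congʳ (q 0 (ℕ.s≤s ℕ.z≤n)))))
    (expands-cong refl (λ n n<N → q (suc n) (ℕ.s≤s n<N)) e)

  expands-weaken : ∀ {N f a} → Expands (suc N) f a → Expands N f a
  expands-weaken {zero}  _              = done
  expands-weaken {suc N} (more f′ eq e) = more f′ eq (expands-weaken e)

  expands-zero : ∀ N {a} → (∀ n → a n ≈ 0#) → Expands N 0# a
  expands-zero zero    p = done
  expands-zero (suc N) p = more 0# (sym (trans (+-cong (p 0) (zeroʳ z)) (+-identityˡ 0#)))
    (expands-zero N (λ n → p (suc n)))

  expands-const : ∀ N c → Expands N c (const c)
  expands-const zero    c = done
  expands-const (suc N) c = more 0# (sym (trans (+-congˡ (zeroʳ z)) (+-identityʳ c))) (expands-zero N (λ _ → refl))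

  expands-+ : ∀ {N f g a c} → Expands N f a → Expands N g c → Expands N (f + g) (a ⊕ c)
  expands-+ done done = done
  expands-+ (more f′ p e) (more g′ q e′) = more (f′ + g′)
    (trans (+-cong p q) (solve 5 (λ a c z f g → (a :+ z :* f) :+ (c :+ z :* g) := (a :+ c) :+ z :* (f :+ g))
      refl _ _ _ _ _))
    (expands-+ e e′)

  expands-scale : ∀ {N f a} c → Expands N f a → Expands N (c * f) (c ⊙ a)
  expands-scale c done = done
  expands-scale c (more f′ p e) = more (c * f′)
    (trans (*-congˡ p) (solve 4 (λ c a z f → c :* (a :+ z :* f) := c :* a :+ z :* (c :* f)) refl _ _ _ _))
    (expands-scale c e)

  expands-* : ∀ {N f g a c} → Expands N f a → Expands N g c → Expands N (f * g) (a ⊛ c)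
  expands-* done done = done
  expands-* {suc N} {f} {g} {a} {c} (more f′ p e) e₂@(more g′ q e′) = more (a 0 * g′ + f′ * g)
    (trans (*-congʳ p) (trans (solve 4 (λ a z f g → (a :+ z :* f) :* g := a :* g :+ z :* (f :* g)) refl _ _ _ _)
      (trans (+-congʳ (*-congˡ q)) (solve 5 (λ a c z g′ fg → a :* (c :+ z :* g′) :+ z :* fg := a :* c :+ z
        :* (a :* g′ :+ fg)) refl _ _ _ _ _))))
    -- The remainder `f′` is known to one order less than `g`, so the expansion of `g` is shortened
    -- before multiplying.
    (expands-+ (expands-scale (a 0) e′) (expands-* e (expands-weaken e₂)))

  expands-shift : ∀ {N f a} → Expands N f (δ a) → a 0 ≈ 0# → Expands (suc N) (z * f) a
  expands-shift {f = f} e p = more f (trans (sym (+-identityˡ _)) (+-congʳ (sym p))) e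

-- Compatibility with `x + z y` is all that an expansion sees, so this serves the divided difference
-- `Ψ`, which is not multiplicative, as well as the evaluation at `ω = 0`.
module ExpansionMap (R R′ : CommutativeRing 0ℓ 0ℓ) (z : CommutativeRing.Carrier R) (z′ : CommutativeRing.Carrier R′)
  (φ : CommutativeRing.Carrier R → CommutativeRing.Carrier R′)
  (φ-cong : ∀ {x y} → CommutativeRing._≈_ R x y → CommutativeRing._≈_ R′ (φ x) (φ y))
  (φ-step : ∀ x y → CommutativeRing._≈_ R′ (φ (CommutativeRing._+_ R x (CommutativeRing._*_ R z y)))
                                            (CommutativeRing._+_ R′ (φ x) (CommutativeRing._*_ R′ z′ (φ y)))) where
  open Expansion

  expands-map : ∀ {N f a} → Expands R z N f a → Expands R′ z′ N (φ f) (λ n → φ (a n))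
  expands-map done          = done
  expands-map (more f′ eq e) = more (φ f′) (CommutativeRing.trans R′ (φ-cong eq) (φ-step _ _)) (expands-map e)

-- A derivation multiplies coefficients by integers that must be cancelled later; this makes it
-- possible over `ℤ`, without rational coefficients.
TorsionFree : CommutativeRing 0ℓ 0ℓ → Set
TorsionFree K = ∀ n a → (suc n · 1#) * a ≈ 0# → a ≈ 0#
  where
  open CommutativeRing K
  open Multiples semiring using () renaming (_×_ to _·_)

module Lagrange (K : CommutativeRing 0ℓ 0ℓ) where
  private module K where
    open CommutativeRing K public
    open IntegerSolver K public
    open Multiples semiring public using () renaming (_×_ to _·_)
  open PowerSeries K using (δ; const-cong; const-*; const-⊛; var-⊛; var-⊛₀; fix; fix-eq; Contraction; var-contraction; ⊛-agree<; ⊛-agree)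
  open PowerSeries K public using (Series; const; mk≋; coeff) renaming (var to T)
  open CommutativeRing (PowerSeries.ring⟦⟧ K) public
  open Powers semiring public using (_^_; ^-congˡ; ^-homo-*)
  open Multiples semiring public using () renaming (_×_ to _·_)
  open IntegerSolver (PowerSeries.ring⟦⟧ K) public
  open SetoidReasoning setoid

  num : ℕ → K.Carrier
  num n = n K.· K.1#

  num-const : ∀ n → n · 1# ≈ const (num n)
  num-const zero    = refl
  num-const (suc n) = trans (+-congˡ (num-const n)) (sym (PowerSeries.const-+ K _ _))

  num-coeff : ∀ n f k → ((n · 1#) * f) k K.≈ num n K.* f k
  num-coeff n f k = K.trans (coeff (*-congʳ (num-const n)) k) (const-⊛ (num n) f k)

  -- The Euler derivation `T d/dT`, chosen because it preserves degrees.
  D : Series → Series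
  D f n = num n K.* f n

  D-cong : ∀ {f g} → f ≈ g → D f ≈ D g
  D-cong p = mk≋ λ n → K.*-congˡ (coeff p n)

  D-+ : ∀ f g → D (f + g) ≈ D f + D g
  D-+ f g = mk≋ λ n → K.distribˡ _ _ _

  D-neg : ∀ f → D (- f) ≈ - D f
  D-neg f = mk≋ λ n → K.solve 2 (λ a b → a K.:* (K.:- b) K.:= K.:- (a K.:* b)) K.refl _ _

  D-const : ∀ a → D (const a) ≈ 0#
  D-const a = mk≋ λ { zero → K.zeroˡ _ ; (suc n) → K.zeroʳ _ }

  D-T : ∀ f → D (T * f) ≈ T * f + T * D f
  D-T f = mk≋ λ
    { zero → K.trans (K.zeroˡ _) (K.sym (K.trans (K.+-cong (var-⊛₀ f) (var-⊛₀ (D f))) (K.+-identityˡ _)))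
    ; (suc n) → K.trans (K.*-congˡ (var-⊛ f n)) (K.trans
        (K.solve 2 (λ a b → (K.:1 K.:+ a) K.:* b K.:= b K.:+ a K.:* b) K.refl _ _)
        (K.sym (K.+-cong (var-⊛ f n) (var-⊛ (D f) n))))
    }

  private
    D-*′ : ∀ n f g → D (f * g) n K.≈ (D f * g + f * D g) n
    D-*′ zero    f g = K.solve 2 (λ a b → K.:0 K.:* (a K.:* b)
      K.:= K.:0 K.:* a K.:* b K.:+ a K.:* (K.:0 K.:* b)) K.refl (f 0) (g 0)
    D-*′ (suc n) f g = K.sym (K.trans
      (K.+-congʳ (K.+-congˡ (K.trans (coeff (trans (*-congʳ δ-D) (distribʳ g (δ f) (D (δ f)))) n)
        (K.+-congˡ K.refl))))
      (K.trans
        (K.solve 6 (λ f₀ g m a b c → (K.:0 K.:* f₀ K.:* g K.:+ (a K.:+ b)) K.:+ (f₀ K.:* (m K.:* g) K.:+ c)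
           K.:= m K.:* (f₀ K.:* g) K.:+ (a K.:+ (b K.:+ c))) K.refl (f 0) (g (suc n)) (num (suc n)) _ _ _)
      (K.trans (K.+-congˡ (K.+-congˡ (K.sym (D-*′ n (δ f) g))))
        (K.solve 3 (λ m a c → (K.:1 K.:+ m) K.:* a K.:+ (c K.:+ m K.:* c) K.:= (K.:1 K.:+ m) K.:* (a K.:+ c))
           K.refl (num n) _ _))))
      where
      δ-D : δ (D f) ≈ δ f + D (δ f)
      δ-D = mk≋ λ n → K.solve 2 (λ a b → (K.:1 K.:+ a) K.:* b K.:= b K.:+ a K.:* b) K.refl _ _

  D-* : ∀ f g → D (f * g) ≈ D f * g + f * D g
  D-* f g = mk≋ λ n → D-*′ n f g

  module Inversion (torsionFree : TorsionFree K) (Z C : Series) (Z-C : Z * C ≈ 1#) where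
    -- The logarithmic derivative of `z = T Z`, that is, `D z = z J`.
    J : Series
    J = 1# + C * D Z

    D-C^ : ∀ n → D (C ^ n) ≈ - ((n · 1#) * (C ^ n * (C * D Z)))
    D-C^ zero    = trans (D-const K.1#) (solve 1 (λ a → :0 := :- (:0 :* a)) refl _)
    D-C^ (suc n) = begin
      D (C * C ^ n) ≈⟨ D-* C (C ^ n) ⟩
      D C * C ^ n + C * D (C ^ n) ≈⟨ +-cong (*-congʳ D-C) (*-congˡ (D-C^ n)) ⟩
      - (C * C * D Z) * C ^ n + C * (- ((n · 1#) * (C ^ n * (C * D Z))))
        ≈⟨ solve 4 (λ c z p n → (:- (c :* c :* z)) :* p :+ c :* (:- (n :* (p :* (c :* z))))
             := :- ((:1 :+ n) :* (c :* p :* (c :* z)))) refl _ _ _ _ ⟩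
      - ((suc n · 1#) * (C * C ^ n * (C * D Z))) ∎
      where
      D-C : D C ≈ - (C * C * D Z)
      D-C = begin
        D C ≈⟨ sym (*-identityˡ _) ⟩
        1# * D C ≈⟨ *-congʳ (sym Z-C) ⟩
        Z * C * D C
          ≈⟨ solve 4 (λ z c dz dc → z :* c :* dc := c :* (dz :* c :+ z :* dc) :+ (:- (c :* c :* dz)))
          refl _ _ (D Z) _ ⟩
        C * (D Z * C + Z * D C) + - (C * C * D Z) ≈⟨ +-congʳ (*-congˡ (sym (D-* Z C))) ⟩
        C * D (Z * C) + - (C * C * D Z) ≈⟨ +-congʳ (*-congˡ (trans (D-cong Z-C) (D-const K.1#))) ⟩
        C * 0# + - (C * C * D Z) ≈⟨ trans (+-congʳ (zeroʳ C)) (+-identityˡ _) ⟩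
        - (C * C * D Z) ∎

    C^-J : ∀ n → (n · 1#) * (C ^ n * J) ≈ (n · 1#) * C ^ n + - D (C ^ n)
    C^-J n = begin
      (n · 1#) * (C ^ n * (1# + C * D Z))
        ≈⟨ solve 3 (λ n p w → n :* (p :* (:1 :+ w)) := n :* p :+ (:- (:- (n :* (p :* w))))) refl _ _ _ ⟩
      (n · 1#) * C ^ n + - (- ((n · 1#) * (C ^ n * (C * D Z)))) ≈⟨ +-congˡ (-‿cong (sym (D-C^ n))) ⟩
      (n · 1#) * C ^ n + - D (C ^ n) ∎

    J₀ : J 0 K.≈ K.1#
    J₀ = K.solve 2 (λ c z → K.:1 K.:+ c K.:* (K.:0 K.:* z) K.:= K.:1) K.refl (C 0) (Z 0)

    -- In degree `n + 1` the derivation multiplies by `n + 1`, so the two terms of `C^-J` cancel.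
    -- This is the fact behind Lagrange inversion that a nontrivial power of `z` times `dz / z` has
    -- no residue.
    C^-J-diagonal : ∀ n → (C ^ suc n * J) (suc n) K.≈ K.0#
    C^-J-diagonal n = torsionFree n _ (K.trans (K.sym (num-coeff (suc n) _ (suc n)))
      (K.trans (coeff (C^-J (suc n)) (suc n)) (K.trans (K.+-congʳ (num-coeff (suc n) _ (suc n))) (K.-‿inverseʳ _))))

    -- Passing from f to const a + T Z f turns (N , m + 1) into (N + 1 , m), which
    -- reads off the coefficients of an expansion in powers of T Z one by one.
    residue : ℕ → ℕ → Series → Series
    residue N m f = C ^ N * ((m · 1#) * J * f + D f)

    residue-cong : ∀ N m {f g} → f ≈ g → residue N m f ≈ residue N m g
    residue-cong N m p = *-congˡ (+-cong (*-congˡ p) (D-cong p))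

    open Expansion (PowerSeries.ring⟦⟧ K) (T * Z)

    residue-step : ∀ N m a f → residue (suc N) m (const a + T * Z * f) (suc N) K.≈ residue N (suc m) f N
    -- The constant `a` contributes a multiple of a coefficient that vanishes by `C^-J-diagonal`;
    -- the rest carries a factor `T`, which lowers the degree by one.
    residue-step N m a f = K.trans (coeff expand (suc N)) (K.trans
      (K.+-cong (K.trans (coeff (*-assoc (m · 1#) (const a) (C ^ suc N * J)) (suc N))
        (K.trans (num-coeff m _ (suc N)) (K.trans (K.*-congˡ
                  (K.trans (const-⊛ a _ (suc N)) (K.trans (K.*-congˡ (C^-J-diagonal N)) (K.zeroʳ a))))
                    (K.zeroʳ _))))
                (var-⊛ _ N))
      (K.+-identityˡ _))
      where
      expand : residue (suc N) m (const a + T * Z * f)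
        ≈ (m · 1#) * const a * (C ^ suc N * J) + T * residue N (suc m) f
      expand = begin
        C * C ^ N * ((m · 1#) * J * (const a + T * Z * f) + D (const a + T * Z * f))
          ≈⟨ *-congˡ (+-congˡ (trans (D-+ _ _)
            (trans (+-cong (D-const a) (trans (D-cong (*-assoc _ _ _))
            (trans (D-T _) (+-congˡ (*-congˡ (D-* Z f)))))) (+-identityˡ _)))) ⟩
        C * C ^ N * ((m · 1#) * J * (const a + T * Z * f) + (T * (Z * f) + T * (D Z * f + Z * D f)))
          ≈⟨ solve 9 (λ c p m j a t z f y → c :* p :* (m :* j :* (a :+ t :* z :* f) :+ y)
               := m :* a :* (c :* p :* j) :+ (p :* (z :* c :* t :* (m :* j :* f) :+ c :* y))) refl C (C ^ N)
                 (m · 1#) J (const a) T Z f _ ⟩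
        (m · 1#) * const a * (C * C ^ N * J) + C ^ N * (Z * C * T * ((m · 1#) * J * f)
          + C * (T * (Z * f) + T * (D Z * f + Z * D f)))
          ≈⟨ +-congˡ (*-congˡ (+-cong (*-congʳ (trans (*-congʳ Z-C) (*-identityˡ T)))
               (solve 6 (λ c t z f dz df → c :* (t :* (z :* f) :+ t :* (dz :* f :+ z :* df))
                 := t :* ((z :* c) :* f :+ c :* dz :* f :+ (z :* c) :* df)) refl C T Z f (D Z) (D f)))) ⟩
        (m · 1#) * const a * (C * C ^ N * J)
          + C ^ N * (T * ((m · 1#) * J * f) + T * (Z * C * f + C * D Z * f + Z * C * D f))
          ≈⟨ +-congˡ (*-congˡ (+-congˡ (*-congˡ (+-cong (+-congʳ (*-congʳ Z-C)) (*-congʳ Z-C))))) ⟩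
        (m · 1#) * const a * (C * C ^ N * J)
          + C ^ N * (T * ((m · 1#) * J * f) + T * (1# * f + C * D Z * f + 1# * D f))
          ≈⟨ +-congˡ (solve 6 (λ p t m w f df →
            p :* (t :* (m :* (:1 :+ w) :* f) :+ t :* (:1 :* f :+ w :* f :+ :1 :* df))
               := t :* (p :* ((:1 :+ m) :* (:1 :+ w) :* f :+ df))) refl (C ^ N) T (m · 1#) (C * D Z) f (D f)) ⟩
        (m · 1#) * const a * (C * C ^ N * J) + T * residue N (suc m) f ∎

    -- Formally `residue N m f` is `C ^ N · z ^ (−m) · D (z ^ m f)`, and its coefficient in degree
    -- `N` is a residue to which only `a N · z ^ (m + N)` contributes; `D` brings down the exponent
    -- `m + N`.
    residue-expansion : ∀ N m {f} {a : ℕ → K.Carrier} → Expands (suc N) f (λ n → const (a n)) →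
      residue N m f N K.≈ num (m ℕ.+ N) K.* a N
    residue-expansion zero m {f} {a} (more g eq _) = K.trans (coeff (residue-cong 0 m {f} eq) 0) (K.trans
      (K.*-congˡ (K.+-congʳ (K.*-congʳ (K.*-cong (coeff (num-const m) 0) J₀))))
      (K.trans (K.solve 5 (λ m a z g x → K.:1 K.:* (m K.:* K.:1 K.:* (a K.:+ K.:0 K.:* z K.:* g) K.:+ K.:0 K.:* x)
                 K.:= m K.:* a) K.refl (num m) (a 0) (Z 0) (g 0) _)
        (K.*-congʳ (K.reflexive (≡.cong num (≡.sym (ℕₚ.+-identityʳ m)))))))
    residue-expansion (suc N) m {f} {a} (more g eq e) = K.trans (coeff (residue-cong (suc N) m {f} eq) (suc N))
      (K.trans (residue-step N m (a 0) g)
      (K.trans (residue-expansion N (suc m) {g} {λ n → a (suc n)} e)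
        (K.*-congʳ (K.reflexive (≡.cong num (≡.sym (ℕₚ.+-suc m N)))))))

    -- One factor `N + 1` is the exponent of `z` brought down by `D`. The other replaces
    -- `C ^ suc N * J` by `(N + 1) C ^ suc N − D (C ^ suc N)`, and in degree `N` the difference of
    -- `N + 1` and `N` leaves the bare coefficient.
    lagrange : ∀ N {f} {a : ℕ → K.Carrier} → D f ≈ T * J → Expands (suc (suc N)) f (λ n → const (a n)) →
               num (suc N) K.* (num (suc N) K.* a (suc N)) K.≈ (C ^ suc N) N
    lagrange N {f} {a} D-f e = K.trans (K.*-congˡ
      (K.sym (K.trans (K.sym step) (residue-expansion (suc N) 0 {f} {a} e))))
      (K.trans (K.sym (num-coeff (suc N) _ N)) (K.trans (coeff (C^-J (suc N)) N)
      (K.trans (K.+-congʳ (num-coeff (suc N) _ N))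
        (K.solve 2 (λ n c → (K.:1 K.:+ n) K.:* c K.:+ (K.:- (n K.:* c)) K.:= c) K.refl (num N) _))))
      where
      step : residue (suc N) 0 f (suc N) K.≈ (C ^ suc N * J) N
      step = K.trans (coeff (trans (*-congˡ (trans (+-congʳ (trans (*-assoc _ _ _) (zeroˡ _)))
        (trans (+-identityˡ _) D-f)))
                      (solve 3 (λ c t j → c :* (t :* j) := t :* (c :* j)) refl _ _ _)) (suc N)) (var-⊛ _ N)

-- The recursive decomposition of good words, on the level of coefficient sequences in z:
-- xs are the weights of the r + 1 kinds of descents.
module Recursion (E : CommutativeRing 0ℓ 0ℓ) (U : CommutativeRing.Carrier E)
  (Ψ : CommutativeRing.Carrier E → CommutativeRing.Carrier E) where
  open CommutativeRing E hiding (zero)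
  open Powers semiring using (_^_)
  open PowerSeries E using (_⊛_; const)

  gSeq : (ℕ → Carrier) → List Carrier → ℕ → Carrier
  gSeq a []        = const 1#
  gSeq a (x ∷ xs) n = gSeq a xs n + x * (a ⊛ (λ m → Ψ (gSeq a xs m))) n

  -- The first number is fuel: each round applies `F = z u G₀` once, and the entries with `n ≤ N`
  -- are final after `N` rounds.
  fSeq : List Carrier → ℕ → ℕ → Carrier
  fSeq xs zero    n       = 0#
  fSeq xs (suc N) zero    = 0#
  fSeq xs (suc N) (suc n) = U * gSeq (fSeq xs N) xs n

  -- The value of `Ψ` at `U ^ c`: one term for each of the `c + 1` places at which a word can be
  -- glued in front of `c` components.
  geometric : ℕ → Carrier
  geometric zero    = 1#
  geometric (suc c) = U ^ suc c + geometric c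

-- The series `bᵢ` and the solution formed from them

module Branches (K : CommutativeRing 0ℓ 0ℓ) where
  private module K where
    open CommutativeRing K public
    open IntegerSolver K public
  open Lagrange K
  open PowerSeries K using (fix; fix-eq; Contraction; Agree; var-contraction; var-⊛; var-⊛₀; ⊛-agree; ⊛-agree<; const-⊛; module Inverse)
  open Kernel (PowerSeries.ring⟦⟧ K) T using (Branch; module Solution; Z; C; Z-C) public
  open Branch public
  open SetoidReasoning setoid

  module _ (ξ : K.Carrier) where
    private
      Φ : Series → Series
      Φ f = const ξ * ((1# + - f) * (1# + - f))

      Φ-local : ∀ f g n → Agree (suc n) f g → Φ f n K.≈ Φ g n
      Φ-local f g n p = ⊛-agree {n} {const ξ} {const ξ} {e f * e f} {e g * e g} (λ _ _ → K.refl)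
        (⊛-agree< {suc n} {e f} {e g} {e f} {e g} e-agree e-agree)
        where
        e : Series → Series
        e f = 1# + - f
        e-agree : Agree (suc n) (e f) (e g)
        e-agree k k<n = K.+-congˡ (K.-‿cong (p k k<n))

      contraction : Contraction (λ f → T * Φ f)
      contraction = var-contraction Φ Φ-local

      β : Series
      β = fix (λ f → T * Φ f) contraction

      β-eq : β ≈ T * Φ β
      β-eq = fix-eq (λ f → T * Φ f) contraction

      β₀ : β 0 K.≈ K.0#
      β₀ = K.trans (coeff β-eq 0) (var-⊛₀ (Φ β))

      unit : (1# + - β) 0 K.* K.1# K.≈ K.1#
      unit = K.trans (K.*-congʳ (K.+-congˡ (K.-‿cong β₀)))
        (K.solve 0 ((K.:1 K.:+ (K.:- K.:0)) K.:* K.:1 K.:= K.:1) K.refl)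

      module I = Inverse (1# + - β) K.1# unit

    branch : Branch
    branch = record
      { x = const ξ
      ; b = β
      ; B = I.inv
      ; B-inv = inverse
      ; xT = begin
          const ξ * T ≈⟨ solve 2 (λ x t → x :* t := :1 :* :1 :* (x :* t)) refl _ _ ⟩
          1# * 1# * (const ξ * T) ≈⟨ *-congʳ (*-cong (sym inverse) (sym inverse)) ⟩
          I.inv * (1# + - β) * (I.inv * (1# + - β)) * (const ξ * T)
            ≈⟨ solve 4 (λ i e x t → i :* e :* (i :* e) :* (x :* t) := t :* (x :* (e :* e)) :* (i :* i))
              refl _ _ _ _ ⟩
          T * Φ β * (I.inv * I.inv) ≈⟨ *-congʳ (sym β-eq) ⟩
          β * (I.inv * I.inv) ∎
      }
      where
      inverse : I.inv * (1# + - β) ≈ 1#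
      inverse = trans (*-comm _ _) I.inv-eq

    branch-b₀ : b branch 0 K.≈ K.0#
    branch-b₀ = β₀

  B-eq : ∀ p → B p ≈ 1# + b p * B p
  B-eq p = trans (solve 2 (λ b B → B := B :* (:1 :+ (:- b)) :+ b :* B) refl (b p) (B p)) (+-congʳ (B-inv p))

  -- Differentiating `b = T x (1 − b)²` logarithmically gives `D b = b − 2 b B · D b`, and
  -- `B = 1 + b B` rearranges this. The left side is what appears in `D (T b) = T (b + D b)`, the
  -- right side is a term of the logarithmic derivative of `Z`.
  D-branch : ∀ p → D (x p) ≈ 0# → b p + D (b p) ≈ (1# + 1#) * (B p * D (b p))
  D-branch p D-x = sym (begin
    (1# + 1#) * (B₁ * D b₁) ≈⟨ *-congˡ (*-congʳ (B-eq p)) ⟩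
    (1# + 1#) * ((1# + b₁ * B₁) * D b₁)
      ≈⟨ solve 3 (λ b g d → (:1 :+ :1) :* ((:1 :+ b :* g) :* d)
           := (d :+ (:1 :+ :1) :* (b :* g :* d)) :+ d) refl b₁ B₁ (D b₁) ⟩
    (D b₁ + (1# + 1#) * (b₁ * B₁ * D b₁)) + D b₁ ≈⟨ +-congʳ (+-congʳ Db) ⟩
    ((b₁ + - ((1# + 1#) * (b₁ * B₁ * D b₁))) + (1# + 1#) * (b₁ * B₁ * D b₁)) + D b₁
      ≈⟨ solve 3 (λ b y d → ((b :+ (:- y)) :+ y) :+ d := b :+ d) refl b₁ _ _ ⟩
    b₁ + D b₁ ∎)
    where
    b₁ = b p
    B₁ = B p
    e = 1# + - b₁
    xTe : x p * T * e ≈ b₁ * B₁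
    xTe = trans (*-congʳ (xT p)) (trans (solve 3 (λ b g e → b :* (g :* g) :* e := b :* g :* (g :* e)) refl _ _ _)
      (trans (*-congˡ (B-inv p)) (*-identityʳ _)))
    b-eq : b₁ ≈ T * (x p * (e * e))
    b-eq = sym (begin
      T * (x p * (e * e)) ≈⟨ solve 3 (λ t x e → t :* (x :* (e :* e)) := x :* t :* e :* e) refl _ _ _ ⟩
      x p * T * e * e     ≈⟨ *-congʳ xTe ⟩
      b₁ * B₁ * e         ≈⟨ *-assoc _ _ _ ⟩
      b₁ * (B₁ * e)       ≈⟨ *-congˡ (B-inv p) ⟩
      b₁ * 1#             ≈⟨ *-identityʳ _ ⟩
      b₁ ∎)
    De : D e ≈ - D b₁
    De = trans (D-+ 1# (- b₁)) (trans (+-cong (D-const K.1#) (D-neg b₁)) (+-identityˡ _))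
    Db : D b₁ ≈ b₁ + - ((1# + 1#) * (b₁ * B₁ * D b₁))
    Db = begin
      D b₁ ≈⟨ trans (D-cong b-eq) (D-T _) ⟩
      T * (x p * (e * e)) + T * D (x p * (e * e)) ≈⟨ +-cong (sym b-eq) (*-congˡ (D-* _ _)) ⟩
      b₁ + T * (D (x p) * (e * e) + x p * D (e * e))
        ≈⟨ +-congˡ (*-congˡ (+-cong (trans (*-congʳ D-x) (zeroˡ _))
          (*-congˡ (trans (D-* e e) (+-cong (*-congʳ De) (*-congˡ De)))))) ⟩
      b₁ + T * (0# + x p * (- D b₁ * e + e * (- D b₁)))
        ≈⟨ solve 5 (λ b t x e d → b :+ t :* (:0 :+ x :* ((:- d) :* e :+ e :* (:- d)))
             := b :+ (:- ((:1 :+ :1) :* (x :* t :* e :* d)))) refl b₁ T (x p) e (D b₁) ⟩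
      b₁ + - ((1# + 1#) * (x p * T * e * D b₁)) ≈⟨ +-congˡ (-‿cong (*-congˡ (*-congʳ xTe))) ⟩
      b₁ + - ((1# + 1#) * (b₁ * B₁ * D b₁)) ∎

  open import Data.List.Relation.Unary.All using (All; []; _∷_)

  module Specialised (torsionFree : TorsionFree K) (ps : List Branch)
    (constant : All (λ p → D (x p) ≈ 0#) ps) (small : All (λ p → b p 0 K.≈ K.0#) ps) where

    module S = Solution ps
    open Inversion torsionFree (Z ps) (C ps) (Z-C ps)

    private
      -- The logarithmic derivative of `∏ (1 − b)²` is `− Σ 2 B · D b`, and `D-branch` rewrites
      -- every summand.
      C-DZ : ∀ qs → All (λ p → D (x p) ≈ 0#) qs → C qs * D (Z qs) ≈ - (S.sumb qs + D (S.sumb qs))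
      C-DZ [] [] = trans (*-congˡ (D-const K.1#)) (trans (zeroʳ _)
        (trans (solve 0 (:0 := :- (:0 :+ :0)) refl) (-‿cong (+-congˡ (sym (D-const K.0#))))))
      C-DZ (p ∷ qs) (c ∷ cs) = begin
        B₁ * B₁ * C qs * D (e * e * Z qs)
          ≈⟨ *-congˡ (trans (D-* (e * e) (Z qs))
            (+-congʳ (*-congʳ (trans (D-* e e) (+-cong (*-congʳ De) (*-congˡ De)))))) ⟩
        B₁ * B₁ * C qs * ((- D b₁ * e + e * (- D b₁)) * Z qs + e * e * D (Z qs))
          ≈⟨ solve 6 (λ g c d e z dz → g :* g :* c :* (((:- d) :* e :+ e :* (:- d)) :* z :+ e :* e :* dz)
               := (:- ((z :* c) :* (g :* e) :* ((:1 :+ :1) :* (g :* d)))) :+ (g :* e) :* (g :* e) :* (c :* dz))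
             refl B₁ (C qs) (D b₁) e (Z qs) (D (Z qs)) ⟩
        - (Z qs * C qs * (B₁ * e) * ((1# + 1#) * (B₁ * D b₁))) + B₁ * e * (B₁ * e) * (C qs * D (Z qs))
          ≈⟨ +-cong (-‿cong (*-cong (*-cong (Z-C qs) (B-inv p)) (sym (D-branch p c))))
            (*-cong (*-cong (B-inv p) (B-inv p)) (C-DZ qs cs)) ⟩
        - (1# * 1# * (b₁ + D b₁)) + 1# * 1# * (- (S.sumb qs + D (S.sumb qs)))
          ≈⟨ solve 4 (λ b d s ds → (:- (:1 :* :1 :* (b :+ d))) :+ :1 :* :1 :* (:- (s :+ ds))
               := :- (b :+ s :+ (d :+ ds))) refl _ _ _ _ ⟩
        - (b₁ + S.sumb qs + (D b₁ + D (S.sumb qs))) ≈⟨ -‿cong (+-congˡ (sym (D-+ b₁ (S.sumb qs)))) ⟩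
        - (b₁ + S.sumb qs + D (b₁ + S.sumb qs)) ∎
        where
        b₁ = b p
        B₁ = B p
        e = 1# + - b₁
        De : D e ≈ - D b₁
        De = trans (D-+ 1# (- b₁)) (trans (+-cong (D-const K.1#) (D-neg b₁)) (+-identityˡ _))

    -- As `D z = z J`, this is the equation `z dF/dz = T` for `F` at `ω = 0`.
    D-solution : D (T * (1# + - S.sumb ps)) ≈ T * J
    D-solution = begin
      D (T * (1# + - S.sumb ps)) ≈⟨ D-T _ ⟩
      T * (1# + - S.sumb ps) + T * D (1# + - S.sumb ps)
        ≈⟨ +-congˡ (*-congˡ (trans (D-+ _ _) (+-cong (D-const K.1#) (D-neg _)))) ⟩
      T * (1# + - S.sumb ps) + T * (0# + - D (S.sumb ps))
        ≈⟨ solve 3 (λ t s d → t :* (:1 :+ (:- s)) :+ t :* (:0 :+ (:- d)) := t :* (:1 :+ (:- (s :+ d)))) refl _ _ _ ⟩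
      T * (1# + - (S.sumb ps + D (S.sumb ps))) ≈⟨ *-congˡ (+-congˡ (sym (C-DZ ps constant))) ⟩
      T * J ∎

    private
      sumb₀ : ∀ {qs} → All (λ p → b p 0 K.≈ K.0#) qs → S.sumb qs 0 K.≈ K.0#
      sumb₀ []       = K.refl
      sumb₀ (c ∷ cs) = K.trans (K.+-cong c (sumb₀ cs)) (K.+-identityʳ _)

      U₁₀ : S.U 1 0 K.* K.1# K.≈ K.1#
      U₁₀ = K.trans (K.*-identityʳ _) (K.trans (coeff S.U₁ 0)
        (K.trans (K.+-congˡ (K.-‿cong (sumb₀ small)))
          (K.solve 0 (K.:1 K.:+ (K.:- K.:0) K.:= K.:1) K.refl)))

      module I₁ = Inverse (S.U 1) K.1# U₁₀
      module I₂ = PowerSeries.Inverse (PowerSeries.ring⟦⟧ K) (PowerSeries.δ (PowerSeries.ring⟦⟧ K) S.U)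
        I₁.inv I₁.inv-eq

    module W = S.WithInverse I₂.inv I₂.inv-eq

    private
      E = PowerSeries.ring⟦⟧ (PowerSeries.ring⟦⟧ K)
      module E where
        open CommutativeRing E public
        open Powers (CommutativeRing.semiring E) public using (_^_)
        open DividedDifferences (PowerSeries.ring⟦⟧ K) public using (δ; const; δ-cong; δ-*; δ-const*; δ-1; const-cong)
      module ES = PowerSeries E
      module EZ = Expansion E (E.const S.z)

    Ψ-cong : ∀ {f g} → f E.≈ g → W.Ψ f E.≈ W.Ψ g
    Ψ-cong p = E.*-congˡ (E.δ-cong (E.*-congˡ {S.U} p))

    Ψ-+ : ∀ f g → W.Ψ (f E.+ g) E.≈ W.Ψ f E.+ W.Ψ g
    Ψ-+ f g = E.trans (E.*-congˡ (E.δ-cong (E.distribˡ S.U f g))) (E.distribˡ _ _ _)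

    Ψ-const : ∀ a f → W.Ψ (E.const a E.* f) E.≈ E.const a E.* W.Ψ f
    Ψ-const a f = E.trans (E.*-congˡ (E.trans (E.δ-cong (swap S.U (E.const a) f)) (E.δ-const* a _)))
      (swap _ (E.const a) _)
      where
      swap : ∀ u c g → u E.* (c E.* g) E.≈ c E.* (u E.* g)
      swap u c g = E.trans (E.sym (E.*-assoc u c g)) (E.trans (E.*-congʳ (E.*-comm u c)) (E.*-assoc c u g))

    private
      s⁻¹-δU : ∀ c → I₂.inv E.* (E.δ S.U E.* c) E.≈ c
      s⁻¹-δU c = E.trans (E.sym (E.*-assoc I₂.inv (E.δ S.U) c))
        (E.trans (E.*-congʳ (E.trans (E.*-comm I₂.inv (E.δ S.U)) I₂.inv-eq)) (E.*-identityˡ _))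

      δ-U* : ∀ f → E.δ (S.U E.* f) E.≈ E.δ f E.+ E.δ S.U E.* f
      δ-U* f = E.trans (E.δ-* S.U f) (E.+-congʳ (E.trans (E.*-congʳ (E.const-cong S.U₀)) (E.*-identityˡ _)))

    -- Because `U 0 = 1`, one has `δ (U f) = δ f + δ U · f`; after division by `δ U`, each further
    -- factor `U` adds one power.
    Ψ-U^ : ∀ c → W.Ψ (S.U E.^ c) E.≈ Recursion.geometric E S.U W.Ψ c
    Ψ-U^ zero    = E.trans (E.*-congˡ (E.trans (δ-U* E.1#) (E.trans (E.+-congʳ E.δ-1) (E.+-identityˡ _))))
      (s⁻¹-δU E.1#)
    Ψ-U^ (suc c) = E.trans (E.*-congˡ (δ-U* (S.U E.^ suc c)))
      (E.trans (E.distribˡ _ _ _) (E.trans (E.+-cong (Ψ-U^ c) (s⁻¹-δU _)) (E.+-comm _ _)))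

    xs : List Branch → List E.Carrier
    xs = map (λ p → E.const (x p))

    open Recursion E S.U W.Ψ public

    private
      module ΨMap = ExpansionMap E E (E.const S.z) (E.const S.z) W.Ψ Ψ-cong
        (λ f g → E.trans (Ψ-+ f _) (E.+-congˡ (Ψ-const S.z g)))

      expands-G : ∀ N {a} → EZ.Expands N W.F a → ∀ suf → EZ.Expands N (W.G suf) (gSeq a (xs suf))
      expands-G N e []        = EZ.expands-cong (E.sym W.G-[]) (λ _ _ → E.refl) (EZ.expands-const N E.1#)
      expands-G N e (p ∷ suf) = EZ.expands-cong (E.sym (W.G-∷ p suf)) (λ _ _ → E.refl)
        (EZ.expands-+ ih (EZ.expands-scale (E.const (x p)) (EZ.expands-* e (ΨMap.expands-map ih))))
        where ih = expands-G N e suf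

      -- Bootstrapping: an expansion of `F` yields expansions of all `G` to the same order, and the
      -- factor `z` in `F = z U G₀` gains one order.
      expands-F : ∀ N → EZ.Expands (suc N) W.F (fSeq (xs ps) N)
      expands-F zero    = EZ.more (S.U E.* W.G ps) (E.trans W.F-eq (E.sym (E.+-identityˡ _))) EZ.done
      expands-F (suc N) = EZ.expands-cong {a = fSeq (xs ps) (suc N)} (E.sym W.F-eq) (λ _ _ → E.refl)
        (EZ.expands-shift (EZ.expands-scale S.U (expands-G (suc N) (expands-F N) ps)) E.refl)

      module At0 = ExpansionMap E (PowerSeries.ring⟦⟧ K) (E.const S.z) S.z (λ f → f 0) (λ p → PowerSeries.coeff p 0)
        (λ f g → refl)

    -- Lagrange inversion takes place at `ω = 0`, where `F` is `T (1 − Σ b)`; the hypothesis says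
    -- that the coefficients in `z` are free of `T` there.
    coefficients : ∀ N (a : ℕ → K.Carrier) → (∀ n → n ℕ.≤ suc N → fSeq (xs ps) (suc N) n 0 ≈ const (a n)) →
                   num (suc N) K.* (num (suc N) K.* a (suc N)) K.≈ (C ps ^ suc N) N
    coefficients N a p = lagrange N D-solution
      (Expansion.expands-cong (PowerSeries.ring⟦⟧ K) S.z (trans W.F₀ (*-congˡ S.k₀)) (λ { n (ℕ.s≤s n≤N) → p n n≤N })
        (At0.expands-map (expands-F (suc N))))

-- Coefficients of the branches

-- Coefficients of the Lucas polynomials B ^ m + (1 − B) ^ m, where B² = B + y.
lucas : ℕ → ℕ → ℕ
lucas zero          zero    = 2
lucas zero          (suc k) = 0
lucas (suc zero)    zero    = 1
lucas (suc zero)    (suc k) = 0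
lucas (suc (suc m)) zero    = lucas (suc m) zero
lucas (suc (suc m)) (suc k) = lucas (suc m) (suc k) ℕ.+ lucas m k

module BranchPowers (K : CommutativeRing 0ℓ 0ℓ) where
  private module K where
    open CommutativeRing K public
    open Powers semiring public using (_^_)
    open Multiples semiring public using (×-homo-+) renaming (_×_ to _·_)
    open IntegerSolver K public
  open Lagrange K
  open Branches K
  open PowerSeries K using (δ; var-⊛; var-⊛₀; const-⊛; ⊛-agree; ⊛-agree<; Agree)
  open SetoidReasoning setoid

  lucasSeries : K.Carrier → ℕ → Series
  lucasSeries ξ m k = (lucas m k K.· K.1#) K.* ξ K.^ k

  private
    ^-low : ∀ f → f 0 K.≈ K.0# → ∀ m k → k ℕ.< m → (f ^ m) k K.≈ K.0#
    ^-low f f₀ (suc m) zero    _ = K.trans (K.*-congʳ f₀) (K.zeroˡ _)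
    ^-low f f₀ (suc m) (suc k) (ℕ.s≤s k<m) = K.trans (K.+-congʳ (K.trans (K.*-congʳ f₀) (K.zeroˡ _)))
      (K.trans (K.+-identityˡ _) (K.trans
        (⊛-agree {k} {δ f} {δ f} {f ^ m} {0#} (λ _ _ → K.refl) (λ j j<k → K.trans (low j j<k) (K.sym (0#-coeff j))))
        (K.trans (coeff (zeroʳ (δ f)) k) (0#-coeff k))))
      where
      0#-coeff : ∀ j → 0# j K.≈ K.0#
      0#-coeff zero    = K.refl
      0#-coeff (suc j) = K.refl
      low : ∀ j → j ℕ.< suc k → (f ^ m) j K.≈ K.0#
      low j (ℕ.s≤s j≤k) = ^-low f f₀ m j (ℕₚ.≤-<-trans j≤k k<m)

  module _ (ξ : K.Carrier) where
    private
      p = branch ξ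
      B₁ = B p
      A₁ = 1# + - B₁

      square : ∀ y → y * y ≈ y + const ξ * T → ∀ m → y ^ suc (suc m) ≈ y ^ suc m + T * (const ξ * y ^ m)
      square y eq m = trans (sym (*-assoc _ _ _)) (trans (*-congʳ eq)
        (solve 4 (λ y x t p → (y :+ x :* t) :* p := y :* p :+ t :* (x :* p)) refl y (const ξ) T (y ^ m)))

      B² : B₁ * B₁ ≈ B₁ + const ξ * T
      B² = trans (*-congʳ (B-eq p))
        (trans (solve 2 (λ b g → (:1 :+ b :* g) :* g := g :+ b :* (g :* g)) refl (b p) B₁)
        (+-congˡ (sym (xT p))))

      A² : A₁ * A₁ ≈ A₁ + const ξ * T
      A² = trans (solve 1 (λ g → (:1 :+ (:- g)) :* (:1 :+ (:- g)) := (:1 :+ (:- g)) :+ (g :* g :+ (:- g))) refl B₁)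
        (+-congˡ (trans (+-congʳ B²) (solve 2 (λ g y → g :+ y :+ (:- g) := y) refl B₁ _)))

      B₀ : B₁ 0 K.≈ K.1#
      B₀ = K.trans (coeff (B-eq p) 0) (K.trans (K.+-congˡ (K.trans (K.*-congʳ (branch-b₀ ξ)) (K.zeroˡ _)))
        (K.+-identityʳ _))

      A₀ : A₁ 0 K.≈ K.0#
      A₀ = K.trans (K.+-congˡ (K.-‿cong B₀)) (K.-‿inverseʳ _)

      V : ℕ → Series
      V m = B₁ ^ m + A₁ ^ m

      V-step : ∀ m → V (suc (suc m)) ≈ V (suc m) + T * (const ξ * V m)
      V-step m = trans (+-cong (square B₁ B² m) (square A₁ A² m))
        (solve 6 (λ a c t x a′ c′ → (a :+ t :* (x :* a′)) :+ (c :+ t :* (x :* c′)) := (a :+ c)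
          :+ t :* (x :* (a′ :+ c′)))
          refl (B₁ ^ suc m) (A₁ ^ suc m) T (const ξ) (B₁ ^ m) (A₁ ^ m))

      V-lucas : ∀ m k → V m k K.≈ lucasSeries ξ m k
      V-lucas zero zero = K.solve 0 (K.:1 K.:+ K.:1 K.:= (K.:1 K.:+ (K.:1 K.:+ K.:0)) K.:* K.:1) K.refl
      V-lucas zero (suc k) = K.solve 1 (λ x → K.:0 K.:+ K.:0 K.:= K.:0 K.:* x) K.refl _
      V-lucas (suc zero) k = K.trans (coeff (solve 1 (λ g → g :* :1 :+ (:1 :+ (:- g)) :* :1 := :1)
        refl B₁) k) (one k)
        where
        one : ∀ k → 1# k K.≈ lucasSeries ξ 1 k
        one zero    = K.solve 0 (K.:1 K.:= (K.:1 K.:+ K.:0) K.:* K.:1) K.refl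
        one (suc k) = K.sym (K.zeroˡ _)
      V-lucas (suc (suc m)) zero = K.trans (coeff (V-step m) 0)
        (K.trans (K.+-cong (V-lucas (suc m) 0) (var-⊛₀ (const ξ * V m))) (K.+-identityʳ _))
      V-lucas (suc (suc m)) (suc k) = K.trans (coeff (V-step m) (suc k))
        (K.trans (K.+-cong (V-lucas (suc m) (suc k))
          (K.trans (var-⊛ (const ξ * V m) k) (K.trans (const-⊛ ξ (V m) k) (K.*-congˡ (V-lucas m k)))))
        (K.trans (K.solve 4 (λ a c x p → a K.:* (x K.:* p) K.:+ x K.:* (c K.:* p) K.:= (a K.:+ c) K.:* (x K.:* p))
          K.refl _ _ ξ (ξ K.^ k))
          (K.*-congʳ (K.sym (K.×-homo-+ K.1# (lucas (suc m) (suc k)) (lucas m k))))))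

    -- `1 − B` is the other root of `y² = y + ξ T` and has constant term 0. Its `m`-th power is
    -- therefore invisible below degree `m`, and there `B ^ m` is the whole Lucas polynomial.
    B^-lucas : ∀ m → Agree m (B₁ ^ m) (lucasSeries ξ m)
    B^-lucas m k k<m = K.trans (K.trans (K.sym (K.+-identityʳ _)) (K.+-congˡ (K.sym (^-low A₁ A₀ m k k<m))))
      (V-lucas m k)

  lucasProduct : List K.Carrier → ℕ → Series
  lucasProduct []       m = 1#
  lucasProduct (ξ ∷ ξs) m = lucasSeries ξ m * lucasProduct ξs m

  private
    C^-∷ : ∀ p ps n → C (p ∷ ps) ^ n ≈ B p ^ (2 ℕ.* n) * C ps ^ n
    C^-∷ p ps n = trans (^-distrib-* (B p * B p) (C ps) n)
      (*-congʳ (trans (^-congˡ n (*-congˡ (sym (*-identityʳ _)))) (^-assocʳ (B p) 2 n)))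
      where
      open CommutativePowers commutativeSemiring using (^-distrib-*)
      open Powers semiring using (^-assocʳ)

  C^-lucas : ∀ ξs n → Agree (2 ℕ.* n) (C (map branch ξs) ^ n) (lucasProduct ξs (2 ℕ.* n))
  C^-lucas []       n k _   = coeff (1^ n) k
    where
    1^ : ∀ n → 1# ^ n ≈ 1#
    1^ zero    = refl
    1^ (suc n) = trans (*-identityˡ _) (1^ n)
  C^-lucas (ξ ∷ ξs) n k k<m = K.trans (coeff (C^-∷ (branch ξ) (map branch ξs) n) k)
    (⊛-agree< {2 ℕ.* n} {B (branch ξ) ^ (2 ℕ.* n)} {lucasSeries ξ (2 ℕ.* n)} (B^-lucas ξ (2 ℕ.* n))
      (C^-lucas ξs n) k k<m)

-- Coefficients in the variables `xᵢ`

-- Iterated power series over `ℤ` contain the polynomials in question and turn the extraction of a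
-- coefficient into iterated evaluation.
polynomials : ℕ → CommutativeRing 0ℓ 0ℓ
polynomials zero    = ℤₚ.+-*-commutativeRing
polynomials (suc m) = PowerSeries.ring⟦⟧ (polynomials m)

module _ where
  open CommutativeRing hiding (zero)

  variables : ∀ m → List (Carrier (polynomials m))
  variables zero    = []
  variables (suc m) = PowerSeries.var (polynomials m) ∷ map (PowerSeries.const (polynomials m)) (variables m)

  coefficient : ∀ m → (Fin m → ℕ) → Carrier (polynomials m) → ℤ
  coefficient zero    κ a = a
  coefficient (suc m) κ f = coefficient m (λ i → κ (suc i)) (f (κ zero))

  coefficient-cong : ∀ m κ {f g} → _≈_ (polynomials m) f g → coefficient m κ f ≡ coefficient m κ g
  coefficient-cong zero    κ p = p
  coefficient-cong (suc m) κ p = coefficient-cong m _ (PowerSeries.coeff p _)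

  coefficient-+ : ∀ m κ f g → coefficient m κ (_+_ (polynomials m) f g) ≡ coefficient m κ f ℤ.+ coefficient m κ g
  coefficient-+ zero    κ f g = ≡.refl
  coefficient-+ (suc m) κ f g = coefficient-+ m _ _ _

  coefficient-0 : ∀ m κ → coefficient m κ (0# (polynomials m)) ≡ ℤ.+ 0
  coefficient-0 zero    κ = ≡.refl
  coefficient-0 (suc m) κ with κ zero
  ... | zero  = coefficient-0 m _
  ... | suc _ = coefficient-0 m _

  coefficient-num : ∀ m κ n f →
    coefficient m κ (_*_ (polynomials m) (Multiples._×_ (semiring (polynomials m)) n (1# (polynomials m))) f)
                    ≡ ℤ.+ n ℤ.* coefficient m κ f
  coefficient-num m κ zero f = ≡.trans (coefficient-cong m κ (zeroˡ (polynomials m) f)) (coefficient-0 m κ)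
  coefficient-num m κ (suc n) f =
    ≡.trans (coefficient-cong m κ (trans K (distribʳ K f (1# K) _) (+-congʳ K (*-identityˡ K f))))
    (≡.trans (coefficient-+ m κ _ _) (≡.trans (≡.cong (λ a → coefficient m κ f ℤ.+ a) (coefficient-num m κ n f))
      (≡.sym (≡.trans (ℤₚ.*-distribʳ-+ (coefficient m κ f) (ℤ.+ 1) (ℤ.+ n))
        (≡.cong (ℤ._+ (ℤ.+ n ℤ.* coefficient m κ f)) (ℤₚ.*-identityˡ (coefficient m κ f)))))))
    where K = polynomials m

torsionFree : ∀ m → TorsionFree (polynomials m)
torsionFree zero n a p with ℤₚ.i*j≡0⇒i≡0∨j≡0 (ℤ.+ suc n) (≡.trans (≡.sym (coefficient-num 0 (λ ()) (suc n) a)) p)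
... | Data.Sum.inj₂ a≡0 = a≡0
torsionFree (suc m) n f p = PowerSeries.mk≋ λ
  { zero → torsionFree m n (f 0) (K.trans (K.sym (Lagrange.num-coeff (polynomials m) (suc n) f 0))
    (PowerSeries.coeff p 0))
  ; (suc k) → torsionFree m n (f (suc k)) (K.trans (K.sym (Lagrange.num-coeff (polynomials m) (suc n) f (suc k)))
    (PowerSeries.coeff p (suc k))) }
  where module K = CommutativeRing (polynomials m)

module Extraction (K : CommutativeRing 0ℓ 0ℓ) where
  private
    K₁ = PowerSeries.ring⟦⟧ K
    module K where
      open CommutativeRing K public
      open Powers semiring public using (_^_)
      open Multiples semiring public using () renaming (_×_ to _·_)
    module K₁ where
      open CommutativeRing K₁ public
      open Powers semiring public using (_^_)
      open Multiples semiring public using () renaming (_×_ to _·_)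
    module L = PowerSeries K₁
    module Lᵣ = CommutativeRing (PowerSeries.ring⟦⟧ K₁)
  open PowerSeries K

  private
    module B = BranchPowers K
    module B₁ = BranchPowers K₁

  constants : Series → L.Series
  constants g n = const (g n)

  constants-⊛ : ∀ n f g → (constants f L.⊛ constants g) n K₁.≈ const ((f ⊛ g) n)
  constants-⊛ zero    f g = K₁.sym (const-* _ _)
  constants-⊛ (suc n) f g = K₁.trans (K₁.+-cong (K₁.sym (const-* _ _)) (constants-⊛ n (δ f) g))
    (K₁.sym (const-+ _ _))

  const-^ : ∀ a n → const (a K.^ n) K₁.≈ const a K₁.^ n
  const-^ a zero    = K₁.refl
  const-^ a (suc n) = K₁.trans (const-* _ _) (K₁.*-congˡ (const-^ a n))

  const-num : ∀ n → const (n K.· K.1#) K₁.≈ n K₁.· K₁.1#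
  const-num n = K₁.sym (Lagrange.num-const K n)

  private
    lucasSeries-const : ∀ ξ m k → B₁.lucasSeries (const ξ) m k K₁.≈ const (B.lucasSeries ξ m k)
    lucasSeries-const ξ m k = K₁.sym (K₁.trans (const-* _ _) (K₁.*-cong (const-num (lucas m k)) (const-^ ξ k)))

    lucasProduct-const : ∀ ξs m → B₁.lucasProduct (map const ξs) m L.≋ constants (B.lucasProduct ξs m)
    lucasProduct-const []       m =
      L.mk≋ λ { zero → K₁.refl ; (suc n) → K₁.sym (mk≋ λ { zero → K.refl ; (suc _) → K.refl }) }
    lucasProduct-const (ξ ∷ ξs) m = Lᵣ.trans
      (Lᵣ.*-cong {B₁.lucasSeries (const ξ) m} {constants (B.lucasSeries ξ m)} (L.mk≋ (lucasSeries-const ξ m))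
        (lucasProduct-const ξs m))
      (L.mk≋ λ n → constants-⊛ n (B.lucasSeries ξ m) (B.lucasProduct ξs m))

    diagonal : Series → L.Series
    diagonal c k = const (c k) K₁.* var K₁.^ k

    δ-diagonal : ∀ c → L.δ (diagonal c) L.≋ L.const var L.⊛ diagonal (δ c)
    δ-diagonal c = L.mk≋ λ k → K₁.trans
      (K₁.trans (K₁.sym (K₁.*-assoc _ _ _)) (K₁.trans (K₁.*-congʳ (K₁.*-comm _ _)) (K₁.*-assoc _ _ _)))
      (K₁.sym (L.const-⊛ var (diagonal (δ c)) k))

    δ-diagonal-⊛ : ∀ c h n → (L.δ (diagonal c) L.⊛ h) n K₁.≈ var K₁.* (diagonal (δ c) L.⊛ h) n
    δ-diagonal-⊛ c h n = L.coeff (Lᵣ.trans (Lᵣ.*-congʳ (δ-diagonal c))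
      (Lᵣ.*-assoc (L.const var) (diagonal (δ c)) h)) n
      ⟨≈⟩ L.const-⊛ var (diagonal (δ c) L.⊛ h) n
      where
      _⟨≈⟩_ = K₁.trans

    diagonal₀ : ∀ c n (g : Series) j → (diagonal c 0 K₁.* const (g n)) j K.≈ const (c 0 K.* g n) j
    diagonal₀ c n g j = coeff (K₁.trans (K₁.*-congʳ (K₁.*-identityʳ _)) (K₁.sym (const-* (c 0) (g n)))) j

  -- In `diagonal c` the exponent of `var` equals the degree of the outer series, so fixing the
  -- exponent `j` leaves a single term of the Cauchy product.
  diagonal-⊛ : ∀ c g n j → j ℕ.≤ n → (diagonal c L.⊛ constants g) n j K.≈ c j K.* g (n ℕ.∸ j)
  diagonal-⊛ c g zero zero _ = diagonal₀ c 0 g 0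
  diagonal-⊛ c g (suc n) zero _ = K.trans (K.+-cong (diagonal₀ c (suc n) g 0)
    (K.trans (coeff (δ-diagonal-⊛ c (constants g) n) 0) (var-⊛₀ ((diagonal (δ c) L.⊛ constants g) n))))
      (K.+-identityʳ _)
  diagonal-⊛ c g (suc n) (suc j) (ℕ.s≤s j≤n) = K.trans (K.+-cong (diagonal₀ c (suc n) g (suc j))
    (K.trans (coeff (δ-diagonal-⊛ c (constants g) n) (suc j))
      (K.trans (var-⊛ ((diagonal (δ c) L.⊛ constants g) n) j) (diagonal-⊛ (δ c) g n j j≤n)))) (K.+-identityˡ _)

  lucasProduct-∷ : ∀ ξs m n j → j ℕ.≤ n →
    B₁.lucasProduct (var ∷ map const ξs) m n j K.≈ (lucas m j K.· K.1#) K.* B.lucasProduct ξs m (n ℕ.∸ j)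
  lucasProduct-∷ ξs m n j j≤n = K.trans
    (coeff (L.coeff (Lᵣ.*-cong {B₁.lucasSeries var m} {diagonal (λ k → lucas m k K.· K.1#)}
      (L.mk≋ λ k → K₁.*-congʳ (K₁.sym (const-num (lucas m k)))) (lucasProduct-const ξs m)) n) j)
    (diagonal-⊛ (λ k → lucas m k K.· K.1#) (B.lucasProduct ξs m) n j j≤n)

-- Each factor contains its variable to the same power as `T`. The exponents `κ` thus prescribe the
-- term taken from every factor, and the degree in `T` has to be `Σ κ`.
lucasProduct-coefficient : ∀ m κ M →
  coefficient m κ (BranchPowers.lucasProduct (polynomials m) (variables m) M (sum (tabulate κ)))
                           ≡ ℤ.+ product (tabulate (λ i → lucas M (κ i)))
lucasProduct-coefficient zero    κ M = ≡.refl
lucasProduct-coefficient (suc m) κ M = ≡.trans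
  (coefficient-cong m _ (Extraction.lucasProduct-∷ (polynomials m) (variables m) M _ (κ zero)
    (ℕₚ.m≤m+n (κ zero) _)))
  (≡.trans (coefficient-num m (λ i → κ (suc i)) (lucas M (κ zero)) _)
  (≡.trans (≡.cong (λ n → ℤ.+ lucas M (κ zero) ℤ.* coefficient m (λ i → κ (suc i))
    (BranchPowers.lucasProduct (polynomials m) (variables m) M n))
             (ℕₚ.m+n∸m≡n (κ zero) _))
  (≡.trans (≡.cong (ℤ.+ lucas M (κ zero) ℤ.*_) (lucasProduct-coefficient m (λ i → κ (suc i)) M))
    (≡.sym (ℤₚ.pos-* (lucas M (κ zero)) _)))))

open import Data.Nat.Combinatorics using (_C_; nCk+nC[k+1]≡[n+1]C[k+1]; nC1≡n)

-- Monomials and Lucas numbers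

module Monomials (R : CommutativeRing 0ℓ 0ℓ) where
  open CommutativeRing R hiding (zero)
  open Powers semiring using (_^_; ^-homo-*)
  open IntegerSolver R

  monomial : List Carrier → (ℕ → ℕ) → Carrier
  monomial []       e = 1#
  monomial (x ∷ xs) e = x ^ e 0 * monomial xs (λ i → e (suc i))

  monomial-cong : ∀ xs {e e′} → (∀ i → e i ≡ e′ i) → monomial xs e ≈ monomial xs e′
  monomial-cong []       p = refl
  monomial-cong (x ∷ xs) p = *-cong (reflexive (≡.cong (x ^_) (p 0))) (monomial-cong xs (λ i → p (suc i)))

  monomial-+ : ∀ xs e e′ → monomial xs (λ i → e i ℕ.+ e′ i) ≈ monomial xs e * monomial xs e′
  monomial-+ []       e e′ = sym (*-identityˡ _)
  monomial-+ (x ∷ xs) e e′ = trans (*-cong (^-homo-* x (e 0) (e′ 0)) (monomial-+ xs _ _))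
    (solve 4 (λ a b c d → a :* b :* (c :* d) := a :* c :* (b :* d)) refl _ _ _ _)

  monomial-0 : ∀ xs → monomial xs (λ _ → 0) ≈ 1#
  monomial-0 []       = refl
  monomial-0 (x ∷ xs) = trans (*-identityˡ _) (monomial-0 xs)

module MonomialMap (R R′ : CommutativeRing 0ℓ 0ℓ)
  (φ : CommutativeRing.Carrier R → CommutativeRing.Carrier R′)
  (φ-* : ∀ x y → CommutativeRing._≈_ R′ (φ (CommutativeRing._*_ R x y)) (CommutativeRing._*_ R′ (φ x) (φ y)))
  (φ-1 : CommutativeRing._≈_ R′ (φ (CommutativeRing.1# R)) (CommutativeRing.1# R′)) where
  private
    module R = CommutativeRing R
    module R′ = CommutativeRing R′
    module M = Monomials R
    module M′ = Monomials R′
    open Powers R.semiring using (_^_)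
    open Powers R′.semiring using () renaming (_^_ to _^′_)

  ^-map : ∀ x n → φ (x ^ n) R′.≈ φ x ^′ n
  ^-map x zero    = φ-1
  ^-map x (suc n) = R′.trans (φ-* _ _) (R′.*-congˡ (^-map x n))

  monomial-map : ∀ xs e → φ (M.monomial xs e) R′.≈ M′.monomial (map φ xs) e
  monomial-map []       e = φ-1
  monomial-map (x ∷ xs) e = R′.trans (φ-* _ _) (R′.*-cong (^-map x (e 0)) (monomial-map xs _))

all-tabulate : ∀ {n} {A : Set} (p : A → Bool) (f : Fin n → A) {q : Fin n → Bool} → (∀ i → p (f i) ≡ q i) →
               all p (tabulate f) ≡ all q (tabulate (λ i → i))
all-tabulate {zero}  p f e = ≡.refl
all-tabulate {suc n} p f {q} e = ≡.cong₂ _∧_ (e zero)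
  (≡.trans (all-tabulate p (λ i → f (suc i)) {λ i → q (suc i)} (λ i → e (suc i)))
    (≡.sym (all-tabulate q suc (λ i → ≡.refl))))

matches : ∀ m → (Fin m → ℕ) → (ℕ → ℕ) → Bool
matches m κ e = all (λ i → e (toℕ i) ≡ᵇ κ i) (tabulate (λ i → i))

module _ (K : CommutativeRing 0ℓ 0ℓ) where
  private
    module K = CommutativeRing K
    module K₁ = CommutativeRing (PowerSeries.ring⟦⟧ K)
    open PowerSeries K
    open Powers K₁.semiring using (_^_)

  var^-const : ∀ e a j → ((var ^ e) ⊛ const a) j K.≈ (if e ≡ᵇ j then a else K.0#)
  var^-const zero    a zero    = coeff (K₁.*-identityˡ (const a)) 0
  var^-const zero    a (suc j) = coeff (K₁.*-identityˡ (const a)) (suc j)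
  var^-const (suc e) a zero    = K.trans (coeff (K₁.*-assoc var (var ^ e) (const a)) 0) (var-⊛₀ (var ^ e ⊛ const a))
  var^-const (suc e) a (suc j) = K.trans (coeff (K₁.*-assoc var (var ^ e) (const a)) (suc j))
    (K.trans (var-⊛ (var ^ e ⊛ const a) j) (var^-const e a j))

coefficient-monomial : ∀ m κ e → coefficient m κ (Monomials.monomial (polynomials m) (variables m) e)
                       ≡ (if matches m κ e then ℤ.+ 1 else ℤ.+ 0)
coefficient-monomial zero    κ e = ≡.refl
coefficient-monomial (suc m) κ e = ≡.trans
  (coefficient-cong m _ (K.trans
    (coeff (K₁.*-congˡ {var ^ e 0}
    (K₁.sym (MonomialMap.monomial-map K ring⟦⟧ const const-* K₁.refl (variables m) e′))) (κ zero))
                                 (var^-const K (e 0) _ (κ zero))))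
  (step (e 0 ≡ᵇ κ zero))
  where
  K = polynomials m
  module K = CommutativeRing K
  module K₁ = CommutativeRing (PowerSeries.ring⟦⟧ K)
  open Powers K₁.semiring using (_^_)
  open PowerSeries K
  κ′ : Fin m → ℕ
  κ′ i = κ (suc i)
  e′ : ℕ → ℕ
  e′ i = e (suc i)
  step : ∀ b → coefficient m κ′ (if b then Monomials.monomial K (variables m) e′ else K.0#)
         ≡ (if b ∧ all (λ i → e (toℕ i) ≡ᵇ κ i) (tabulate suc) then ℤ.+ 1 else ℤ.+ 0)
  step true  = ≡.trans (coefficient-monomial m κ′ e′)
    (≡.cong (if_then ℤ.+ 1 else ℤ.+ 0) (≡.sym (all-tabulate (λ i → e (toℕ i) ≡ᵇ κ i) suc (λ i → ≡.refl))))
  step false = coefficient-0 m κ′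

private
  -- The identity `(k + 1) C(n, k + 1) = (n − k) C(n, k)`, free of subtraction.
  absorption : ∀ n k → suc k ℕ.* (n C suc k) ℕ.+ k ℕ.* (n C k) ≡ n ℕ.* (n C k)
  absorption zero    zero    = ≡.refl
  absorption zero    (suc k) = ≡.cong₂ ℕ._+_ (ℕₚ.*-zeroʳ k) (ℕₚ.*-zeroʳ k)
  absorption (suc n) zero    = ≡.trans (ℕₚ.+-identityʳ _)
    (≡.trans (ℕₚ.*-identityˡ _) (≡.trans (nC1≡n (suc n)) (≡.sym (ℕₚ.*-identityʳ _))))
  absorption (suc n) (suc k) = begin
    suc (suc k) ℕ.* (suc n C suc (suc k)) ℕ.+ suc k ℕ.* (suc n C suc k)
      ≡⟨ ≡.cong₂ (λ a b → suc (suc k) ℕ.* a ℕ.+ suc k ℕ.* b) (≡.sym (nCk+nC[k+1]≡[n+1]C[k+1] n (suc k)))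
        (≡.sym (nCk+nC[k+1]≡[n+1]C[k+1] n k)) ⟩
    suc (suc k) ℕ.* (c₁ ℕ.+ c₂) ℕ.+ suc k ℕ.* (c₀ ℕ.+ c₁)
      ≡⟨ solve 4 (λ k c₀ c₁ c₂ → (con 2 :+ k) :* (c₁ :+ c₂) :+ (con 1 :+ k) :* (c₀ :+ c₁)
           := ((con 2 :+ k) :* c₂ :+ (con 1 :+ k) :* c₁) :+ ((con 1 :+ k) :* c₁ :+ k :* c₀) :+ (c₀ :+ c₁))
             ≡.refl k c₀ c₁ c₂ ⟩
    (suc (suc k) ℕ.* c₂ ℕ.+ suc k ℕ.* c₁) ℕ.+ (suc k ℕ.* c₁ ℕ.+ k ℕ.* c₀) ℕ.+ (c₀ ℕ.+ c₁)
      ≡⟨ ≡.cong₂ (λ a b → a ℕ.+ b ℕ.+ (c₀ ℕ.+ c₁)) (absorption n (suc k)) (absorption n k) ⟩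
    n ℕ.* c₁ ℕ.+ n ℕ.* c₀ ℕ.+ (c₀ ℕ.+ c₁)
      ≡⟨ solve 3 (λ n c₀ c₁ → n :* c₁ :+ n :* c₀ :+ (c₀ :+ c₁) := (con 1 :+ n) :* (c₀ :+ c₁)) ≡.refl n c₀ c₁ ⟩
    suc n ℕ.* (c₀ ℕ.+ c₁) ≡⟨ ≡.cong (suc n ℕ.*_) (nCk+nC[k+1]≡[n+1]C[k+1] n k) ⟩
    suc n ℕ.* (suc n C suc k) ∎
    where
    open ≡.≡-Reasoning
    open ℕSolver.+-*-Solver
    c₀ = n C k
    c₁ = n C suc k
    c₂ = n C suc (suc k)

  lucas-diagonal : ∀ k → lucas (suc k) (suc k) ≡ 0
  lucas-above : ∀ m k → m ℕ.≤ k → lucas m (suc k) ≡ 0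
  lucas-above zero          k m≤k = ≡.refl
  lucas-above (suc zero)    k m≤k = ≡.refl
  lucas-above (suc (suc m)) (suc k) (ℕ.s≤s m≤k) = ≡.cong₂ ℕ._+_ (lucas-above (suc m) (suc k) (ℕₚ.m≤n⇒m≤1+n m≤k))
    (lucas-above m k (ℕₚ.≤-trans (ℕₚ.n≤1+n m) m≤k))
  lucas-diagonal zero    = ≡.refl
  lucas-diagonal (suc k) = ≡.cong₂ ℕ._+_ (lucas-above (suc k) (suc k) ℕₚ.≤-refl) (lucas-above k k ℕₚ.≤-refl)

  lucas-0 : ∀ m → lucas (suc m) 0 ≡ 1
  lucas-0 zero    = ≡.refl
  lucas-0 (suc m) = lucas-0 m

  -- The classical value `C(m − j, j) + C(m − j − 1, j − 1)` of a Lucas coefficient at `j = k + 1`,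
  -- parametrised by `d = m − j − 1` so that no truncated subtraction occurs.
  lucas-binomial : ∀ d k → lucas (suc (suc (k ℕ.+ d))) (suc k) ≡ (suc d C suc k) ℕ.+ (d C k)
  lucas-binomial zero zero = ≡.refl
  lucas-binomial zero (suc k) rewrite ℕₚ.+-identityʳ k = ≡.cong₂ ℕ._+_ (lucas-diagonal (suc k)) (lucas-diagonal k)
  lucas-binomial (suc d) k = begin
    lucas (suc (k ℕ.+ suc d)) (suc k) ℕ.+ lucas (k ℕ.+ suc d) k
      ≡⟨ ≡.cong (λ m → lucas (suc m) (suc k) ℕ.+ lucas m k) (ℕₚ.+-suc k d) ⟩
    lucas (suc (suc (k ℕ.+ d))) (suc k) ℕ.+ lucas (suc (k ℕ.+ d)) k
      ≡⟨ ≡.cong (ℕ._+ lucas (suc (k ℕ.+ d)) k) (lucas-binomial d k) ⟩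
    (suc d C suc k) ℕ.+ (d C k) ℕ.+ lucas (suc (k ℕ.+ d)) k ≡⟨ ℕₚ.+-assoc (suc d C suc k) (d C k) _ ⟩
    (suc d C suc k) ℕ.+ ((d C k) ℕ.+ lucas (suc (k ℕ.+ d)) k) ≡⟨ ≡.cong ((suc d C suc k) ℕ.+_) (rest k) ⟩
    (suc d C suc k) ℕ.+ ((suc d C k) ℕ.+ (suc d C k))
      ≡⟨ solve 2 (λ a b → a :+ (b :+ b) := (b :+ a) :+ b) ≡.refl (suc d C suc k) (suc d C k) ⟩
    (suc d C k) ℕ.+ (suc d C suc k) ℕ.+ (suc d C k)
      ≡⟨ ≡.cong (ℕ._+ (suc d C k)) (nCk+nC[k+1]≡[n+1]C[k+1] (suc d) k) ⟩
    (suc (suc d) C suc k) ℕ.+ (suc d C k) ∎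
    where
    open ≡.≡-Reasoning
    open ℕSolver.+-*-Solver
    rest : ∀ k → (d C k) ℕ.+ lucas (suc (k ℕ.+ d)) k ≡ (suc d C k) ℕ.+ (suc d C k)
    rest zero    = ≡.cong suc (lucas-0 d)
    rest (suc k) = begin
      (d C suc k) ℕ.+ lucas (suc (suc (k ℕ.+ d))) (suc k) ≡⟨ ≡.cong ((d C suc k) ℕ.+_) (lucas-binomial d k) ⟩
      (d C suc k) ℕ.+ ((suc d C suc k) ℕ.+ (d C k))
        ≡⟨ solve 3 (λ a b c → a :+ (b :+ c) := (c :+ a) :+ b) ≡.refl (d C suc k) (suc d C suc k) (d C k) ⟩
      (d C k) ℕ.+ (d C suc k) ℕ.+ (suc d C suc k) ≡⟨ ≡.cong (ℕ._+ (suc d C suc k)) (nCk+nC[k+1]≡[n+1]C[k+1] d k) ⟩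
      (suc d C suc k) ℕ.+ (suc d C suc k) ∎

lucas-closed : ∀ n k → k ℕ.< n → lucas (2 ℕ.* n) k ℕ.* (n ℕ.∸ k) ≡ n ℕ.* ((2 ℕ.* n ℕ.∸ 1 ℕ.∸ k) C k)
lucas-closed (suc n) zero    k<n = ≡.trans (≡.cong (ℕ._* suc n) (lucas-0 (n ℕ.+ suc (n ℕ.+ 0))))
  (≡.trans (ℕₚ.*-identityˡ (suc n)) (≡.sym (ℕₚ.*-identityʳ (suc n))))
lucas-closed n       (suc k) k<n =
  ≡.subst (λ n → lucas (2 ℕ.* n) (suc k) ℕ.* (n ℕ.∸ suc k) ≡ n ℕ.* ((2 ℕ.* n ℕ.∸ 1 ℕ.∸ suc k) C suc k))
  (≡.trans (ℕₚ.+-comm (suc k) e) (ℕₚ.m∸n+n≡m (ℕₚ.<⇒≤ k<n))) main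
  where
  open ≡.≡-Reasoning
  open ℕSolver.+-*-Solver
  e = n ℕ.∸ suc k
  -- With `n = suc k + e`, this is `2 n − 1 − suc k`, the upper index of the binomial coefficient.
  N = k ℕ.+ 2 ℕ.* e
  c = N C suc k
  c′ = N C k
  double : 2 ℕ.* (suc k ℕ.+ e) ≡ suc (suc (k ℕ.+ N))
  double = solve 2 (λ k e → con 2 :* (con 1 :+ k :+ e) := con 2 :+ (k :+ (k :+ con 2 :* e))) ≡.refl k e
  twice : suc k ℕ.* c ≡ 2 ℕ.* e ℕ.* c′
  twice = ℕₚ.+-cancelʳ-≡ (k ℕ.* c′) _ _ (≡.trans (absorption N k)
    (solve 3 (λ k e c → (k :+ con 2 :* e) :* c := con 2 :* e :* c :+ k :* c) ≡.refl k e c′))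
  main : lucas (2 ℕ.* (suc k ℕ.+ e)) (suc k) ℕ.* (suc k ℕ.+ e ℕ.∸ suc k)
    ≡ (suc k ℕ.+ e) ℕ.* ((2 ℕ.* (suc k ℕ.+ e) ℕ.∸ 1 ℕ.∸ suc k) C suc k)
  main = begin
    lucas (2 ℕ.* (suc k ℕ.+ e)) (suc k) ℕ.* (suc k ℕ.+ e ℕ.∸ suc k)
      ≡⟨ ≡.cong₂ (λ a b → lucas a (suc k) ℕ.* b) double (ℕₚ.m+n∸m≡n (suc k) e) ⟩
    lucas (suc (suc (k ℕ.+ N))) (suc k) ℕ.* e ≡⟨ ≡.cong (ℕ._* e) (lucas-binomial N k) ⟩
    ((suc N C suc k) ℕ.+ c′) ℕ.* e ≡⟨ ≡.cong (λ a → (a ℕ.+ c′) ℕ.* e) (≡.sym (nCk+nC[k+1]≡[n+1]C[k+1] N k)) ⟩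
    (c′ ℕ.+ c ℕ.+ c′) ℕ.* e
      ≡⟨ solve 3 (λ c′ c e → (c′ :+ c :+ c′) :* e := con 2 :* e :* c′ :+ e :* c) ≡.refl c′ c e ⟩
    2 ℕ.* e ℕ.* c′ ℕ.+ e ℕ.* c ≡⟨ ≡.cong (ℕ._+ e ℕ.* c) (≡.sym twice) ⟩
    suc k ℕ.* c ℕ.+ e ℕ.* c ≡⟨ ≡.sym (ℕₚ.*-distribʳ-+ c (suc k) e) ⟩
    (suc k ℕ.+ e) ℕ.* c
      ≡⟨ ≡.cong (λ a → (suc k ℕ.+ e) ℕ.* (a C suc k))
      (≡.sym (≡.trans (≡.cong (λ a → a ℕ.∸ 1 ℕ.∸ suc k) double) (ℕₚ.m+n∸m≡n k N))) ⟩
    (suc k ℕ.+ e) ℕ.* ((2 ℕ.* (suc k ℕ.+ e) ℕ.∸ 1 ℕ.∸ suc k) C suc k) ∎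

open import Defs
open import Data.Bool using (T)
open import Data.List using (length; _++_; [_]; _ʳ++_; concat; concatMap; upTo; applyUpTo; allFin; filterᵇ)
open import Data.List.Membership.Propositional using (_∈_; _∉_; lose)
open import Data.List.Membership.Propositional.Properties
open import Data.List.Membership.Propositional.Properties.WithK using (unique∧set⇒bag)
open import Data.List.Relation.Binary.BagAndSetEquality using (∼bag⇒↭)
open import Data.List.Relation.Binary.Permutation.Propositional.Properties using (↭-length)
open import Data.List.Relation.Unary.AllPairs as AllPairs using (AllPairs; []; _∷_)
import Data.List.Relation.Unary.AllPairs.Properties as AllPairsₚ
open import Data.List.Relation.Unary.Any using (Any; here; there)
open import Data.List.Relation.Unary.Unique.Propositional using (Unique)
import Data.List.Relation.Unary.Unique.Propositional.Properties as Uniqueₚ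
open import Data.Unit using (⊤; tt)
open import Function.Bundles using (mk⇔)
open import Relation.Binary using (tri<; tri≈; tri>)
open import Relation.Nullary.Decidable using (T?)
open import Data.Nat using (_≤_; _<_; z≤n; s≤s; _∸_)
open ≡ using (refl; sym; trans; cong; cong₂; subst)

-- Structure of the `r`-permutations sorted by two passes

module Words where
  open import Data.Nat using (_+_; _⊓_; _≤ᵇ_; _<ᵇ_)

  -- Stack sorting

  ≡ᵇ-refl : ∀ n → (n ≡ᵇ n) ≡ true
  ≡ᵇ-refl zero    = refl
  ≡ᵇ-refl (suc n) = ≡ᵇ-refl n

  StrictlyMonotone : (ℕ → ℕ) → Set
  StrictlyMonotone f = ∀ {i j} → i < j → f i < f j

  module StrictlyMonotoneProperties {f : ℕ → ℕ} (f< : StrictlyMonotone f) where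
    mono-injective : ∀ {i j} → f i ≡ f j → i ≡ j
    mono-injective {i} {j} eq with ℕₚ.<-cmp i j
    ... | tri< i<j _ _ = ⊥-elim (ℕₚ.<⇒≢ (f< i<j) eq)
    ... | tri≈ _ i≡j _ = i≡j
    ... | tri> _ _ j<i = ⊥-elim (ℕₚ.<⇒≢ (f< j<i) (sym eq))

    mono-≤ : ∀ {i j} → i ≤ j → f i ≤ f j
    mono-≤ {i} {j} i≤j with ℕₚ.m≤n⇒m<n∨m≡n i≤j
    ... | inj₁ i<j  = ℕₚ.<⇒≤ (f< i<j)
    ... | inj₂ refl = ℕₚ.≤-refl

    mono-cancel-< : ∀ {i j} → f i < f j → i < j
    mono-cancel-< {i} {j} p with ℕₚ.<-cmp i j
    ... | tri< i<j _ _  = i<j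
    ... | tri≈ _ refl _ = ⊥-elim (ℕₚ.<-irrefl refl p)
    ... | tri> _ _ j<i  = ⊥-elim (ℕₚ.<-asym p (f< j<i))

    mono-cancel-≤ : ∀ {i j} → f i ≤ f j → i ≤ j
    mono-cancel-≤ {i} {j} p with ℕₚ.<-cmp i j
    ... | tri< i<j _ _  = ℕₚ.<⇒≤ i<j
    ... | tri≈ _ refl _ = ℕₚ.≤-refl
    ... | tri> _ _ j<i  = ⊥-elim (ℕₚ.<⇒≱ (f< j<i) p)

    ≡ᵇ-mono : ∀ i j → (f i ≡ᵇ f j) ≡ (i ≡ᵇ j)
    ≡ᵇ-mono i j with i ≡ᵇ j in eq
    ... | true  rewrite ℕₚ.≡ᵇ⇒≡ i j (subst T (sym eq) tt) = ≡ᵇ-refl (f j)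
    ... | false with f i ≡ᵇ f j in eq′
    ...   | true  = ⊥-elim (subst T eq (ℕₚ.≡⇒≡ᵇ i j (mono-injective (ℕₚ.≡ᵇ⇒≡ (f i) (f j) (subst T (sym eq′) tt)))))
    ...   | false = refl

  ≢⇒≡ᵇ : ∀ {m n} → m ≢ n → (m ≡ᵇ n) ≡ false
  ≢⇒≡ᵇ {m} {n} m≢n with m ≡ᵇ n in eq
  ... | true  = ⊥-elim (m≢n (ℕₚ.≡ᵇ⇒≡ m n (subst T (sym eq) tt)))
  ... | false = refl

  ≡ᵇ-true : ∀ m n → (m ≡ᵇ n) ≡ true → m ≡ n
  ≡ᵇ-true m n eq = ℕₚ.≡ᵇ⇒≡ m n (subst T (sym eq) tt)

  ≡ᵇ-false : ∀ m {n} → (m ≡ᵇ n) ≡ false → m ≢ n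
  ≡ᵇ-false m eq refl = subst T (trans (sym (≡ᵇ-refl m)) eq) tt

  ∈⇒≤maxL : ∀ {x w} → x ∈ w → x ≤ maxL w
  ∈⇒≤maxL (here refl)         = ℕₚ.m≤m⊔n _ _
  ∈⇒≤maxL {w = y ∷ w} (there x∈w) = ℕₚ.≤-trans (∈⇒≤maxL x∈w) (ℕₚ.m≤n⊔m y (maxL w))

  maxL∈ : ∀ x w → maxL (x ∷ w) ∈ x ∷ w
  maxL∈ x []      rewrite ℕₚ.⊔-identityʳ x = here refl
  maxL∈ x (y ∷ w) with ℕₚ.⊔-sel x (maxL (y ∷ w))
  ... | inj₁ eq rewrite eq = here refl
  ... | inj₂ eq = subst (_∈ x ∷ y ∷ w) (sym eq) (there (maxL∈ y w))

  maxL-unique : ∀ {m w} → m ∈ w → (∀ {x} → x ∈ w → x ≤ m) → maxL w ≡ m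
  maxL-unique {m} {x ∷ w} m∈w ub = ℕₚ.≤-antisym (ub (maxL∈ x w)) (∈⇒≤maxL m∈w)

  joinW : ℕ → List Word → Word
  joinW m []            = []
  joinW m (α ∷ [])      = α
  joinW m (α ∷ β ∷ αs) = α ++ m ∷ joinW m (β ∷ αs)

  splitAll-nonempty : ∀ m w → ∃[ α ] ∃[ αs ] splitAll m w ≡ α ∷ αs
  splitAll-nonempty m []      = [] , [] , refl
  splitAll-nonempty m (x ∷ w) with x ≡ᵇ m | splitAll-nonempty m w
  ... | true  | _           = [] , splitAll m w , refl
  ... | false | α , αs , eq = x ∷ α , αs , cong (consHead x) eq

  join-splitAll : ∀ m w → joinW m (splitAll m w) ≡ w
  join-splitAll m []      = refl
  join-splitAll m (x ∷ w) with x ≡ᵇ m in eq | splitAll-nonempty m w | join-splitAll m w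
  ... | true  | α , αs , s | ih rewrite s = cong₂ _∷_ (sym (≡ᵇ-true x m eq)) ih
  ... | false | α , αs , s | ih rewrite s = trans (push α αs) (cong (x ∷_) ih)
    where
    push : ∀ α αs → joinW m ((x ∷ α) ∷ αs) ≡ x ∷ joinW m (α ∷ αs)
    push α []       = refl
    push α (β ∷ αs) = refl

  splitAll-join : ∀ m α αs → All (All (_≢ m)) (α ∷ αs) → splitAll m (joinW m (α ∷ αs)) ≡ α ∷ αs
  splitAll-join m [] [] _ = refl
  splitAll-join m [] (β ∷ αs) (_ ∷ p) =
    trans (cong (λ b → if b then [] ∷ splitAll m (joinW m (β ∷ αs)) else consHead m
      (splitAll m (joinW m (β ∷ αs)))) (≡ᵇ-refl m))
          (cong ([] ∷_) (splitAll-join m β αs p))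
  splitAll-join m (x ∷ α) [] ((x≢m ∷ q) ∷ []) =
    trans (cong (λ b → if b then [] ∷ splitAll m α else consHead x (splitAll m α)) (≢⇒≡ᵇ x≢m))
          (cong (consHead x) (splitAll-join m α [] (q ∷ [])))
  splitAll-join m (x ∷ α) (β ∷ αs) ((x≢m ∷ q) ∷ p) =
    trans (cong (λ b → if b then [] ∷ splitAll m (α ++ m ∷ joinW m (β ∷ αs)) else consHead x
      (splitAll m (α ++ m ∷ joinW m (β ∷ αs)))) (≢⇒≡ᵇ x≢m))
          (cong (consHead x) (splitAll-join m α (β ∷ αs) (q ∷ p)))

  splitAll-≢ : ∀ m w → All (All (_≢ m)) (splitAll m w)
  splitAll-≢ m []      = [] ∷ []
  splitAll-≢ m (x ∷ w) with x ≡ᵇ m in eq | splitAll m w | splitAll-≢ m w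
  ... | true  | _      | ps = [] ∷ ps
  ... | false | []     | ps     = (≡ᵇ-false x eq ∷ []) ∷ []
  ... | false | α ∷ αs | p ∷ ps = (≡ᵇ-false x eq ∷ p) ∷ ps

  ∈-join⁺ : ∀ {x} m αs → x ∈ concat αs → x ∈ joinW m αs
  ∈-join⁺ m (α ∷ []) x∈ = subst (_ ∈_) (Listₚ.++-identityʳ α) x∈
  ∈-join⁺ m (α ∷ β ∷ αs) x∈ = [ ∈-++⁺ˡ , (λ p → ∈-++⁺ʳ α (there (∈-join⁺ m (β ∷ αs) p))) ]′ (∈-++⁻ α x∈)

  ∈-join⁻ : ∀ {x} m αs → x ∈ joinW m αs → x ∈ concat αs ⊎ x ≡ m
  ∈-join⁻ m (α ∷ []) x∈ = inj₁ (subst (_ ∈_) (sym (Listₚ.++-identityʳ α)) x∈)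
  ∈-join⁻ {x} m (α ∷ β ∷ αs) x∈ = [ (λ p → inj₁ (∈-++⁺ˡ p)) , later (∈-join⁻ m (β ∷ αs)) ]′ (∈-++⁻ α x∈)
    where
    later : (x ∈ joinW m (β ∷ αs) → x ∈ concat (β ∷ αs) ⊎ x ≡ m) → x ∈ m ∷ joinW m (β ∷ αs) →
      x ∈ concat (α ∷ β ∷ αs) ⊎ x ≡ m
    later ih (here eq) = inj₂ eq
    later ih (there p) = [ (λ q → inj₁ (∈-++⁺ʳ α q)) , inj₂ ]′ (ih p)

  ∈-splitAll⁻ : ∀ {x α} m w → α ∈ splitAll m w → x ∈ α → x ∈ w
  ∈-splitAll⁻ m w α∈ x∈α = subst (_ ∈_) (join-splitAll m w) (∈-join⁺ m (splitAll m w) (∈-concat⁺′ x∈α α∈))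

  private
    length-join : ∀ {α} m αs → α ∈ αs → length α ≤ length (joinW m αs)
    length-join m (α ∷ [])      (here refl) = ℕₚ.≤-refl
    length-join m (α ∷ β ∷ αs) (here refl) = subst (length α ≤_) (sym (Listₚ.length-++ α)) (ℕₚ.m≤m+n _ _)
    length-join m (α ∷ β ∷ αs) (there p)   = subst (_ ≤_) (sym (Listₚ.length-++ α))
      (ℕₚ.≤-trans (length-join m (β ∷ αs) p) (ℕₚ.≤-trans (ℕₚ.n≤1+n _) (ℕₚ.m≤n+m _ (length α))))

    length-join-< : ∀ {α} m β γ αs → α ∈ β ∷ γ ∷ αs → length α < length (joinW m (β ∷ γ ∷ αs))
    length-join-< m β γ αs (here refl) = subst (length β <_) (sym (Listₚ.length-++ β)) (ℕₚ.m<m+n _ (s≤s z≤n))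
    length-join-< m β γ αs (there p)   = subst (_ <_) (sym (Listₚ.length-++ β))
      (ℕₚ.<-≤-trans (s≤s (length-join m (γ ∷ αs) p)) (ℕₚ.m≤n+m _ (length β)))

    splitAll-two : ∀ m w → m ∈ w → ∃[ α ] ∃[ β ] ∃[ αs ] splitAll m w ≡ α ∷ β ∷ αs
    splitAll-two m (x ∷ w) m∈ with x ≡ᵇ m in eq | m∈
    splitAll-two m (x ∷ w) m∈ | true | _ with splitAll-nonempty m w
    ... | β , αs , s rewrite s = [] , β , αs , refl
    splitAll-two m (x ∷ w) m∈ | false | here refl with trans (sym (≡ᵇ-refl m)) eq
    ... | ()
    splitAll-two m (x ∷ w) m∈ | false | there p with splitAll-two m w p
    ... | α , β , αs , s rewrite s = x ∷ α , β , αs , refl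

  -- As `m` occurs there are at least two pieces, each shorter than the word. Hence the length of a
  -- word is enough fuel for `stackSortR`, and induction along the splitting is well founded.
  length-splitAll : ∀ m x w → m ∈ x ∷ w → All (λ α → length α ≤ length w) (splitAll m (x ∷ w))
  length-splitAll m x w m∈ with splitAll m (x ∷ w) | splitAll-two m (x ∷ w) m∈ | join-splitAll m (x ∷ w)
  ... | _ | α , β , αs , refl | j = All.tabulate λ p →
    ℕₚ.≤-pred (subst (λ v → _ < length v) j (length-join-< m α β αs p))

  stackSortR-fuel : ∀ f g w → length w ≤ f → length w ≤ g → stackSortR f w ≡ stackSortR g w
  stackSortR-fuel zero    zero    []      _ _ = refl
  stackSortR-fuel zero    (suc g) []      _ _ = refl
  stackSortR-fuel (suc f) zero    []      _ _ = refl
  stackSortR-fuel (suc f) (suc g) []      _ _ = refl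
  stackSortR-fuel (suc f) (suc g) (x ∷ w) (s≤s p) (s≤s q) = cong (λ u → concat u ++ [ maxL (x ∷ w) ])
    (Listₚ.map-cong-local (All.map (λ {α} l → stackSortR-fuel f g α (ℕₚ.≤-trans l p) (ℕₚ.≤-trans l q))
      (length-splitAll _ x w (maxL∈ x w))))

  Sᵣ-step : ∀ w → w ≢ [] → Sᵣ w ≡ concat (map Sᵣ (splitAll (maxL w) w)) ++ [ maxL w ]
  Sᵣ-step []      w≢[] = ⊥-elim (w≢[] refl)
  Sᵣ-step (x ∷ w) _    = cong (λ u → concat u ++ [ maxL (x ∷ w) ])
    (Listₚ.map-cong-local (All.map (λ {α} l → stackSortR-fuel (length w) (length α) α l ℕₚ.≤-refl)
      (length-splitAll _ x w (maxL∈ x w))))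

  word-induction : (P : Word → Set) → P [] →
    (∀ w → w ≢ [] → All P (splitAll (maxL w) w) → P w) → ∀ w → P w
  word-induction P p[] step w = go (length w) w ℕₚ.≤-refl
    where
    go : ∀ n w → length w ≤ n → P w
    go n       []      _       = p[]
    go (suc n) (x ∷ w) (s≤s l) = step (x ∷ w) (λ ()) (All.map (λ {α} k → go n α (ℕₚ.≤-trans k l))
      (length-splitAll _ x w (maxL∈ x w)))

  All-<-maxL : ∀ w → All (All (_< maxL w)) (splitAll (maxL w) w)
  All-<-maxL w = All.tabulate λ {α} α∈ → All.tabulate λ {x} x∈ →
    ℕₚ.≤∧≢⇒< (∈⇒≤maxL (∈-splitAll⁻ (maxL w) w α∈ x∈)) (All.lookup (All.lookup (splitAll-≢ (maxL w) w) α∈) x∈)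

  maxL∈-nonempty : ∀ {w} → w ≢ [] → maxL w ∈ w
  maxL∈-nonempty {[]}    w≢[] = ⊥-elim (w≢[] refl)
  maxL∈-nonempty {x ∷ w} _    = maxL∈ x w

  Sᵣ-∈⁻ : ∀ w {x} → x ∈ Sᵣ w → x ∈ w
  Sᵣ-∈⁻ = word-induction (λ w → ∀ {x} → x ∈ Sᵣ w → x ∈ w) (λ ()) step
    where
    step : ∀ w → w ≢ [] → All (λ w → ∀ {x} → x ∈ Sᵣ w → x ∈ w) (splitAll (maxL w) w) → ∀ {x} → x ∈ Sᵣ w → x ∈ w
    step w w≢[] ih x∈ with ∈-++⁻ (concat (map Sᵣ (splitAll (maxL w) w))) (subst (_ ∈_) (Sᵣ-step w w≢[]) x∈)
    ... | inj₂ (here refl) = maxL∈-nonempty w≢[]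
    ... | inj₁ p with ∈-concat⁻′ (map Sᵣ (splitAll (maxL w) w)) p
    ...   | σ , x∈σ , σ∈ with ∈-map⁻ Sᵣ σ∈
    ...     | α , α∈ , refl = ∈-splitAll⁻ (maxL w) w α∈ (All.lookup ih α∈ x∈σ)

  Sᵣ-∈⁺ : ∀ w {x} → x ∈ w → x ∈ Sᵣ w
  Sᵣ-∈⁺ = word-induction (λ w → ∀ {x} → x ∈ w → x ∈ Sᵣ w) (λ ()) step
    where
    step : ∀ w → w ≢ [] → All (λ w → ∀ {x} → x ∈ w → x ∈ Sᵣ w) (splitAll (maxL w) w) → ∀ {x} → x ∈ w → x ∈ Sᵣ w
    step w w≢[] ih x∈ = subst (_ ∈_) (sym (Sᵣ-step w w≢[]))
      (cases (∈-join⁻ (maxL w) (splitAll (maxL w) w) (subst (_ ∈_) (sym (join-splitAll (maxL w) w)) x∈)))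
      where
      cases : ∀ {x} → x ∈ concat (splitAll (maxL w) w) ⊎ x ≡ maxL w →
        x ∈ concat (map Sᵣ (splitAll (maxL w) w)) ++ [ maxL w ]
      cases (inj₂ refl) = ∈-++⁺ʳ _ (here refl)
      cases (inj₁ p) with ∈-concat⁻′ (splitAll (maxL w) w) p
      ... | α , x∈α , α∈ = ∈-++⁺ˡ (∈-concat⁺′ (All.lookup ih α∈ x∈α) (∈-map⁺ Sᵣ α∈))

  sortedLetters : List Word → Word
  sortedLetters αs = concat (map Sᵣ αs)

  concat-Sᵣ-∈⁻ : ∀ αs {x} → x ∈ concat (map Sᵣ αs) → x ∈ concat αs
  concat-Sᵣ-∈⁻ αs p with ∈-concat⁻′ (map Sᵣ αs) p
  ... | σ , x∈σ , σ∈ with ∈-map⁻ Sᵣ σ∈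
  ...   | α , α∈ , refl = ∈-concat⁺′ (Sᵣ-∈⁻ α x∈σ) α∈

  concat-Sᵣ-∈⁺ : ∀ αs {x} → x ∈ concat αs → x ∈ concat (map Sᵣ αs)
  concat-Sᵣ-∈⁺ αs p with ∈-concat⁻′ αs p
  ... | α , x∈α , α∈ = ∈-concat⁺′ (Sᵣ-∈⁺ α x∈α) (∈-map⁺ Sᵣ α∈)

  Sᵣ-max : ∀ w → w ≢ [] → ∃[ v ] Sᵣ w ≡ v ++ [ maxL w ] × All (_< maxL w) v
  Sᵣ-max w w≢[] = concat (map Sᵣ αs) , Sᵣ-step w w≢[] , All.tabulate λ x∈ → bound (concat-Sᵣ-∈⁻ αs x∈)
    where
    αs = splitAll (maxL w) w
    bound : ∀ {x} → x ∈ concat αs → x < maxL w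
    bound p with ∈-concat⁻′ αs p
    ... | α , x∈α , α∈ = All.lookup (All.lookup (All-<-maxL w) α∈) x∈α

  maxL-join : ∀ m α β αs → All (All (_< m)) (α ∷ β ∷ αs) → maxL (joinW m (α ∷ β ∷ αs)) ≡ m
  maxL-join m α β αs p = maxL-unique (∈-++⁺ʳ α (here refl)) bound
    where
    bound : ∀ {x} → x ∈ joinW m (α ∷ β ∷ αs) → x ≤ m
    bound x∈ with ∈-join⁻ m (α ∷ β ∷ αs) x∈
    ... | inj₂ refl = ℕₚ.≤-refl
    ... | inj₁ q with ∈-concat⁻′ (α ∷ β ∷ αs) q
    ...   | γ , x∈γ , γ∈ = ℕₚ.<⇒≤ (All.lookup (All.lookup p γ∈) x∈γ)

  Sᵣ-join : ∀ m α β αs → All (All (_< m)) (α ∷ β ∷ αs) →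
            Sᵣ (joinW m (α ∷ β ∷ αs)) ≡ concat (map Sᵣ (α ∷ β ∷ αs)) ++ [ m ]
  Sᵣ-join m α β αs p = trans (Sᵣ-step (joinW m (α ∷ β ∷ αs)) (nonempty α))
    (cong₂ (λ u v → concat (map Sᵣ u) ++ [ v ])
      (trans (cong (λ k → splitAll k (joinW m (α ∷ β ∷ αs))) (maxL-join m α β αs p))
             (splitAll-join m α (β ∷ αs) (All.map (All.map ℕₚ.<⇒≢) p)))
      (maxL-join m α β αs p))
    where
    nonempty : ∀ α {v : Word} → α ++ m ∷ v ≢ []
    nonempty []      ()
    nonempty (_ ∷ _) ()

  module _ {f : ℕ → ℕ} (f< : StrictlyMonotone f) where
    open StrictlyMonotoneProperties f<

    maxL-map : ∀ x w → maxL (map f (x ∷ w)) ≡ f (maxL (x ∷ w))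
    maxL-map x w = maxL-unique (∈-map⁺ f (maxL∈ x w)) bound
      where
      bound : ∀ {y} → y ∈ map f (x ∷ w) → y ≤ f (maxL (x ∷ w))
      bound y∈ with ∈-map⁻ f y∈
      ... | z , z∈ , refl = mono-≤ (∈⇒≤maxL z∈)

    splitAll-map : ∀ m w → splitAll (f m) (map f w) ≡ map (map f) (splitAll m w)
    splitAll-map m []      = refl
    splitAll-map m (x ∷ w) rewrite ≡ᵇ-mono x m with x ≡ᵇ m
    ... | true  = cong ([] ∷_) (splitAll-map m w)
    ... | false = trans (cong (consHead (f x)) (splitAll-map m w)) (consHead-map (splitAll m w))
      where
      consHead-map : ∀ ss → consHead (f x) (map (map f) ss) ≡ map (map f) (consHead x ss)
      consHead-map []       = refl
      consHead-map (_ ∷ _) = refl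

    Sᵣ-map : ∀ w → Sᵣ (map f w) ≡ map f (Sᵣ w)
    Sᵣ-map = word-induction (λ w → Sᵣ (map f w) ≡ map f (Sᵣ w)) refl step
      where
      step : ∀ w → w ≢ [] → All (λ w → Sᵣ (map f w) ≡ map f (Sᵣ w)) (splitAll (maxL w) w) →
        Sᵣ (map f w) ≡ map f (Sᵣ w)
      step []        w≢[] ih = refl
      step w@(y ∷ v) w≢[] ih = begin
        Sᵣ (map f w) ≡⟨ Sᵣ-step (map f w) (λ ()) ⟩
        concat (map Sᵣ (splitAll (maxL (map f w)) (map f w))) ++ [ maxL (map f w) ]
          ≡⟨ cong (λ k → concat (map Sᵣ (splitAll k (map f w))) ++ [ k ]) (maxL-map y v) ⟩
        concat (map Sᵣ (splitAll (f (maxL w)) (map f w))) ++ [ f (maxL w) ]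
          ≡⟨ cong (λ u → concat (map Sᵣ u) ++ [ f (maxL w) ]) (splitAll-map (maxL w) w) ⟩
        concat (map Sᵣ (map (map f) (splitAll (maxL w) w))) ++ [ f (maxL w) ]
          ≡⟨ cong (λ u → concat u ++ [ f (maxL w) ])
            (trans (sym (Listₚ.map-∘ _)) (trans (Listₚ.map-cong-local ih) (Listₚ.map-∘ _))) ⟩
        concat (map (map f) (map Sᵣ (splitAll (maxL w) w))) ++ [ f (maxL w) ]
          ≡⟨ cong (_++ [ f (maxL w) ]) (Listₚ.concat-map (map Sᵣ (splitAll (maxL w) w))) ⟩
        map f (concat (map Sᵣ (splitAll (maxL w) w))) ++ [ f (maxL w) ]
          ≡⟨ sym (Listₚ.map-++ f (concat (map Sᵣ (splitAll (maxL w) w))) [ maxL w ]) ⟩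
        map f (concat (map Sᵣ (splitAll (maxL w) w)) ++ [ maxL w ]) ≡⟨ cong (map f) (sym (Sᵣ-step w w≢[])) ⟩
        map f (Sᵣ w) ∎
        where open ≡.≡-Reasoning

    concat-Sᵣ-map : ∀ αs → concat (map Sᵣ (map (map f) αs)) ≡ map f (concat (map Sᵣ αs))
    concat-Sᵣ-map αs = trans (cong concat
      (trans (sym (Listₚ.map-∘ αs)) (trans (Listₚ.map-cong Sᵣ-map αs) (Listₚ.map-∘ αs))))
      (Listₚ.concat-map (map Sᵣ αs))

  -- Avoiding 231

  -- All letters up to `t` precede all larger ones. This serves two purposes: with `t` the letter in
  -- front of the word, it forbids that letter to play the 2 of a 231; for a permutation, it says
  -- that a direct-sum component ends at `t`.
  data Cut (t : ℕ) : Word → Set where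
    above : ∀ {v} → All (t <_) v → Cut t v
    below : ∀ {x v} → x ≤ t → Cut t v → Cut t (x ∷ v)

  -- Words with distinct letters avoiding the pattern 231.
  data Avoids231 : Word → Set where
    []  : Avoids231 []
    _∷_ : ∀ {x v} → All (x ≢_) v × Cut x v → Avoids231 v → Avoids231 (x ∷ v)

  cut-≤ : ∀ {t v} → All (_≤ t) v → Cut t v
  cut-≤ []       = above []
  cut-≤ (p ∷ ps) = below p (cut-≤ ps)

  cut-++⁻ : ∀ {t} u {v} → Cut t (u ++ v) → Cut t u × Cut t v
  cut-++⁻ []      c           = above [] , c
  cut-++⁻ (x ∷ u) (above p)   = above (Allₚ.++⁻ˡ (x ∷ u) p) , above (Allₚ.++⁻ʳ (x ∷ u) p)
  cut-++⁻ (x ∷ u) (below p c) with cut-++⁻ u c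
  ... | c₁ , c₂ = below p c₁ , c₂

  cut-++⁺ : ∀ {t u v} → Cut t u → All (t <_) v → Cut t (u ++ v)
  cut-++⁺ (above p)   q = above (Allₚ.++⁺ p q)
  cut-++⁺ (below p c) q = below p (cut-++⁺ c q)

  cut-≤-++⁺ : ∀ {t u v} → All (_≤ t) u → Cut t v → Cut t (u ++ v)
  cut-≤-++⁺ []       c = c
  cut-≤-++⁺ (p ∷ ps) c = below p (cut-≤-++⁺ ps c)

  cut-after : ∀ {t} u {a v} → t < a → Cut t (u ++ a ∷ v) → All (t <_) v
  cut-after []      t<a (above (_ ∷ p)) = p
  cut-after []      t<a (below a≤t _)   = ⊥-elim (ℕₚ.<⇒≱ t<a a≤t)
  cut-after (x ∷ u) t<a (above (_ ∷ p)) = cut-after u t<a (above p)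
  cut-after (x ∷ u) t<a (below _ c)     = cut-after u t<a c

  cut-map : ∀ {t t′ v} (f : ℕ → ℕ) → All (λ x → x ≤ t → f x ≤ t′) v → All (λ x → t < x → t′ < f x) v → Cut t v →
    Cut t′ (map f v)
  cut-map f _        q (above p)   = above (Allₚ.map⁺ (All.zipWith (λ (g , y) → g y) (q , p)))
  cut-map f (r ∷ rs) (_ ∷ q) (below p c) = below (r p) (cut-map f rs q c)

  cut-map⁻ : ∀ {t t′} v (f : ℕ → ℕ) → All (λ x → f x ≤ t′ → x ≤ t) v → All (λ x → t′ < f x → t < x) v →
    Cut t′ (map f v) → Cut t v
  cut-map⁻ []      f _        _ _           = above []
  cut-map⁻ v@(_ ∷ _) f _      q (above p)   = above (All.zipWith (λ (g , y) → g y) (q , Allₚ.map⁻ p))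
  cut-map⁻ (x ∷ v) f (r ∷ rs) (_ ∷ q) (below p c) = below (r p) (cut-map⁻ v f rs q c)

  -- With `a` playing the 3, no letter of `σ` can be followed by a smaller letter in `τ`.
  avoids-++⁻ : ∀ {a} σ {τ} → All (_< a) σ → Avoids231 (σ ++ a ∷ τ) →
    Avoids231 σ × All (λ x → All (x <_) τ) σ × All (a ≢_) τ × Cut a τ × Avoids231 τ
  avoids-++⁻ [] [] ((a≢ , c) ∷ av) = [] , [] , a≢ , c , av
  avoids-++⁻ (x ∷ σ) (x<a ∷ σ<a) ((x≢ , c) ∷ av) with avoids-++⁻ σ σ<a av
  ... | avσ , σ<τ , rest = ((Allₚ.++⁻ˡ σ x≢ , proj₁ (cut-++⁻ σ c)) ∷ avσ) , (cut-after σ x<a c ∷ σ<τ) , rest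

  avoids-++⁺ : ∀ {a σ τ} → All (_< a) σ → Avoids231 σ → All (λ x → All (x <_) τ) σ → All (a ≢_) τ → Cut a τ →
    Avoids231 τ →
    Avoids231 (σ ++ a ∷ τ)
  avoids-++⁺ [] [] [] a≢ c av = (a≢ , c) ∷ av
  avoids-++⁺ (x<a ∷ σ<a) ((x≢ , cx) ∷ avσ) (x<τ ∷ σ<τ) a≢ c av =
    (Allₚ.++⁺ x≢ (ℕₚ.<⇒≢ x<a ∷ All.map ℕₚ.<⇒≢ x<τ) , cut-++⁺ cx (x<a ∷ x<τ)) ∷ avoids-++⁺ σ<a avσ σ<τ a≢ c av

  avoids-∷ʳ⁻ : ∀ {a} σ → All (_< a) σ → Avoids231 (σ ++ [ a ]) → Avoids231 σ
  avoids-∷ʳ⁻ σ p av = proj₁ (avoids-++⁻ σ p av)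

  avoids-∷ʳ⁺ : ∀ {a σ} → All (_< a) σ → Avoids231 σ → Avoids231 (σ ++ [ a ])
  avoids-∷ʳ⁺ p av = avoids-++⁺ p av (All.map (λ _ → []) p) [] (above []) []

  module _ {f : ℕ → ℕ} (f< : StrictlyMonotone f) where
    open StrictlyMonotoneProperties f<

    avoids-map⁺ : ∀ {v} → Avoids231 v → Avoids231 (map f v)
    avoids-map⁺ []             = []
    avoids-map⁺ ((x≢ , c) ∷ av) =
      (Allₚ.map⁺ (All.map (λ x≢y eq → x≢y (mono-injective eq)) x≢) , cut-map f (All.tabulate λ _ → mono-≤)
        (All.tabulate λ _ → f<) c) ∷ avoids-map⁺ av

    avoids-map⁻ : ∀ v → Avoids231 (map f v) → Avoids231 v
    avoids-map⁻ []      []              = []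
    avoids-map⁻ (x ∷ v) ((x≢ , c) ∷ av) =
      (All.map (λ fx≢fy eq → fx≢fy (cong f eq)) (Allₚ.map⁻ x≢) , cut-map⁻ v f (All.tabulate λ _ → mono-cancel-≤)
        (All.tabulate λ _ → mono-cancel-<) c) ∷ avoids-map⁻ v av

  Ascending : Word → Set
  Ascending = AllPairs _<_

  ascending-++⁻ : ∀ u {v} → Ascending (u ++ v) → Ascending u × Ascending v × All (λ x → All (x <_) v) u
  ascending-++⁻ []      p        = [] , p , []
  ascending-++⁻ (x ∷ u) (q ∷ p) with ascending-++⁻ u p
  ... | au , av , c = Allₚ.++⁻ˡ u q ∷ au , av , Allₚ.++⁻ʳ u q ∷ c

  private
    splitFirst-spec : ∀ m w → m ∈ w →
      w ≡ proj₁ (splitFirst m w) ++ m ∷ proj₂ (splitFirst m w) × All (_≢ m) (proj₁ (splitFirst m w))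
    splitFirst-spec m (x ∷ w) m∈ with x ≡ᵇ m in eq
    ... | true  = cong (_∷ w) (≡ᵇ-true x m eq) , []
    ... | false with splitFirst m w | splitFirst-spec m w
    ...   | l , r | ih with m∈
    ...     | here refl = ⊥-elim (≡ᵇ-false x eq refl)
    ...     | there p   = cong (x ∷_) (proj₁ (ih p)) , ≡ᵇ-false x eq ∷ proj₂ (ih p)

    stackSortD-step : ∀ f x w → let m = maxL (x ∷ w) in ∃[ l ] ∃[ r ]
      stackSortD (suc f) (x ∷ w) ≡ stackSortD f l ++ stackSortD f r ++ [ m ] × x ∷ w
        ≡ l ++ m ∷ r × All (_< m) l × All (_≤ m) r
    stackSortD-step f x w with splitFirst (maxL (x ∷ w)) (x ∷ w) | splitFirst-spec (maxL (x ∷ w))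
      (x ∷ w) (maxL∈ x w)
    ... | l , r | eq , l≢ = l , r , refl , eq ,
      All.tabulate (λ {y} y∈ → ℕₚ.≤∧≢⇒< (∈⇒≤maxL (subst (y ∈_) (sym eq) (∈-++⁺ˡ y∈))) (All.lookup l≢ y∈)) ,
      All.tabulate (λ {y} y∈ → ∈⇒≤maxL (subst (y ∈_) (sym eq) (∈-++⁺ʳ l (there y∈))))

    lengths : ∀ (l : Word) {m r n} → length (l ++ m ∷ r) ≤ suc n → length l ≤ n × length r ≤ n
    lengths l {m} {r} {n} p rewrite Listₚ.length-++ l {m ∷ r} | ℕₚ.+-suc (length l) (length r) =
      ℕₚ.≤-trans (ℕₚ.m≤m+n _ _) (ℕₚ.≤-pred p) , ℕₚ.≤-trans (ℕₚ.m≤n+m _ (length l)) (ℕₚ.≤-pred p)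

    ∈-three⁻ : ∀ {y m : ℕ} (u v : Word) → y ∈ u ++ v ++ [ m ] → y ∈ u ⊎ y ∈ v ⊎ y ≡ m
    ∈-three⁻ u v p with ∈-++⁻ u p
    ... | inj₁ q = inj₁ q
    ... | inj₂ q with ∈-++⁻ v q
    ...   | inj₁ s           = inj₂ (inj₁ s)
    ...   | inj₂ (here refl) = inj₂ (inj₂ refl)

    stackSortD-∈⁻ : ∀ f w {y} → length w ≤ f → y ∈ stackSortD f w → y ∈ w
    stackSortD-∈⁻ (suc f) (x ∷ w) {y} p y∈ with stackSortD-step f x w
    ... | l , r , eq , w≡ , _ , _ with lengths l (subst (λ v → length v ≤ suc f) w≡ p) | ∈-three⁻ (stackSortD f l)
      (stackSortD f r) (subst (y ∈_) eq y∈)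
    ...   | pl , pr | inj₁ q             = subst (y ∈_) (sym w≡) (∈-++⁺ˡ (stackSortD-∈⁻ f l pl q))
    ...   | pl , pr | inj₂ (inj₁ q)      = subst (y ∈_) (sym w≡) (∈-++⁺ʳ l (there (stackSortD-∈⁻ f r pr q)))
    ...   | pl , pr | inj₂ (inj₂ refl)   = subst (y ∈_) (sym w≡) (∈-++⁺ʳ l (here refl))

    stackSortD-∈⁺ : ∀ f w {y} → length w ≤ f → y ∈ w → y ∈ stackSortD f w
    stackSortD-∈⁺ (suc f) (x ∷ w) {y} p y∈ with stackSortD-step f x w
    ... | l , r , eq , w≡ , _ , _ with lengths l (subst (λ v → length v ≤ suc f) w≡ p) | ∈-++⁻ l
      (subst (y ∈_) w≡ y∈)
    ...   | pl , pr | inj₁ q           = subst (y ∈_) (sym eq) (∈-++⁺ˡ (stackSortD-∈⁺ f l pl q))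
    ...   | pl , pr | inj₂ (here refl) =
      subst (y ∈_) (sym eq) (∈-++⁺ʳ (stackSortD f l) (∈-++⁺ʳ (stackSortD f r) (here refl)))
    ...   | pl , pr | inj₂ (there q)   =
      subst (y ∈_) (sym eq) (∈-++⁺ʳ (stackSortD f l) (∈-++⁺ˡ (stackSortD-∈⁺ f r pr q)))

    -- Knuth's criterion. Around the maximum `m` the word is `l m r`, and avoidance puts all of `l`
    -- below all of `r`, which is the order in which `S` outputs them.
    stackSortD-ascending : ∀ f w → length w ≤ f → Avoids231 w → Ascending (stackSortD f w)
    stackSortD-ascending zero    []      _ _ = []
    stackSortD-ascending (suc f) []      _ _ = []
    stackSortD-ascending (suc f) (x ∷ w) p av with stackSortD-step f x w
    ... | l , r , eq , w≡ , l<m , r≤m with lengths l (subst (λ v → length v ≤ suc f) w≡ p) | avoids-++⁻ l l<m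
      (subst Avoids231 w≡ av)
    ...   | pl , pr | avl , l<r , m≢r , _ , avr =
      subst Ascending (sym eq) (AllPairsₚ.++⁺ (stackSortD-ascending f l pl avl)
      (AllPairsₚ.++⁺ (stackSortD-ascending f r pr avr) ([] ∷ [])
        (All.tabulate λ y∈ → let y∈r = stackSortD-∈⁻ f r pr y∈ in ℕₚ.≤∧≢⇒< (All.lookup r≤m y∈r) (λ eq → All.lookup m≢r y∈r (sym eq)) ∷ []))
      (All.tabulate λ y∈ → let y∈l = stackSortD-∈⁻ f l pl y∈ in
        Allₚ.++⁺ (All.tabulate λ z∈ → All.lookup (All.lookup l<r y∈l) (stackSortD-∈⁻ f r pr z∈))
          (All.lookup l<m y∈l ∷ [])))

    -- Conversely, the letters of `l` are output before those of `r`, so ascending output puts `l`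
    -- below `r`. The maximum itself can only play the 3, as `cut-≤` records.
    stackSortD-avoids : ∀ f w → length w ≤ f → Ascending (stackSortD f w) → Avoids231 w
    stackSortD-avoids f       []      _ _ = []
    stackSortD-avoids (suc f) (x ∷ w) p asc with stackSortD-step f x w
    ... | l , r , eq , w≡ , l<m , r≤m with lengths l (subst (λ v → length v ≤ suc f) w≡ p) | ascending-++⁻
      (stackSortD f l) (subst Ascending eq asc)
    ...   | pl , pr | ascl , ascrm , l<rm with ascending-++⁻ (stackSortD f r) ascrm
    ...     | ascr , _ , r<m = subst Avoids231 (sym w≡) (avoids-++⁺ l<m (stackSortD-avoids f l pl ascl)
      (All.tabulate λ y∈ → All.tabulate λ z∈ → All.lookup
        (Allₚ.++⁻ˡ (stackSortD f r) (All.lookup l<rm (stackSortD-∈⁺ f l pl y∈))) (stackSortD-∈⁺ f r pr z∈))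
      (All.tabulate λ y∈ eq → ℕₚ.<⇒≢ (All.head (All.lookup r<m (stackSortD-∈⁺ f r pr y∈))) (sym eq))
      (cut-≤ r≤m) (stackSortD-avoids f r pr ascr))

  ascending-unique : ∀ {u v} → Ascending u → Ascending v → (∀ {x} → x ∈ u → x ∈ v) → (∀ {x} → x ∈ v → x ∈ u) → u ≡ v
  ascending-unique []      []      _ _ = refl
  ascending-unique []      (_ ∷ _) _ q with q (here refl)
  ... | ()
  ascending-unique (_ ∷ _) []      p _ with p (here refl)
  ... | ()
  ascending-unique {x ∷ u} {y ∷ v} (x< ∷ au) (y< ∷ av) p q = cong₂ _∷_ x≡y (ascending-unique au av
    (λ z∈ → tail (ℕₚ.<⇒≢ (All.lookup x< z∈)) x≡y (p (there z∈)))
    (λ z∈ → tail (ℕₚ.<⇒≢ (All.lookup y< z∈)) (sym x≡y) (q (there z∈))))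
    where
    x≡y : x ≡ y
    x≡y with p (here refl) | q (here refl)
    ... | here eq  | _        = eq
    ... | there _  | here eq  = sym eq
    ... | there x∈ | there y∈ = ⊥-elim (ℕₚ.<-asym (All.lookup x< y∈) (All.lookup y< x∈))
    tail : ∀ {a b z : ℕ} {w} → a ≢ z → a ≡ b → z ∈ b ∷ w → z ∈ w
    tail a≢z refl (here refl) = ⊥-elim (a≢z refl)
    tail a≢z refl (there z∈)  = z∈

  range-ascending : ∀ n → Ascending (range n)
  range-ascending n = AllPairsₚ.map⁺ (AllPairsₚ.applyUpTo⁺₁ (λ x → x) n (λ i<j _ → s≤s i<j))

  ∈-range⁻ : ∀ n {x} → x ∈ range n → 1 ≤ x × x ≤ n
  ∈-range⁻ n x∈ with ∈-map⁻ suc x∈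
  ... | y , y∈ , refl with ∈-applyUpTo⁻ (λ x → x) y∈
  ...   | z , z<n , refl = s≤s z≤n , z<n

  ∈-range⁺ : ∀ n {x} → 1 ≤ x → x ≤ n → x ∈ range n
  ∈-range⁺ n {suc x} _ x<n = ∈-map⁺ suc (∈-applyUpTo⁺ (λ x → x) x<n)

  S-sorts : ∀ n v → Avoids231 v → (∀ {x} → x ∈ v → 1 ≤ x × x ≤ n) → (∀ {x} → 1 ≤ x → x ≤ n → x ∈ v) → S v ≡ range n
  S-sorts n v av bound total = ascending-unique (stackSortD-ascending (length v) v ℕₚ.≤-refl av) (range-ascending n)
    (λ x∈ → let (p , q) = bound (stackSortD-∈⁻ (length v) v ℕₚ.≤-refl x∈) in ∈-range⁺ n p q)
    (λ x∈ → let (p , q) = ∈-range⁻ n x∈ in stackSortD-∈⁺ (length v) v ℕₚ.≤-refl (total p q))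

  S-sorts⁻ : ∀ n v → S v ≡ range n → Avoids231 v
  S-sorts⁻ n v eq = stackSortD-avoids (length v) v ℕₚ.≤-refl (subst Ascending (sym eq) (range-ascending n))

  eqW⇒≡ : ∀ u v → eqW u v ≡ true → u ≡ v
  eqW⇒≡ []      []      _ = refl
  eqW⇒≡ (x ∷ u) (y ∷ v) p with x ≡ᵇ y in eq
  ... | true = cong₂ _∷_ (≡ᵇ-true x y eq) (eqW⇒≡ u v p)

  eqW-refl : ∀ u → eqW u u ≡ true
  eqW-refl []      = refl
  eqW-refl (x ∷ u) rewrite ≡ᵇ-refl x = eqW-refl u

  -- Removing the largest letter

  ∧-true⁻ : ∀ {a b} → a ∧ b ≡ true → a ≡ true × b ≡ true
  ∧-true⁻ {true} {true} _ = refl , refl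

  ∧-true⁺ : ∀ {a b} → a ≡ true → b ≡ true → a ∧ b ≡ true
  ∧-true⁺ refl refl = refl

  T⇒≡true : ∀ {b} → T b → b ≡ true
  T⇒≡true {true} _ = refl

  ≡true⇒T : ∀ {b} → b ≡ true → T b
  ≡true⇒T refl = tt

  module _ {A : Set} (p : A → Bool) where
    all-true⁻ : ∀ xs → all p xs ≡ true → All (λ x → p x ≡ true) xs
    all-true⁻ []       _  = []
    all-true⁻ (x ∷ xs) eq = let (a , b) = ∧-true⁻ eq in a ∷ all-true⁻ xs b

    all-true⁺ : ∀ {xs} → All (λ x → p x ≡ true) xs → all p xs ≡ true
    all-true⁺ []       = refl
    all-true⁺ (a ∷ as) = ∧-true⁺ a (all-true⁺ as)

  allBelow⁻ : ∀ n p → allBelow n p ≡ true → ∀ {i} → i < n → p i ≡ true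
  allBelow⁻ n p eq i<n = All.lookup (all-true⁻ p (upTo n) eq) (∈-applyUpTo⁺ (λ x → x) i<n)

  allBelow⁺ : ∀ n p → (∀ i → i < n → p i ≡ true) → allBelow n p ≡ true
  allBelow⁺ n p h = all-true⁺ p (Allₚ.applyUpTo⁺₁ (λ x → x) n (λ {i} → h i))

  -- The condition of `patternOK` for one occurrence of `x` standing in front of the word, recast as
  -- a recursion on the word instead of a quantification over positions.
  Nested : ℕ → Word → Set
  Nested x []      = ⊤
  Nested x (y ∷ w) = (x ∈ w → y ≤ x) × Nested x w

  Pattern : Word → Set
  Pattern []      = ⊤
  Pattern (x ∷ w) = Nested x w × Pattern w

  private
    at0-suc : ∀ x w j → at0 (x ∷ w) (suc j) ≡ at0 w j
    at0-suc x w j with at w j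
    ... | just _  = refl
    ... | nothing = refl

    at0-∈ : ∀ w k → k < length w → at0 w k ∈ w
    at0-∈ (x ∷ w) zero    _       = here refl
    at0-∈ (x ∷ w) (suc k) (s≤s p) = subst (_∈ x ∷ w) (sym (at0-suc x w k)) (there (at0-∈ w k p))

    ∈-at0 : ∀ {x} w → x ∈ w → ∃[ k ] k < length w × at0 w k ≡ x
    ∈-at0 (x ∷ w) (here refl) = 0 , s≤s z≤n , refl
    ∈-at0 (x ∷ w) (there p) with ∈-at0 w p
    ... | k , k< , eq = suc k , s≤s k< , trans (at0-suc x w k) eq

    NestedAt : ℕ → Word → Set
    NestedAt x w = ∀ j k → j < k → k < length w → x ≡ at0 w k → at0 w j ≤ x

    PatternAt : Word → Set
    PatternAt w = ∀ i j k → i < j → j < k → k < length w → at0 w i ≡ at0 w k → at0 w j ≤ at0 w i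

    nested⇒at : ∀ x w → Nested x w → NestedAt x w
    nested⇒at x (y ∷ w) (p , _) zero    (suc k) _         (s≤s k<) eq =
      p (subst (_∈ w) (sym (trans eq (at0-suc y w k))) (at0-∈ w k k<))
    nested⇒at x (y ∷ w) (_ , q) (suc j) (suc k) (s≤s j<k) (s≤s k<) eq =
      subst (_≤ x) (sym (at0-suc y w j)) (nested⇒at x w q j k j<k k< (trans eq (at0-suc y w k)))

    at⇒nested : ∀ x w → NestedAt x w → Nested x w
    at⇒nested x []      h = tt
    at⇒nested x (y ∷ w) h = first , at⇒nested x w λ j k j<k k< eq →
        subst (_≤ x) (at0-suc y w j) (h (suc j) (suc k) (s≤s j<k) (s≤s k<) (trans eq (sym (at0-suc y w k))))
      where
      first : x ∈ w → y ≤ x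
      first x∈ with ∈-at0 w x∈
      ... | k , k< , eq = h 0 (suc k) (s≤s z≤n) (s≤s k<) (sym (trans (at0-suc y w k) eq))

    pattern⇒at : ∀ w → Pattern w → PatternAt w
    pattern⇒at (x ∷ w) (p , _) zero (suc j) (suc k) _ (s≤s j<k) (s≤s k<) eq =
      subst (_≤ x) (sym (at0-suc x w j)) (nested⇒at x w p j k j<k k< (trans eq (at0-suc x w k)))
    pattern⇒at (x ∷ w) (_ , q) (suc i) (suc j) (suc k) (s≤s i<j) (s≤s j<k) (s≤s k<) eq =
      ≡.subst₂ _≤_ (sym (at0-suc x w j)) (sym (at0-suc x w i))
        (pattern⇒at w q i j k i<j j<k k< (trans (sym (at0-suc x w i)) (trans eq (at0-suc x w k))))

    at⇒pattern : ∀ w → PatternAt w → Pattern w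
    at⇒pattern []      h = tt
    at⇒pattern (x ∷ w) h =
      at⇒nested x w (λ j k j<k k< eq → subst (_≤ x) (at0-suc x w j)
        (h 0 (suc j) (suc k) (s≤s z≤n) (s≤s j<k) (s≤s k<) (trans eq (sym (at0-suc x w k))))) ,
      at⇒pattern w (λ i j k i<j j<k k< eq → ≡.subst₂ _≤_ (at0-suc x w j) (at0-suc x w i)
        (h (suc i) (suc j) (suc k) (s≤s i<j) (s≤s j<k) (s≤s k<)
          (trans (at0-suc x w i) (trans eq (sym (at0-suc x w k))))))

  patternOK⇒Pattern : ∀ w → patternOK w ≡ true → Pattern w
  patternOK⇒Pattern w h = at⇒pattern w λ i j k i<j j<k k< eq →
    let j<n = ℕₚ.<-trans j<k k<
        e = allBelow⁻ (length w) _ (allBelow⁻ (length w) _ (allBelow⁻ (length w) _ h (ℕₚ.<-trans i<j j<n)) j<n) k<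
    in extract (T⇒≡true (ℕₚ.<⇒<ᵇ i<j)) (T⇒≡true (ℕₚ.<⇒<ᵇ j<k))
      (trans (cong (at0 w i ≡ᵇ_) (sym eq)) (≡ᵇ-refl (at0 w i))) e
    where
    extract : ∀ {a b c m n} → a ≡ true → b ≡ true → c ≡ true → (if a ∧ b ∧ c then m ≤ᵇ n else true) ≡ true → m ≤ n
    extract {m = m} {n} refl refl refl e = ℕₚ.≤ᵇ⇒≤ m n (≡true⇒T e)

  Pattern⇒patternOK : ∀ w → Pattern w → patternOK w ≡ true
  Pattern⇒patternOK w p = allBelow⁺ n _ λ i i<n → allBelow⁺ n _ λ j j<n → allBelow⁺ n _ λ k k<n → check i j k k<n
    where
    n = length w
    check : ∀ i j k → k < n → (if (i <ᵇ j) ∧ (j <ᵇ k) ∧ (at0 w i ≡ᵇ at0 w k) then at0 w j ≤ᵇ at0 w i else true)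
      ≡ true
    check i j k k<n with i <ᵇ j in e₁ | j <ᵇ k in e₂ | at0 w i ≡ᵇ at0 w k in e₃
    ... | true  | true  | true  =
      T⇒≡true (ℕₚ.≤⇒≤ᵇ (pattern⇒at w p i j k (ℕₚ.<ᵇ⇒< i j (≡true⇒T e₁)) (ℕₚ.<ᵇ⇒< j k (≡true⇒T e₂)) k<n
      (≡ᵇ-true _ _ e₃)))
    ... | true  | true  | false = refl
    ... | true  | false | _     = refl
    ... | false | _     | _     = refl

  Separated : List Word → Set
  Separated []       = ⊤
  Separated (α ∷ αs) = (∀ {x} → x ∈ α → x ∉ concat αs) × Separated αs

  private
    nested-≤ : ∀ {m} w → All (_≤ m) w → Nested m w
    nested-≤ []      []       = tt
    nested-≤ (y ∷ w) (p ∷ ps) = (λ _ → p) , nested-≤ w ps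

    nested-∉ : ∀ {x} w → x ∉ w → Nested x w
    nested-∉ []      _   = tt
    nested-∉ (y ∷ w) x∉ = (λ x∈ → ⊥-elim (x∉ (there x∈))) , nested-∉ w (λ x∈ → x∉ (there x∈))

    nested-++⁻ : ∀ {x m} u {w} → x < m → Nested x (u ++ m ∷ w) → Nested x u × x ∉ w
    nested-++⁻ []      x<m (p , _) = tt , λ x∈ → ℕₚ.<⇒≱ x<m (p x∈)
    nested-++⁻ (y ∷ u) x<m (p , q) with nested-++⁻ u x<m q
    ... | nu , x∉ = ((λ x∈ → p (∈-++⁺ˡ x∈)) , nu) , x∉

    nested-++⁺ : ∀ {x m} u {w} → x < m → Nested x u → x ∉ w → Nested x (u ++ m ∷ w)
    nested-++⁺ []      x<m _       x∉ = (λ x∈ → ⊥-elim (x∉ x∈)) , nested-∉ _ x∉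
    nested-++⁺ {x} {m} (y ∷ u) {w} x<m (p , q) x∉ = first , nested-++⁺ u x<m q x∉
      where
      first : x ∈ u ++ m ∷ w → y ≤ x
      first x∈ with ∈-++⁻ u x∈
      ... | inj₁ x∈u         = p x∈u
      ... | inj₂ (here refl) = ⊥-elim (ℕₚ.<-irrefl refl x<m)
      ... | inj₂ (there x∈w) = ⊥-elim (x∉ x∈w)

  -- A letter of `u` that reappeared in `w` would enclose the larger letter `m`.
  pattern-++⁻ : ∀ {m} u {w} → All (_< m) u → Pattern (u ++ m ∷ w) → Pattern u × Pattern w × (∀ {x} → x ∈ u → x ∉ w)
  pattern-++⁻ []      _          (_ , q) = tt , q , λ ()
  pattern-++⁻ (x ∷ u) (x<m ∷ ps) (n , q) with pattern-++⁻ u ps q | nested-++⁻ u x<m n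
  ... | pu , pw , dis | nu , x∉ = (nu , pu) , pw , λ { (here refl) → x∉ ; (there p) → dis p }

  pattern-++⁺ : ∀ {m} u {w} → All (_< m) u → All (_≤ m) w → Pattern u → Pattern w → (∀ {x} → x ∈ u → x ∉ w) →
    Pattern (u ++ m ∷ w)
  pattern-++⁺ []      _          w≤ _         pw dis = nested-≤ _ w≤ , pw
  pattern-++⁺ (x ∷ u) (x<m ∷ ps) w≤ (nu , pu) pw dis =
    nested-++⁺ u x<m nu (dis (here refl)) , pattern-++⁺ u ps w≤ pu pw (λ p → dis (there p))

  join-≤ : ∀ m αs → All (All (_< m)) αs → All (_≤ m) (joinW m αs)
  join-≤ m αs p = All.tabulate bound
    where
    bound : ∀ {x} → x ∈ joinW m αs → x ≤ m
    bound x∈ with ∈-join⁻ m αs x∈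
    ... | inj₂ refl = ℕₚ.≤-refl
    ... | inj₁ q with ∈-concat⁻′ αs q
    ...   | γ , x∈γ , γ∈ = ℕₚ.<⇒≤ (All.lookup (All.lookup p γ∈) x∈γ)

  pattern-join⁻ : ∀ m αs → All (All (_< m)) αs → Pattern (joinW m αs) → All Pattern αs × Separated αs
  pattern-join⁻ m [] _ _ = [] , tt
  pattern-join⁻ m (α ∷ []) _ p = p ∷ [] , (λ _ ()) , tt
  pattern-join⁻ m (α ∷ β ∷ αs) (α<m ∷ αs<m) p =
    let (pα , pr , dis) = pattern-++⁻ α α<m p
        (ps , sep) = pattern-join⁻ m (β ∷ αs) αs<m pr
    in pα ∷ ps , (λ x∈α x∈ → dis x∈α (∈-join⁺ m (β ∷ αs) x∈)) , sep

  pattern-join⁺ : ∀ m αs → All (All (_< m)) αs → All Pattern αs → Separated αs → Pattern (joinW m αs)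
  pattern-join⁺ m [] _ _ _ = tt
  pattern-join⁺ m (α ∷ []) _ (p ∷ _) _ = p
  pattern-join⁺ m (α ∷ β ∷ αs) (α<m ∷ αs<m) (p ∷ ps) (dis , sep) =
    pattern-++⁺ α α<m (join-≤ m (β ∷ αs) αs<m) p (pattern-join⁺ m (β ∷ αs) αs<m ps sep) dis′
    where
    dis′ : ∀ {x} → x ∈ α → x ∉ joinW m (β ∷ αs)
    dis′ x∈α x∈ with ∈-join⁻ m (β ∷ αs) x∈
    ... | inj₁ q    = dis x∈α q
    ... | inj₂ refl = ℕₚ.<-irrefl refl (All.lookup α<m x∈α)

  ∈-map-inj⁻ : ∀ {f : ℕ → ℕ} → (∀ {i j} → f i ≡ f j → i ≡ j) → ∀ {x w} → f x ∈ map f w → x ∈ w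
  ∈-map-inj⁻ {f} inj {x} {w} p with ∈-map⁻ f p
  ... | y , y∈ , eq = subst (_∈ w) (sym (inj eq)) y∈

  module _ {f : ℕ → ℕ} (f< : StrictlyMonotone f) where
    open StrictlyMonotoneProperties f<

    nested-map⁺ : ∀ x w → Nested x w → Nested (f x) (map f w)
    nested-map⁺ x []      _       = tt
    nested-map⁺ x (y ∷ w) (p , q) = (λ x∈ → mono-≤ (p (∈-map-inj⁻ mono-injective x∈))) , nested-map⁺ x w q

    pattern-map⁺ : ∀ w → Pattern w → Pattern (map f w)
    pattern-map⁺ []      _       = tt
    pattern-map⁺ (x ∷ w) (p , q) = nested-map⁺ x w p , pattern-map⁺ w q

    nested-map⁻ : ∀ x w → Nested (f x) (map f w) → Nested x w
    nested-map⁻ x []      _       = tt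
    nested-map⁻ x (y ∷ w) (p , q) = (λ x∈ → mono-cancel-≤ (p (∈-map⁺ f x∈))) , nested-map⁻ x w q

    pattern-map⁻ : ∀ w → Pattern (map f w) → Pattern w
    pattern-map⁻ []      _       = tt
    pattern-map⁻ (x ∷ w) (p , q) = nested-map⁻ x w p , pattern-map⁻ w q

    occ-map : ∀ a w → occ (f a) (map f w) ≡ occ a w
    occ-map a []      = refl
    occ-map a (x ∷ w) rewrite ≡ᵇ-mono a x | occ-map a w = refl

    separated-map⁺ : ∀ αs → Separated αs → Separated (map (map f) αs)
    separated-map⁺ []       _       = tt
    separated-map⁺ (α ∷ αs) (p , q) = dis , separated-map⁺ αs q
      where
      dis : ∀ {x} → x ∈ map f α → x ∉ concat (map (map f) αs)
      dis x∈ x∈′ with ∈-map⁻ f x∈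
      ... | y , y∈ , refl = p y∈ (∈-map-inj⁻ mono-injective (subst (f y ∈_) (Listₚ.concat-map αs) x∈′))

    separated-map⁻ : ∀ αs → Separated (map (map f) αs) → Separated αs
    separated-map⁻ []       _       = tt
    separated-map⁻ (α ∷ αs) (p , q) =
      (λ x∈ x∈′ → p (∈-map⁺ f x∈) (subst (_ ∈_) (sym (Listₚ.concat-map αs)) (∈-map⁺ f x∈′))) , separated-map⁻ αs q

  occ-++ : ∀ a u v → occ a (u ++ v) ≡ occ a u + occ a v
  occ-++ a []      v = refl
  occ-++ a (x ∷ u) v with a ≡ᵇ x
  ... | true  = cong suc (occ-++ a u v)
  ... | false = occ-++ a u v

  occ-∉ : ∀ {a} w → a ∉ w → occ a w ≡ 0
  occ-∉ []      _  = refl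
  occ-∉ {a} (x ∷ w) a∉ with a ≡ᵇ x in eq
  ... | true  = ⊥-elim (a∉ (here (≡ᵇ-true a x eq)))
  ... | false = occ-∉ w (λ a∈ → a∉ (there a∈))

  occ-∈ : ∀ {a} w → 1 ≤ occ a w → a ∈ w
  occ-∈ {a} (x ∷ w) p with a ≡ᵇ x in eq
  ... | true  = here (≡ᵇ-true a x eq)
  ... | false = there (occ-∈ w p)

  occ-cons-≢ : ∀ {a x} w → a ≢ x → occ a (x ∷ w) ≡ occ a w
  occ-cons-≢ w a≢x rewrite ≢⇒≡ᵇ a≢x = refl

  occ-cons-≡ : ∀ a w → occ a (a ∷ w) ≡ suc (occ a w)
  occ-cons-≡ a w rewrite ≡ᵇ-refl a = refl

  occ-join : ∀ {a} m αs → a ≢ m → occ a (joinW m αs) ≡ occ a (concat αs)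
  occ-join m [] _ = refl
  occ-join {a} m (α ∷ []) _ = cong (occ a) (sym (Listₚ.++-identityʳ α))
  occ-join {a} m (α ∷ β ∷ αs) a≢m = trans (occ-++ a α _) (trans
    (cong (occ a α +_) (trans (occ-cons-≢ (joinW m (β ∷ αs)) a≢m) (occ-join m (β ∷ αs) a≢m)))
    (sym (occ-++ a α (concat (β ∷ αs)))))

  occ-join-max : ∀ m α αs → All (All (_< m)) (α ∷ αs) → occ m (joinW m (α ∷ αs)) ≡ length αs
  occ-join-max m α [] (p ∷ _) = occ-∉ α (λ m∈ → ℕₚ.<-irrefl refl (All.lookup p m∈))
  occ-join-max m α (β ∷ αs) (p ∷ ps) = trans (occ-++ m α _) (trans
    (cong₂ _+_ (occ-∉ α (λ m∈ → ℕₚ.<-irrefl refl (All.lookup p m∈))) (occ-cons-≡ m (joinW m (β ∷ αs))))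
    (cong suc (occ-join-max m β αs ps)))

  record Letters (r n : ℕ) (w : Word) : Set where
    constructor letters
    field
      bounds : ∀ {x} → x ∈ w → 1 ≤ x × x ≤ n
      full   : ∀ {a} → 1 ≤ a → a ≤ n → occ a w ≡ r
  open Letters public

  record GoodWord (r n : ℕ) (w : Word) : Set where
    constructor goodWord
    field
      w-letters : Letters r n w
      w-pattern : Pattern w
      w-avoids  : Avoids231 (Sᵣ w)
  open GoodWord public

  -- The words α₁, …, αⱼ between the occurrences of the largest letter of a good word.
  record Good (r n : ℕ) (αs : List Word) : Set where
    constructor good
    field
      g-letters   : Letters r n (concat αs)
      g-pattern   : All Pattern αs
      g-separated : Separated αs
      g-avoids    : Avoids231 (sortedLetters αs)
  open Good public

  concat-All : ∀ {P : ℕ → Set} αs → (∀ {x} → x ∈ concat αs → P x) → All (All P) αs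
  concat-All αs h = All.tabulate λ α∈ → All.tabulate λ x∈ → h (∈-concat⁺′ x∈ α∈)

  good-bounds : ∀ {r n αs} → Good r n αs → All (All (_< suc n)) αs
  good-bounds {αs = αs} g = concat-All αs (λ x∈ → s≤s (proj₂ (bounds (g-letters g) x∈)))

  concat-Sᵣ-< : ∀ {r n αs} → Good r n αs → All (_< suc n) (sortedLetters αs)
  concat-Sᵣ-< {αs = αs} g = All.tabulate λ x∈ → s≤s (proj₂ (bounds (g-letters g) (concat-Sᵣ-∈⁻ αs x∈)))

  -- Sorting the joined word only appends the largest letter to the sorted pieces, and a maximum in
  -- last place takes part in no 231.
  good-join⁺ : ∀ {r n} αs → length αs ≡ suc (suc r) → Good (suc r) n αs →
    GoodWord (suc r) (suc n) (joinW (suc n) αs)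
  good-join⁺ {r} {n} αs@(α ∷ β ∷ γ) len g = goodWord
    (letters bnd cnt)
    (pattern-join⁺ (suc n) αs (good-bounds g) (g-pattern g) (g-separated g))
    (subst Avoids231 (sym (Sᵣ-join (suc n) α β γ (good-bounds g))) (avoids-∷ʳ⁺ (concat-Sᵣ-< g) (g-avoids g)))
    where
    bnd : ∀ {x} → x ∈ joinW (suc n) αs → 1 ≤ x × x ≤ suc n
    bnd x∈ with ∈-join⁻ (suc n) αs x∈
    ... | inj₁ p    = let (a , b) = bounds (g-letters g) p in a , ℕₚ.m≤n⇒m≤1+n b
    ... | inj₂ refl = s≤s z≤n , ℕₚ.≤-refl
    cnt : ∀ {a} → 1 ≤ a → a ≤ suc n → occ a (joinW (suc n) αs) ≡ suc r
    cnt {a} 1≤a a≤ with ℕₚ.m≤n⇒m<n∨m≡n a≤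
    ... | inj₁ (s≤s a≤n) = trans (occ-join (suc n) αs (ℕₚ.<⇒≢ (s≤s a≤n))) (full (g-letters g) 1≤a a≤n)
    ... | inj₂ refl      = trans (occ-join-max (suc n) α (β ∷ γ) (good-bounds g)) (ℕₚ.suc-injective len)

  good-join⁻ : ∀ {r n} w → GoodWord (suc r) (suc n) w →
    length (splitAll (suc n) w) ≡ suc (suc r) × Good (suc r) n (splitAll (suc n) w)
  good-join⁻ {r} {n} w g with splitAll (suc n) w | splitAll-≢ (suc n) w | join-splitAll (suc n) w
  ... | αs | ≢m | refl = go αs ≢m g
    where
    go : ∀ αs → All (All (_≢ suc n)) αs → GoodWord (suc r) (suc n) (joinW (suc n) αs) →
      length αs ≡ suc (suc r) × Good (suc r) n αs
    go αs ≢m g = finish αs refl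
      where
      αs<m : All (All (_< suc n)) αs
      αs<m = All.tabulate λ α∈ → All.tabulate λ x∈ →
        ℕₚ.≤∧≢⇒< (proj₂ (bounds (w-letters g) (∈-join⁺ (suc n) αs (∈-concat⁺′ x∈ α∈))))
          (All.lookup (All.lookup ≢m α∈) x∈)
      pat = pattern-join⁻ (suc n) αs αs<m (w-pattern g)
      lets : Letters (suc r) n (concat αs)
      lets = letters
        (λ x∈ → let (α , x∈α , α∈) = ∈-concat⁻′ αs x∈ in
          proj₁ (bounds (w-letters g) (∈-join⁺ (suc n) αs x∈)) , ℕₚ.≤-pred (All.lookup (All.lookup αs<m α∈) x∈α))
        (λ 1≤a a≤n → trans (sym (occ-join (suc n) αs (ℕₚ.<⇒≢ (s≤s a≤n))))
          (full (w-letters g) 1≤a (ℕₚ.m≤n⇒m≤1+n a≤n)))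
      maximal : occ (suc n) (joinW (suc n) αs) ≡ suc r
      maximal = full (w-letters g) (s≤s z≤n) ℕₚ.≤-refl
      -- With fewer than two pieces `suc n` would not occur at all, whereas it occurs `suc r` times.
      finish : ∀ βs → βs ≡ αs → length αs ≡ suc (suc r) × Good (suc r) n αs
      finish [] refl with maximal
      ... | ()
      finish (α ∷ []) refl with trans (sym maximal) (occ-join-max (suc n) α [] αs<m)
      ... | ()
      finish (α ∷ β ∷ γ) refl =
        cong suc (trans (sym (occ-join-max (suc n) α (β ∷ γ) αs<m)) maximal) ,
        good lets (proj₁ pat) (proj₂ pat)
          (avoids-∷ʳ⁻ (sortedLetters αs) (All.tabulate λ x∈ → s≤s (proj₂ (bounds lets (concat-Sᵣ-∈⁻ αs x∈))))
            (subst Avoids231 (Sᵣ-join (suc n) α β γ αs<m) (w-avoids g)))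

  module _ {r n : ℕ} (w : Word) where
    goodWord⁻ : isRPerm (suc r) n w ≡ true → eqW (S (Sᵣ w)) (range n) ≡ true → GoodWord (suc r) n w
    goodWord⁻ p q =
      let (l , rest) = ∧-true⁻ p
          (o , pat) = ∧-true⁻ {all (λ a → occ a w ≡ᵇ suc r) (range n)} rest
      in goodWord
        (letters
          (λ {x} x∈ → let (a , b) = ∧-true⁻ {1 ≤ᵇ x} (All.lookup (all-true⁻ (λ x → (1 ≤ᵇ x) ∧ (x ≤ᵇ n)) w l) x∈) in
            ℕₚ.≤ᵇ⇒≤ 1 x (≡true⇒T a) , ℕₚ.≤ᵇ⇒≤ x n (≡true⇒T b))
          (λ {a} 1≤a a≤n → ≡ᵇ-true _ _ (All.lookup (all-true⁻ (λ a → occ a w ≡ᵇ suc r) (range n) o)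
            (∈-range⁺ n 1≤a a≤n))))
        (patternOK⇒Pattern w pat)
        (S-sorts⁻ n (Sᵣ w) (eqW⇒≡ _ _ q))

    goodWord⁺ : GoodWord (suc r) n w → isRPerm (suc r) n w ≡ true × eqW (S (Sᵣ w)) (range n) ≡ true
    goodWord⁺ g = ∧-true⁺
        (all-true⁺ _ (All.tabulate λ x∈ → let (a , b) = bounds (w-letters g) x∈ in ∧-true⁺ (T⇒≡true (ℕₚ.≤⇒≤ᵇ a)) (T⇒≡true (ℕₚ.≤⇒≤ᵇ b))))
        (∧-true⁺ (all-true⁺ _ (All.tabulate λ {a} a∈ → let (p , q) = ∈-range⁻ n a∈ in
                    trans (cong (_≡ᵇ suc r) (full (w-letters g) p q)) (≡ᵇ-refl (suc r))))
          (Pattern⇒patternOK w (w-pattern g))) ,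
      trans (cong (λ v → eqW v (range n)) (S-sorts n (Sᵣ w) (w-avoids g)
        (λ x∈ → bounds (w-letters g) (Sᵣ-∈⁻ w x∈))
        (λ {x} 1≤x x≤n → Sᵣ-∈⁺ w (occ-∈ w (subst (1 ≤_) (sym (full (w-letters g) 1≤x x≤n)) (s≤s z≤n))))))
          (eqW-refl (range n))

  -- Gluing a word to a sequence of words

  -- In a good sequence α ∷ αs with α nonempty, α uses 1, …, m and one further letter
  -- suc m + t; shiftL and shiftR relabel [suc m] and [q] onto the letters of α and of αs.
  shiftL : ℕ → ℕ → ℕ → ℕ
  shiftL m t i = if i ≤ᵇ m then i else i + t

  shiftR : ℕ → ℕ → ℕ → ℕ
  shiftR m t i = if i ≤ᵇ t then m + i else suc (m + i)

  ≤ᵇ-true : ∀ {i j} → i ≤ j → (i ≤ᵇ j) ≡ true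
  ≤ᵇ-true p = T⇒≡true (ℕₚ.≤⇒≤ᵇ p)

  ≤ᵇ-false : ∀ {i j} → j < i → (i ≤ᵇ j) ≡ false
  ≤ᵇ-false {i} {j} p with i ≤ᵇ j in eq
  ... | true  = ⊥-elim (ℕₚ.<⇒≱ p (ℕₚ.≤ᵇ⇒≤ i j (≡true⇒T eq)))
  ... | false = refl

  shiftL-low : ∀ {m t i} → i ≤ m → shiftL m t i ≡ i
  shiftL-low p rewrite ≤ᵇ-true p = refl

  shiftL-high : ∀ {m t i} → m < i → shiftL m t i ≡ i + t
  shiftL-high p rewrite ≤ᵇ-false p = refl

  shiftR-low : ∀ {m t i} → i ≤ t → shiftR m t i ≡ m + i
  shiftR-low p rewrite ≤ᵇ-true p = refl

  shiftR-high : ∀ {m t i} → t < i → shiftR m t i ≡ suc (m + i)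
  shiftR-high p rewrite ≤ᵇ-false p = refl

  shiftL-mono : ∀ m t → StrictlyMonotone (shiftL m t)
  shiftL-mono m t {i} {j} i<j with ℕₚ.≤-<-connex i m | ℕₚ.≤-<-connex j m
  ... | inj₁ a | inj₁ b = ≡.subst₂ _<_ (sym (shiftL-low a)) (sym (shiftL-low b)) i<j
  ... | inj₁ a | inj₂ b = ≡.subst₂ _<_ (sym (shiftL-low a)) (sym (shiftL-high b)) (ℕₚ.<-≤-trans i<j (ℕₚ.m≤m+n j t))
  ... | inj₂ a | inj₁ b = ⊥-elim (ℕₚ.<-irrefl refl (ℕₚ.<-trans (ℕₚ.<-≤-trans i<j b) a))
  ... | inj₂ a | inj₂ b = ≡.subst₂ _<_ (sym (shiftL-high a)) (sym (shiftL-high b)) (ℕₚ.+-monoˡ-< t i<j)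

  shiftR-mono : ∀ m t → StrictlyMonotone (shiftR m t)
  shiftR-mono m t {i} {j} i<j with ℕₚ.≤-<-connex i t | ℕₚ.≤-<-connex j t
  ... | inj₁ a | inj₁ b = ≡.subst₂ _<_ (sym (shiftR-low a)) (sym (shiftR-low b)) (ℕₚ.+-monoʳ-< m i<j)
  ... | inj₁ a | inj₂ b = ≡.subst₂ _<_ (sym (shiftR-low a)) (sym (shiftR-high b))
    (ℕₚ.m<n⇒m<1+n (ℕₚ.+-monoʳ-< m i<j))
  ... | inj₂ a | inj₁ b = ⊥-elim (ℕₚ.<-irrefl refl (ℕₚ.<-trans (ℕₚ.<-≤-trans i<j b) a))
  ... | inj₂ a | inj₂ b = ≡.subst₂ _<_ (sym (shiftR-high a)) (sym (shiftR-high b)) (s≤s (ℕₚ.+-monoʳ-< m i<j))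

  m<shiftR : ∀ m t {j} → 1 ≤ j → m < shiftR m t j
  m<shiftR m t {j} 1≤j with ℕₚ.≤-<-connex j t
  ... | inj₁ a = subst (m <_) (sym (shiftR-low a)) (ℕₚ.m<m+n m 1≤j)
  ... | inj₂ a = subst (m <_) (sym (shiftR-high a)) (s≤s (ℕₚ.m≤m+n m j))

  shiftR-≤ : ∀ m t j → shiftR m t j ≤ suc (m + j)
  shiftR-≤ m t j with ℕₚ.≤-<-connex j t
  ... | inj₁ a = subst (_≤ suc (m + j)) (sym (shiftR-low a)) (ℕₚ.n≤1+n _)
  ... | inj₂ a = ℕₚ.≤-reflexive (shiftR-high a)

  shiftR-below : ∀ {m t j} → j ≤ t → shiftR m t j < suc (m + t)
  shiftR-below {m} {t} {j} p = subst (_< suc (m + t)) (sym (shiftR-low p)) (s≤s (ℕₚ.+-monoʳ-≤ m p))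

  shiftR-above : ∀ {m t j} → t < j → suc (m + t) < shiftR m t j
  shiftR-above {m} {t} {j} p = subst (suc (m + t) <_) (sym (shiftR-high p)) (s≤s (ℕₚ.+-monoʳ-< m p))

  shiftR-≢ : ∀ m t j → shiftR m t j ≢ suc (m + t)
  shiftR-≢ m t j with ℕₚ.≤-<-connex j t
  ... | inj₁ a = ℕₚ.<⇒≢ (shiftR-below a)
  ... | inj₂ a = λ eq → ℕₚ.<⇒≢ (shiftR-above {m} a) (sym eq)

  shiftL-top : ∀ m t → shiftL m t (suc m) ≡ suc (m + t)
  shiftL-top m t = shiftL-high ℕₚ.≤-refl

  shiftL-≤ : ∀ m t {i} → i ≤ suc m → shiftL m t i ≤ suc (m + t)
  shiftL-≤ m t {i} p with ℕₚ.m≤n⇒m<n∨m≡n p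
  ... | inj₁ (s≤s a) = subst (_≤ suc (m + t)) (sym (shiftL-low a)) (ℕₚ.≤-trans p (s≤s (ℕₚ.m≤m+n m t)))
  ... | inj₂ refl    = ℕₚ.≤-reflexive (shiftL-top m t)

  shiftL-≥ : ∀ m t i → i ≤ shiftL m t i
  shiftL-≥ m t i with ℕₚ.≤-<-connex i m
  ... | inj₁ a = ℕₚ.≤-reflexive (sym (shiftL-low a))
  ... | inj₂ a = subst (i ≤_) (sym (shiftL-high a)) (ℕₚ.m≤m+n i t)

  shifts-disjoint : ∀ m t {i j} → i ≤ suc m → 1 ≤ j → shiftL m t i ≢ shiftR m t j
  shifts-disjoint m t {i} {j} i≤ 1≤j eq with ℕₚ.m≤n⇒m<n∨m≡n i≤
  ... | inj₁ (s≤s a) = ℕₚ.<⇒≱ (m<shiftR m t 1≤j) (subst (_≤ m) (trans (sym (shiftL-low a)) eq) a)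
  ... | inj₂ refl    = shiftR-≢ m t j (trans (sym eq) (shiftL-top m t))

  shifts-cover : ∀ m t q {a} → t ≤ q → 1 ≤ a → a ≤ suc m + q →
    (∃[ i ] 1 ≤ i × i ≤ suc m × shiftL m t i ≡ a) ⊎ (∃[ j ] 1 ≤ j × j ≤ q × shiftR m t j ≡ a)
  shifts-cover m t q {a} t≤q 1≤a a≤ with ℕₚ.≤-<-connex a m
  ... | inj₁ a≤m = inj₁ (a , 1≤a , ℕₚ.m≤n⇒m≤1+n a≤m , shiftL-low a≤m)
  ... | inj₂ m<a with ℕₚ.<-cmp a (suc (m + t))
  ...   | tri≈ _ refl _ = inj₁ (suc m , s≤s z≤n , ℕₚ.≤-refl , shiftL-top m t)
  ...   | tri< a<  _ _ = inj₂ (a ∸ m , ℕₚ.m<n⇒0<n∸m m<a , ℕₚ.≤-trans j≤t t≤q , trans (shiftR-low j≤t)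
    (ℕₚ.m+[n∸m]≡n (ℕₚ.<⇒≤ m<a)))
    where
    j≤t : a ∸ m ≤ t
    j≤t = subst (a ∸ m ≤_) (ℕₚ.m+n∸m≡n m t) (ℕₚ.∸-monoˡ-≤ m (ℕₚ.≤-pred a<))
  ...   | tri> _ _ a> = inj₂ (a ∸ suc m , ℕₚ.≤-trans (s≤s z≤n) t<j ,
            subst (a ∸ suc m ≤_) (ℕₚ.m+n∸m≡n (suc m) q) (ℕₚ.∸-monoˡ-≤ (suc m) a≤) , trans (shiftR-high t<j)
              (ℕₚ.m+[n∸m]≡n m<a))
    where
    t<j : t < a ∸ suc m
    t<j = ℕₚ.≤-trans (ℕₚ.≤-reflexive (sym (ℕₚ.m+n∸m≡n m (suc t)))) (ℕₚ.∸-monoˡ-≤ (suc m)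
      (subst (_≤ a) (cong suc (sym (ℕₚ.+-suc m t))) a>))

  good-[]⁺ : ∀ {r n αs} → Good r n αs → Good r n ([] ∷ αs)
  good-[]⁺ (good l p s a) = good l (tt ∷ p) ((λ ()) , s) a

  good-[]⁻ : ∀ {r n αs} → Good r n ([] ∷ αs) → Good r n αs
  good-[]⁻ (good l (_ ∷ p) (_ , s) a) = good l p s a

  goodWord-∈ : ∀ {r n w x} → GoodWord (suc r) n w → 1 ≤ x → x ≤ n → x ∈ w
  goodWord-∈ {w = w} g 1≤x x≤n = occ-∈ w (subst (1 ≤_) (sym (full (w-letters g) 1≤x x≤n)) (s≤s z≤n))

  goodWord-maxL : ∀ {r m w} → GoodWord (suc r) (suc m) w → maxL w ≡ suc m
  goodWord-maxL g = maxL-unique (goodWord-∈ g (s≤s z≤n) ℕₚ.≤-refl) (λ x∈ → proj₂ (bounds (w-letters g) x∈))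

  goodWord-Sᵣ : ∀ {r m w} → GoodWord (suc r) (suc m) w → ∃[ v ] Sᵣ w ≡ v ++ [ suc m ] × All (_≤ m) v
  goodWord-Sᵣ {m = m} {w} g with Sᵣ-max w nonempty
    where
    nonempty : w ≢ []
    nonempty refl with goodWord-∈ g (s≤s z≤n) ℕₚ.≤-refl
    ... | ()
  ... | v , eq , v< rewrite goodWord-maxL g = v , eq , All.map ℕₚ.≤-pred v<

  module _ (m t : ℕ) where
    glue : Word → List Word → List Word
    glue L R = map (shiftL m t) L ∷ map (map (shiftR m t)) R

    private
      fL = shiftL m t
      fR = shiftR m t
      fL< : StrictlyMonotone fL
      fL< = shiftL-mono m t
      fR< : StrictlyMonotone fR
      fR< = shiftR-mono m t

    glue-Sᵣ : ∀ {v} L R → Sᵣ L ≡ v ++ [ suc m ] →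
      sortedLetters (glue L R) ≡ map fL v ++ suc (m + t) ∷ map fR (sortedLetters R)
    glue-Sᵣ {v} L R eq = trans (cong₂ _++_ (trans (Sᵣ-map fL< L) (trans (cong (map fL) eq)
        (trans (Listₚ.map-++ fL v [ suc m ]) (cong (λ a → map fL v ++ [ a ]) (shiftL-top m t)))))
        (concat-Sᵣ-map fR< R))
      (Listₚ.++-assoc (map fL v) [ suc (m + t) ] _)

    -- After sorting, the letters `1, …, m` stand in front and below everything else. A new 231
    -- could therefore only start with the letter `suc m + t`, and the cut of `R` at `t` prevents
    -- that.
    good-glue⁺ : ∀ {r q L R} → GoodWord (suc r) (suc m) L → Good (suc r) q R → t ≤ q → Cut t (sortedLetters R) →
      Good (suc r) (suc m + q) (glue L R)
    good-glue⁺ {r} {q} {L} {R} gL gR t≤q cut with goodWord-Sᵣ gL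
    ... | v , eq , v≤m = good (letters bnd cnt)
      (pattern-map⁺ fL< L (w-pattern gL) ∷ Allₚ.map⁺ (All.map (λ {α} → pattern-map⁺ fR< α) (g-pattern gR)))
      (dis , separated-map⁺ fR< R (g-separated gR))
      (subst Avoids231 (sym (glue-Sᵣ L R eq)) (avoids-++⁺ v< (avoids-map⁺ fL< avv) v<τ
        (Allₚ.map⁺ (All.tabulate λ _ eq → shiftR-≢ m t _ (sym eq)))
        (cut-map fR (All.tabulate λ _ p → ℕₚ.<⇒≤ (shiftR-below p)) (All.tabulate λ _ → shiftR-above) cut)
        (avoids-map⁺ fR< (g-avoids gR))))
      where
      concatR : concat (map (map fR) R) ≡ map fR (concat R)
      concatR = Listₚ.concat-map R
      avv : Avoids231 v
      avv = avoids-∷ʳ⁻ v (All.map s≤s v≤m) (subst Avoids231 eq (w-avoids gL))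
      fLv : ∀ {x} → x ∈ v → fL x ≤ m
      fLv x∈ = subst (_≤ m) (sym (shiftL-low (All.lookup v≤m x∈))) (All.lookup v≤m x∈)
      v< : All (_< suc (m + t)) (map fL v)
      v< = Allₚ.map⁺ (All.tabulate λ x∈ → s≤s (ℕₚ.≤-trans (fLv x∈) (ℕₚ.m≤m+n m t)))
      boundR : ∀ {j} → j ∈ sortedLetters R → 1 ≤ j
      boundR j∈ = proj₁ (bounds (g-letters gR) (concat-Sᵣ-∈⁻ R j∈))
      v<τ : All (λ x → All (x <_) (map fR (sortedLetters R))) (map fL v)
      v<τ = Allₚ.map⁺ (All.tabulate λ x∈ → Allₚ.map⁺ (All.tabulate λ j∈ → ℕₚ.≤-<-trans (fLv x∈)
        (m<shiftR m t (boundR j∈))))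
      dis : ∀ {x} → x ∈ map fL L → x ∉ concat (map (map fR) R)
      dis x∈ x∈′ with ∈-map⁻ fL x∈ | ∈-map⁻ fR (subst (_ ∈_) concatR x∈′)
      ... | i , i∈ , refl | j , j∈ , eq = shifts-disjoint m t (proj₂ (bounds (w-letters gL) i∈))
        (proj₁ (bounds (g-letters gR) j∈)) eq
      bnd : ∀ {x} → x ∈ map fL L ++ concat (map (map fR) R) → 1 ≤ x × x ≤ suc m + q
      bnd {x} x∈ with ∈-++⁻ (map fL L) x∈
      ... | inj₁ p with ∈-map⁻ fL p
      ...   | i , i∈ , refl = let (a , b) = bounds (w-letters gL) i∈ in
              ℕₚ.≤-trans a (shiftL-≥ m t i) , ℕₚ.≤-trans (shiftL-≤ m t b) (s≤s (ℕₚ.+-monoʳ-≤ m t≤q))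
      bnd {x} x∈ | inj₂ p with ∈-map⁻ fR (subst (x ∈_) concatR p)
      ...   | j , j∈ , refl = let (a , b) = bounds (g-letters gR) j∈ in
              ℕₚ.≤-trans (s≤s z≤n) (m<shiftR m t a) , ℕₚ.≤-trans (shiftR-≤ m t j) (s≤s (ℕₚ.+-monoʳ-≤ m b))
      cnt : ∀ {a} → 1 ≤ a → a ≤ suc m + q → occ a (map fL L ++ concat (map (map fR) R)) ≡ suc r
      cnt {a} 1≤a a≤ with shifts-cover m t q t≤q 1≤a a≤
      ... | inj₁ (i , 1≤i , i≤ , refl) = trans (occ-++ a (map fL L) _) (trans
        (cong₂ _+_ (trans (occ-map fL< i L) (full (w-letters gL) 1≤i i≤))
                   (occ-∉ _ (λ a∈ → dis (∈-map⁺ fL (goodWord-∈ gL 1≤i i≤)) a∈))) (ℕₚ.+-identityʳ _))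
      ... | inj₂ (j , 1≤j , j≤ , refl) = trans (occ-++ a (map fL L) _)
        (cong₂ _+_ (occ-∉ (map fL L) not)
          (trans (cong (occ a) concatR) (trans (occ-map fR< j (concat R)) (full (g-letters gR) 1≤j j≤))))
        where
        not : fR j ∉ map fL L
        not p with ∈-map⁻ fL p
        ... | i , i∈ , eq = shifts-disjoint m t (proj₂ (bounds (w-letters gL) i∈)) 1≤j (sym eq)

    -- The two shifts have disjoint images on the letters of `L` and `R`, so each occurrence count
    -- of the glued sequence is a count in one of them.
    good-glue⁻ : ∀ {r q L R} → (∀ {i} → i ∈ L → 1 ≤ i × i ≤ suc m) →
      (∀ {j} → j ∈ concat R → 1 ≤ j × j ≤ q) → t ≤ q →
      Cut (suc (m + t)) (map fR (sortedLetters R)) → Avoids231 (Sᵣ L) →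
      Avoids231 (sortedLetters R) → Good (suc r) (suc m + q) (glue L R) →
      GoodWord (suc r) (suc m) L × Good (suc r) q R × Cut t (sortedLetters R)
    good-glue⁻ {r} {q} {L} {R} bL bR t≤q cut avL avR g =
      goodWord (letters bL cntL) (pattern-map⁻ fL< L (All.head (g-pattern g))) avL ,
      good (letters bR cntR) (All.map (λ {α} → pattern-map⁻ fR< α) (Allₚ.map⁻ (All.tail (g-pattern g))))
        (separated-map⁻ fR< R (proj₂ (g-separated g))) avR ,
      cut-map⁻ _ fR (All.tabulate λ _ → back₁) (All.tabulate λ _ → back₂) cut
      where
      concatR : concat (map (map fR) R) ≡ map fR (concat R)
      concatR = Listₚ.concat-map R
      back₁ : ∀ {j} → fR j ≤ suc (m + t) → j ≤ t
      back₁ {j} p with ℕₚ.≤-<-connex j t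
      ... | inj₁ a = a
      ... | inj₂ a = ⊥-elim (ℕₚ.<⇒≱ (shiftR-above {m} a) p)
      back₂ : ∀ {j} → suc (m + t) < fR j → t < j
      back₂ {j} p with ℕₚ.≤-<-connex j t
      ... | inj₁ a = ⊥-elim (ℕₚ.<-asym (shiftR-below {m} a) p)
      ... | inj₂ a = a
      cntL : ∀ {i} → 1 ≤ i → i ≤ suc m → occ i L ≡ suc r
      cntL {i} 1≤i i≤ = trans (sym (trans (occ-++ (fL i) (map fL L) _)
        (trans (cong₂ _+_ (occ-map fL< i L) (occ-∉ _ not)) (ℕₚ.+-identityʳ _))))
        (full (g-letters g) (ℕₚ.≤-trans 1≤i (shiftL-≥ m t i))
          (ℕₚ.≤-trans (shiftL-≤ m t i≤) (s≤s (ℕₚ.+-monoʳ-≤ m t≤q))))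
        where
        not : fL i ∉ concat (map (map fR) R)
        not p with ∈-map⁻ fR (subst (_ ∈_) concatR p)
        ... | j , j∈ , eq = shifts-disjoint m t i≤ (proj₁ (bR j∈)) eq
      cntR : ∀ {j} → 1 ≤ j → j ≤ q → occ j (concat R) ≡ suc r
      cntR {j} 1≤j j≤ = trans (sym (trans (occ-++ (fR j) (map fL L) _)
        (cong₂ _+_ (occ-∉ (map fL L) not) (trans (cong (occ (fR j)) concatR) (occ-map fR< j (concat R))))))
        (full (g-letters g) (ℕₚ.≤-trans (s≤s z≤n) (m<shiftR m t 1≤j))
          (ℕₚ.≤-trans (shiftR-≤ m t j) (s≤s (ℕₚ.+-monoʳ-≤ m j≤))))
        where
        not : fR j ∉ map fL L
        not p with ∈-map⁻ fL p
        ... | i , i∈ , eq = shifts-disjoint m t (proj₂ (bL i∈)) 1≤j (sym eq)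

  private
    letters-below : ∀ {r n α αs v a} → Good (suc r) n (α ∷ αs) → α ≢ [] → Sᵣ α ≡ v ++ [ a ] → All (_< a) v →
      All (λ x → All (x <_) (sortedLetters αs)) v →
        maxL v < a × (∀ {x} → x ∈ v → x ≤ maxL v) × (∀ {x} → x ∈ concat αs → maxL v < x)
    letters-below {α = α} {αs} {v} {a} g α≢[] eq v<a v<τ = below-a v v<a , ∈⇒≤maxL , λ x∈ → below-τ v v<τ x∈
      where
      1≤a : 1 ≤ a
      1≤a = proj₁ (bounds (g-letters g) (∈-++⁺ˡ (Sᵣ-∈⁻ α (subst (a ∈_) (sym eq) (∈-++⁺ʳ v (here refl))))))
      below-a : ∀ v → All (_< a) v → maxL v < a
      -- For empty `v` the value of `maxL v` is 0, and all letters are positive.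
      below-a []      _ = 1≤a
      below-a (y ∷ v) p = All.lookup p (maxL∈ y v)
      below-τ : ∀ v → All (λ x → All (x <_) (sortedLetters αs)) v → ∀ {x} → x ∈ concat αs → maxL v < x
      below-τ []      _ x∈ = proj₁ (bounds (g-letters g) (∈-++⁺ʳ α x∈))
      below-τ (y ∷ v) p x∈ = All.lookup (All.lookup p (maxL∈ y v)) (concat-Sᵣ-∈⁺ αs x∈)

    -- The letters to be relabelled are at most `m`, or equal to the top letter; truncation at
    -- `suc m` keeps the former and lowers the latter.
    unshiftL : ℕ → ℕ → ℕ
    unshiftL m x = x ⊓ suc m

    unshiftR : ℕ → ℕ → ℕ → ℕ
    unshiftR m t x = if x ≤ᵇ (m + t) then x ∸ m else x ∸ suc m

    shiftL-unshiftL : ∀ {m t x} → x ≤ m ⊎ x ≡ suc (m + t) → shiftL m t (unshiftL m x) ≡ x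
    shiftL-unshiftL {m} {t} {x} (inj₁ p) = trans (cong (shiftL m t) (ℕₚ.m≤n⇒m⊓n≡m (ℕₚ.m≤n⇒m≤1+n p))) (shiftL-low p)
    shiftL-unshiftL {m} {t} {x} (inj₂ refl) = trans (cong (shiftL m t) (ℕₚ.m≥n⇒m⊓n≡n (s≤s (ℕₚ.m≤m+n m t))))
      (shiftL-top m t)

    unshiftR-spec : ∀ {m t q x} → t ≤ q → m < x → x ≤ suc (m + q) → x ≢ suc (m + t) →
      shiftR m t (unshiftR m t x) ≡ x × 1 ≤ unshiftR m t x × unshiftR m t x ≤ q
    unshiftR-spec {m} {t} {q} {x} t≤q m<x x≤ x≢ with shifts-cover m t q t≤q (ℕₚ.≤-trans (s≤s z≤n) m<x) x≤
    ... | inj₁ (i , 1≤i , i≤ , refl) with ℕₚ.m≤n⇒m<n∨m≡n i≤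
    ...   | inj₁ (s≤s i≤m) = ⊥-elim (ℕₚ.<⇒≱ m<x (subst (_≤ m) (sym (shiftL-low i≤m)) i≤m))
    ...   | inj₂ refl      = ⊥-elim (x≢ (shiftL-top m t))
    unshiftR-spec {m} {t} {q} {x} t≤q m<x x≤ x≢ | inj₂ (j , 1≤j , j≤q , refl) =
      cong (shiftR m t) back , subst (1 ≤_) (sym back) 1≤j , subst (_≤ q) (sym back) j≤q
      where
      back : unshiftR m t (shiftR m t j) ≡ j
      back with ℕₚ.≤-<-connex j t
      ... | inj₁ a = trans (cong (λ b → if b then shiftR m t j ∸ m else shiftR m t j ∸ suc m)
        (≤ᵇ-true (ℕₚ.≤-pred (shiftR-below a))))
                           (trans (cong (_∸ m) (shiftR-low {m} a)) (ℕₚ.m+n∸m≡n m j))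
      ... | inj₂ a = trans (cong (λ b → if b then shiftR m t j ∸ m else shiftR m t j ∸ suc m)
        (≤ᵇ-false (ℕₚ.<-trans (ℕₚ.n<1+n _) (shiftR-above {m} a))))
                           (trans (cong (_∸ suc m) (shiftR-high {m} a)) (ℕₚ.m+n∸m≡n m j))

  -- The sorted form of `α` is `v` followed by its maximum `a`. As `a` could play the 3, `v` lies
  -- below all letters of `αs`; as `a` could play the 2, it cuts their sorted form. With `m` the
  -- largest letter of `v`, the letters other than `a` split at `m`, and `t` is the relative
  -- position of `a` among those above.
  good-∷⁻ : ∀ {r n α αs} → Good (suc r) n (α ∷ αs) → α ≢ [] → ∃[ m ] ∃[ q ] ∃[ t ] ∃[ L ] ∃[ R ]
    n ≡ suc m + q × t ≤ q × GoodWord (suc r) (suc m) L × Good (suc r) q R × Cut t (sortedLetters R) × α ∷ αs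
      ≡ glue m t L R
  good-∷⁻ {r} {n} {α} {αs} g α≢[] with Sᵣ-max α α≢[]
  ... | v , eq , v<a with avoids-++⁻ v v<a
    (subst Avoids231 (trans (cong (_++ sortedLetters αs) eq) (Listₚ.++-assoc v [ maxL α ] _)) (g-avoids g))
  ...   | avv , v<τ , a≢τ , cut , avτ with letters-below g α≢[] eq v<a v<τ
  ...     | m<a , v≤m , m<τ = m , q , t , L , R , n≡ , t≤q , proj₁ result , proj₁ (proj₂ result) , proj₂
    (proj₂ result) , sym glue-eq
    where
    m = maxL v
    a = maxL α
    τ = sortedLetters αs
    a≤n : a ≤ n
    a≤n = proj₂ (bounds (g-letters g) (∈-++⁺ˡ (maxL∈-nonempty α≢[])))
    q = n ∸ suc m
    t = a ∸ suc m
    n≡ : n ≡ suc m + q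
    n≡ = sym (ℕₚ.m+[n∸m]≡n (ℕₚ.≤-trans m<a a≤n))
    a≡ : suc (m + t) ≡ a
    a≡ = ℕₚ.m+[n∸m]≡n m<a
    t≤q : t ≤ q
    t≤q = ℕₚ.∸-monoˡ-≤ (suc m) a≤n
    L = map (unshiftL m) α
    R = map (map (unshiftR m t)) αs
    cases : ∀ {x} → x ∈ α → x ≤ m ⊎ x ≡ suc (m + t)
    cases {x} x∈ with ∈-++⁻ v (subst (x ∈_) eq (Sᵣ-∈⁺ α x∈))
    ... | inj₁ p           = inj₁ (v≤m p)
    ... | inj₂ (here refl) = inj₂ (sym a≡)
    specR : ∀ {x} → x ∈ concat αs → shiftR m t (unshiftR m t x) ≡ x × 1 ≤ unshiftR m t x × unshiftR m t x ≤ q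
    specR {x} x∈ = unshiftR-spec t≤q (m<τ x∈) (subst (x ≤_) n≡ (proj₂ (bounds (g-letters g) (∈-++⁺ʳ α x∈))))
      (λ eq′ → All.lookup a≢τ (concat-Sᵣ-∈⁺ αs x∈) (trans (sym a≡) (sym eq′)))
    eqL : map (shiftL m t) L ≡ α
    eqL = trans (sym (Listₚ.map-∘ α)) (Listₚ.map-id-local (All.tabulate λ x∈ → shiftL-unshiftL {m} {t} (cases x∈)))
    eqR : map (map (shiftR m t)) R ≡ αs
    eqR = trans (sym (Listₚ.map-∘ αs)) (Listₚ.map-id-local (All.tabulate λ {β} β∈ →
      trans (sym (Listₚ.map-∘ β)) (Listₚ.map-id-local (All.tabulate λ x∈ → proj₁ (specR (∈-concat⁺′ x∈ β∈))))))
    glue-eq : glue m t L R ≡ α ∷ αs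
    glue-eq = cong₂ _∷_ eqL eqR
    bL : ∀ {i} → i ∈ L → 1 ≤ i × i ≤ suc m
    bL i∈ with ∈-map⁻ (unshiftL m) i∈
    ... | x , x∈ , refl = ℕₚ.⊓-glb (proj₁ (bounds (g-letters g) (∈-++⁺ˡ x∈))) (s≤s z≤n) , ℕₚ.m⊓n≤n x (suc m)
    bR : ∀ {j} → j ∈ concat R → 1 ≤ j × j ≤ q
    bR {j} j∈ with ∈-map⁻ (unshiftR m t) (subst (j ∈_) (Listₚ.concat-map αs) j∈)
    ... | x , x∈ , refl = proj₂ (specR x∈)
    τ≡ : map (shiftR m t) (sortedLetters R) ≡ τ
    τ≡ = trans (sym (concat-Sᵣ-map (shiftR-mono m t) R)) (cong (λ βs → sortedLetters βs) eqR)
    result = good-glue⁻ m t bL bR t≤q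
      (≡.subst₂ Cut (sym a≡) (sym τ≡) cut)
      (avoids-map⁻ (shiftL-mono m t) (Sᵣ L)
        (subst Avoids231 (trans (sym eq) (trans (cong Sᵣ (sym eqL)) (Sᵣ-map (shiftL-mono m t) L)))
        (avoids-∷ʳ⁺ v<a avv)))
      (avoids-map⁻ (shiftR-mono m t) _ (subst Avoids231 (sym τ≡) avτ))
      (≡.subst₂ (Good (suc r)) n≡ (sym glue-eq) g)

  -- The maximum of the first word is `suc m + t`. Its letter set then determines `m`, hence `t`,
  -- and the relabellings are injective.
  glue-injective : ∀ {r m m′ t t′ q q′ L L′ R R′} → GoodWord (suc r) (suc m) L → GoodWord (suc r) (suc m′) L′ →
    Good (suc r) q R → Good (suc r) q′ R′ →
    glue m t L R ≡ glue m′ t′ L′ R′ → m ≡ m′ × t ≡ t′ × L ≡ L′ × R ≡ R′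
  glue-injective {r} {m} {m′} {t} {t′} {L = L} {L′} {R} {R′} gL gL′ gR gR′ eq = finish m≡ t≡ eqα eqαs
    where
    eqα : map (shiftL m t) L ≡ map (shiftL m′ t′) L′
    eqα = Listₚ.∷-injectiveˡ eq
    eqαs : map (map (shiftR m t)) R ≡ map (map (shiftR m′ t′)) R′
    eqαs = Listₚ.∷-injectiveʳ eq
    top∈ : ∀ {m t L} → GoodWord (suc r) (suc m) L → suc (m + t) ∈ map (shiftL m t) L
    top∈ {m} {t} {L} g = subst (_∈ map (shiftL m t) L) (shiftL-top m t)
      (∈-map⁺ (shiftL m t) (goodWord-∈ g (s≤s z≤n) ℕₚ.≤-refl))
    ≤top : ∀ {m t L x} → GoodWord (suc r) (suc m) L → x ∈ map (shiftL m t) L → x ≤ suc (m + t)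
    ≤top {m} {t} g x∈ with ∈-map⁻ (shiftL m t) x∈
    ... | i , i∈ , refl = shiftL-≤ m t (proj₂ (bounds (w-letters g) i∈))
    tops : suc (m + t) ≡ suc (m′ + t′)
    tops = ℕₚ.≤-antisym (≤top gL′ (subst (suc (m + t) ∈_) eqα (top∈ gL)))
      (≤top gL (subst (suc (m′ + t′) ∈_) (sym eqα) (top∈ gL′)))
    -- Otherwise suc m would be a letter of the left part that is neither small nor maximal.
    not< : ∀ {m m′ t t′ L L′} → GoodWord (suc r) (suc m) L → GoodWord (suc r) (suc m′) L′ →
      map (shiftL m t) L ≡ map (shiftL m′ t′) L′ → suc (m + t) ≡ suc (m′ + t′) → ¬ (m < m′)
    not< {m} {m′} {t} {t′} g g′ e tops m<m′ with ∈-map⁻ (shiftL m t) (subst (suc m ∈_) (sym e)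
      (subst (_∈ _) (shiftL-low m<m′) (∈-map⁺ (shiftL m′ t′) (goodWord-∈ g′ (s≤s z≤n) (ℕₚ.m≤n⇒m≤1+n m<m′)))))
    ... | i , i∈ , eq with ℕₚ.m≤n⇒m<n∨m≡n (proj₂ (bounds (w-letters g) i∈))
    ...   | inj₁ (s≤s i≤m) = ℕₚ.<-irrefl (sym (trans eq (shiftL-low i≤m))) (s≤s i≤m)
    ...   | inj₂ refl = ℕₚ.<⇒≢ (ℕₚ.<-≤-trans m<m′ (ℕₚ.m≤m+n m′ t′))
      (trans (ℕₚ.suc-injective (trans eq (shiftL-top m t))) (ℕₚ.suc-injective tops))
    m≡ : m ≡ m′
    m≡ with ℕₚ.<-cmp m m′
    ... | tri< a _ _ = ⊥-elim (not< gL gL′ eqα tops a)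
    ... | tri≈ _ b _ = b
    ... | tri> _ _ c = ⊥-elim (not< gL′ gL (sym eqα) (sym tops) c)
    t≡ : t ≡ t′
    t≡ = ℕₚ.+-cancelˡ-≡ m _ _ (trans (ℕₚ.suc-injective tops) (cong (_+ t′) (sym m≡)))
    finish : m ≡ m′ → t ≡ t′ → map (shiftL m t) L ≡ map (shiftL m′ t′) L′ →
      map (map (shiftR m t)) R ≡ map (map (shiftR m′ t′)) R′ →
      m ≡ m′ × t ≡ t′ × L ≡ L′ × R ≡ R′
    finish refl refl e e′ = refl , refl ,
      Listₚ.map-injective (StrictlyMonotoneProperties.mono-injective (shiftL-mono m t)) e ,
      Listₚ.map-injective (Listₚ.map-injective (StrictlyMonotoneProperties.mono-injective (shiftR-mono m t))) e′

  -- Generating the good words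

  cutᵇ : ℕ → Word → Bool
  cutᵇ t []      = true
  cutᵇ t (x ∷ v) = if x ≤ᵇ t then cutᵇ t v else all (t <ᵇ_) v

  cutᵇ⇒Cut : ∀ t v → cutᵇ t v ≡ true → Cut t v
  cutᵇ⇒Cut t []      _ = above []
  cutᵇ⇒Cut t (x ∷ v) p with x ≤ᵇ t in eq
  ... | true  = below (ℕₚ.≤ᵇ⇒≤ x t (≡true⇒T eq)) (cutᵇ⇒Cut t v p)
  ... | false = above (ℕₚ.≰⇒> (λ x≤t → subst T eq (ℕₚ.≤⇒≤ᵇ x≤t)) ∷
                       All.map (λ {y} q → ℕₚ.<ᵇ⇒< t y (≡true⇒T q)) (all-true⁻ (t <ᵇ_) v p))

  Cut⇒cutᵇ : ∀ {t v} → Cut t v → cutᵇ t v ≡ true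
  Cut⇒cutᵇ {t} {[]}    _ = refl
  Cut⇒cutᵇ {t} {x ∷ v} (above (p ∷ ps)) rewrite ≤ᵇ-false p =
    all-true⁺ (t <ᵇ_) (All.map (λ q → T⇒≡true (ℕₚ.<⇒<ᵇ q)) ps)
  Cut⇒cutᵇ {t} {x ∷ v} (below p c) rewrite ≤ᵇ-true p = Cut⇒cutᵇ c

  cutᵇ-cong : ∀ {s t u v} → (Cut s u → Cut t v) → (Cut t v → Cut s u) → cutᵇ s u ≡ cutᵇ t v
  cutᵇ-cong {s} {t} {u} {v} f g with cutᵇ s u in eq | cutᵇ t v in eq′
  ... | true  | true  = refl
  ... | false | false = refl
  ... | true  | false = trans (sym (Cut⇒cutᵇ (f (cutᵇ⇒Cut s u eq)))) eq′
  ... | false | true  = trans (sym eq) (Cut⇒cutᵇ (g (cutᵇ⇒Cut t v eq′)))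

  module _ {A B : Set} where
    private
      satisfied′ : ∀ {P : A → Set} {xs} → Any P xs → ∃[ x ] x ∈ xs × P x
      satisfied′ (here p)  = _ , here refl , p
      satisfied′ (there q) = let (x , x∈ , p) = satisfied′ q in x , there x∈ , p

    unique-concatMap : ∀ (f : A → List B) {xs} → Unique xs → (∀ {x} → x ∈ xs → Unique (f x)) →
      (∀ {x y z} → x ∈ xs → y ∈ xs → z ∈ f x → z ∈ f y → x ≡ y) → Unique (concatMap f xs)
    unique-concatMap f {[]}     _          _ _   = []
    unique-concatMap f {x ∷ xs} (x≢ ∷ uxs) u det = Uniqueₚ.++⁺ (u (here refl))
      (unique-concatMap f uxs (λ p → u (there p)) (λ p q → det (there p) (there q)))
      λ (z∈fx , z∈) → clash z∈fx (∈-concatMap⁻ f {xs = xs} z∈)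
      where
      clash : ∀ {z} → z ∈ f x → ¬ Any (λ y → z ∈ f y) xs
      clash z∈fx p with satisfied′ p
      ... | y , y∈ , z∈fy = All.lookup x≢ y∈ (det (here refl) (there y∈) z∈fx z∈fy)

    unique-map : ∀ (f : A → B) {xs} → Unique xs → (∀ {x y} → x ∈ xs → y ∈ xs → f x ≡ f y → x ≡ y) →
      Unique (map f xs)
    unique-map f {[]}     _          _   = []
    unique-map f {x ∷ xs} (x≢ ∷ uxs) inj =
      Allₚ.map⁺ (All.tabulate λ y∈ eq → All.lookup x≢ y∈ (inj (here refl) (there y∈) eq)) ∷
      unique-map f uxs (λ p q → inj (there p) (there q))

    ∈-concatMap⁻′ : ∀ (f : A → List B) xs {z} → z ∈ concatMap f xs → ∃[ x ] x ∈ xs × z ∈ f x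
    ∈-concatMap⁻′ f xs p = satisfied′ (∈-concatMap⁻ f {xs = xs} p)

    ∈-concatMap⁺′ : ∀ (f : A → List B) {xs x z} → x ∈ xs → z ∈ f x → z ∈ concatMap f xs
    ∈-concatMap⁺′ f x∈ z∈ = ∈-concatMap⁺ f (lose x∈ z∈)

  -- Unlike in `count`, the bound `n` is included: a word may also be glued on with its top letter
  -- above all letters of the rest.
  cutList : (ℕ → Bool) → ℕ → List ℕ
  cutList P zero    = if P 0 then [ 0 ] else []
  cutList P (suc n) = if P 0 then 0 ∷ map suc (cutList (λ t → P (suc t)) n)
    else map suc (cutList (λ t → P (suc t)) n)

  ∈-cutList⁻ : ∀ P n {t} → t ∈ cutList P n → t ≤ n × P t ≡ true
  ∈-cutList⁻ P zero t∈ with P 0 in eq | t∈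
  ... | true | here refl = z≤n , eq
  ∈-cutList⁻ P (suc n) t∈ with P 0 in eq | t∈
  ... | true  | here refl = z≤n , eq
  ... | true  | there p with ∈-map⁻ suc p
  ...   | s , s∈ , refl = let (a , b) = ∈-cutList⁻ (λ t → P (suc t)) n s∈ in s≤s a , b
  ∈-cutList⁻ P (suc n) t∈ | false | p with ∈-map⁻ suc p
  ...   | s , s∈ , refl = let (a , b) = ∈-cutList⁻ (λ t → P (suc t)) n s∈ in s≤s a , b

  ∈-cutList⁺ : ∀ P n {t} → t ≤ n → P t ≡ true → t ∈ cutList P n
  ∈-cutList⁺ P zero    z≤n eq rewrite eq = here refl
  ∈-cutList⁺ P (suc n) {zero}  _ eq rewrite eq = here refl
  ∈-cutList⁺ P (suc n) {suc t} (s≤s p) eq with P 0 | ∈-map⁺ suc (∈-cutList⁺ (λ t → P (suc t)) n p eq)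
  ... | true  | q = there q
  ... | false | q = q

  unique-cutList : ∀ P n → Unique (cutList P n)
  unique-cutList P zero with P 0
  ... | true  = [] ∷ []
  ... | false = []
  unique-cutList P (suc n) with P 0 | Uniqueₚ.map⁺ ℕₚ.suc-injective (unique-cutList (λ t → P (suc t)) n)
  ... | true  | u = Allₚ.map⁺ (All.tabulate λ _ ()) ∷ u
  ... | false | u = u

  gluings : ℕ → ℕ → Word → List Word → List (List Word)
  gluings m q L R = map (λ t → glue m t L R) (cutList (λ t → cutᵇ t (sortedLetters R)) q)

  module Generate (r : ℕ) where
    module _ (A : ℕ → List Word) where
      mutual
        sequences : ℕ → ℕ → List (List Word)
        sequences zero    zero    = [ [] ]
        sequences zero    (suc n) = []
        sequences (suc j) n       = map ([] ∷_) (sequences j n) ++ concatMap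
          (λ m → nonemptyFirst j m (n ∸ suc m)) (upTo n)

        nonemptyFirst : ℕ → ℕ → ℕ → List (List Word)
        nonemptyFirst j m q = concatMap (λ L → concatMap (gluings m q L) (sequences j q)) (A (suc m))

    -- `N` is fuel for the recursion through the largest letter; the lists are exact for
    -- `1 ≤ n ≤ N`.
    goodWords : ℕ → ℕ → List Word
    goodWords zero    n       = []
    goodWords (suc N) zero    = []
    goodWords (suc N) (suc n) = map (joinW (suc n)) (sequences (goodWords N) (suc (suc r)) n)

    -- Only nonempty words are described: empty pieces are produced separately by `[] ∷_` in
    -- `sequences`.
    record Correct (A : ℕ → List Word) (N : ℕ) : Set where
      field
        sound    : ∀ {m w} → m < N → w ∈ A (suc m) → GoodWord (suc r) (suc m) w
        complete : ∀ {m w} → m < N → GoodWord (suc r) (suc m) w → w ∈ A (suc m)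
        unique   : ∀ {m} → m < N → Unique (A (suc m))
    open Correct

    module _ {A : ℕ → List Word} {N : ℕ} (correct : Correct A N) where
      data Glued (j m q : ℕ) : List Word → Set where
        glued : ∀ {L R t} → L ∈ A (suc m) → R ∈ sequences A j q → t ≤ q → cutᵇ t (sortedLetters R) ≡ true →
          Glued j m q (glue m t L R)

      nonemptyFirst⁻ : ∀ j m q {αs} → αs ∈ nonemptyFirst A j m q → Glued j m q αs
      nonemptyFirst⁻ j m q p with ∈-concatMap⁻′ _ (A (suc m)) p
      ... | L , L∈ , p₁ with ∈-concatMap⁻′ (gluings m q L) (sequences A j q) p₁
      ...   | R , R∈ , p₂ with ∈-map⁻ (λ t → glue m t L R) p₂
      ...     | t , t∈ , refl = let (a , b) = ∈-cutList⁻ (λ t → cutᵇ t (sortedLetters R)) q t∈ in glued L∈ R∈ a b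

      nonemptyFirst⁺ : ∀ j m q {L R t} → L ∈ A (suc m) → R ∈ sequences A j q → t ≤ q →
        cutᵇ t (sortedLetters R) ≡ true →
        glue m t L R ∈ nonemptyFirst A j m q
      nonemptyFirst⁺ j m q {L} {R} {t} L∈ R∈ t≤ c = ∈-concatMap⁺′ _ L∈ (∈-concatMap⁺′ (gluings m q L) R∈
        (∈-map⁺ (λ t → glue m t L R) (∈-cutList⁺ (λ t → cutᵇ t (sortedLetters R)) q t≤ c)))

      private
        q≤ : ∀ {m n} → n ≤ N → n ∸ suc m ≤ N
        q≤ {m} {n} n≤N = ℕₚ.≤-trans (ℕₚ.m∸n≤m n (suc m)) n≤N

      sequences-sound : ∀ j n {αs} → n ≤ N → αs ∈ sequences A j n → length αs ≡ j × Good (suc r) n αs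
      sequences-sound zero zero n≤N (here refl) = refl , good (letters (λ ()) (λ { (s≤s _) () })) [] tt []
      sequences-sound (suc j) n n≤N αs∈ with ∈-++⁻ (map ([] ∷_) (sequences A j n)) αs∈
      ... | inj₁ p with ∈-map⁻ ([] ∷_) p
      ...   | R , R∈ , refl = let (l , g) = sequences-sound j n n≤N R∈ in cong suc l , good-[]⁺ g
      sequences-sound (suc j) n n≤N αs∈ | inj₂ p with ∈-concatMap⁻′
        (λ m → nonemptyFirst A j m (n ∸ suc m)) (upTo n) p
      ... | m , m∈ , p₁ with ∈-applyUpTo⁻ (λ x → x) m∈
      ...   | _ , m<n , refl with nonemptyFirst⁻ j m (n ∸ suc m) p₁
      ...     | glued {R = R} {t} L∈ R∈ t≤ c = let (l , g) = sequences-sound j (n ∸ suc m) (q≤ n≤N) R∈ in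
        cong suc (trans (Listₚ.length-map _ R) l) ,
        subst (λ k → Good (suc r) k _) (ℕₚ.m+[n∸m]≡n m<n)
          (good-glue⁺ m t (sound correct (ℕₚ.<-≤-trans m<n n≤N) L∈) g t≤ (cutᵇ⇒Cut t _ c))

      glued-complete : ∀ j n αs → length αs ≡ suc j → n ≤ N →
        (∀ q R → length R ≡ j → q ≤ N → Good (suc r) q R → R ∈ sequences A j q) →
        (∃[ m ] ∃[ q ] ∃[ t ] ∃[ L ] ∃[ R ] n ≡ suc m + q × t ≤ q × GoodWord (suc r) (suc m) L × Good (suc r) q R ×
          Cut t (sortedLetters R) × αs ≡ glue m t L R) → αs ∈ sequences A (suc j) n
      glued-complete j n αs len n≤N ih (m , q , t , L , R , refl , t≤q , gL , gR , cut , refl) =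
        ∈-++⁺ʳ (map ([] ∷_) (sequences A j n))
        (∈-concatMap⁺′ (λ m → nonemptyFirst A j m (n ∸ suc m)) (∈-applyUpTo⁺ (λ x → x) m<n)
          (subst (λ k → αs ∈ nonemptyFirst A j m k) (sym (ℕₚ.m+n∸m≡n (suc m) q))
            (nonemptyFirst⁺ j m q (complete correct (ℕₚ.<-≤-trans m<n n≤N) gL) R∈ t≤q (Cut⇒cutᵇ cut))))
        where
        m<n : m < suc m + q
        m<n = s≤s (ℕₚ.m≤m+n m q)
        R∈ : R ∈ sequences A j q
        R∈ = ih q R (trans (sym (Listₚ.length-map _ R)) (ℕₚ.suc-injective len))
          (ℕₚ.≤-trans (ℕₚ.m≤n+m q (suc m)) n≤N) gR

      sequences-complete : ∀ j n αs → length αs ≡ j → n ≤ N → Good (suc r) n αs → αs ∈ sequences A j n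
      sequences-complete zero    zero    []        _   n≤N g = here refl
      sequences-complete zero    (suc n) []        _   n≤N g with full (g-letters g) {1} (s≤s z≤n) (s≤s z≤n)
      ... | ()
      sequences-complete (suc j) n ([] ∷ αs)       len n≤N g =
        ∈-++⁺ˡ (∈-map⁺ ([] ∷_) (sequences-complete j n αs (ℕₚ.suc-injective len) n≤N (good-[]⁻ g)))
      sequences-complete (suc j) n ((x ∷ α) ∷ αs) len n≤N g =
        glued-complete j n ((x ∷ α) ∷ αs) len n≤N (λ q R → sequences-complete j q R) (good-∷⁻ g (λ ()))

      sequences-unique : ∀ j n → n ≤ N → Unique (sequences A j n)
      sequences-unique zero    zero    _   = [] ∷ []
      sequences-unique zero    (suc n) _   = []
      sequences-unique (suc j) n       n≤N = Uniqueₚ.++⁺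
        (Uniqueₚ.map⁺ Listₚ.∷-injectiveʳ (sequences-unique j n n≤N))
        (unique-concatMap _ (Uniqueₚ.upTo⁺ n) (λ {m} m∈ → unique-nonemptyFirst m (m< m∈))
          (λ {m} {m′} m∈ m′∈ → same m m′ (m< m∈) (m< m′∈)))
        disjoint
        where
        m< : ∀ {m} → m ∈ upTo n → m < n
        m< m∈ with ∈-applyUpTo⁻ (λ x → x) m∈
        ... | _ , p , refl = p
        gW : ∀ {m w} → m < n → w ∈ A (suc m) → GoodWord (suc r) (suc m) w
        gW p = sound correct (ℕₚ.<-≤-trans p n≤N)
        gS : ∀ {m R} → R ∈ sequences A j (n ∸ suc m) → Good (suc r) (n ∸ suc m) R
        gS R∈ = proj₂ (sequences-sound j _ (q≤ n≤N) R∈)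
        same : ∀ m m′ {αs} → m < n → m′ < n → αs ∈ nonemptyFirst A j m (n ∸ suc m) →
          αs ∈ nonemptyFirst A j m′ (n ∸ suc m′) → m ≡ m′
        same m m′ m< m′< p p′ = compare (nonemptyFirst⁻ j m _ p) (nonemptyFirst⁻ j m′ _ p′) refl
          where
          compare : ∀ {αs αs′} → Glued j m (n ∸ suc m) αs → Glued j m′ (n ∸ suc m′) αs′ → αs ≡ αs′ → m ≡ m′
          compare (glued L∈ R∈ _ _) (glued L∈′ R∈′ _ _) eq =
            proj₁ (glue-injective (gW m< L∈) (gW m′< L∈′) (gS R∈) (gS R∈′) eq)
        unique-nonemptyFirst : ∀ m → m < n → Unique (nonemptyFirst A j m (n ∸ suc m))
        unique-nonemptyFirst m m<n = unique-concatMap _ (unique correct (ℕₚ.<-≤-trans m<n n≤N))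
          (λ {L} L∈ → unique-concatMap (gluings m q L) (sequences-unique j q (q≤ n≤N))
            (λ {R} R∈ → unique-map (λ t → glue m t L R) (unique-cutList _ q)
              λ _ _ eq → proj₁ (proj₂ (glue-injective (gW m<n L∈) (gW m<n L∈) (gS R∈) (gS R∈) eq)))
            λ {R} {R′} R∈ R′∈ p p′ → proj₂ (proj₂ (proj₂ (glued-eq L∈ L∈ R∈ R′∈ p p′))))
          λ {L} {L′} L∈ L′∈ p p′ → let a = ∈-concatMap⁻′ (gluings m q L) (sequences A j q) p
                                       b = ∈-concatMap⁻′ (gluings m q L′) (sequences A j q) p′
                                   in proj₁ (proj₂ (proj₂ (glued-eq L∈ L′∈ (proj₁ (proj₂ a)) (proj₁ (proj₂ b))
                                     (proj₂ (proj₂ a)) (proj₂ (proj₂ b)))))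
          where
          q = n ∸ suc m
          glued-eq : ∀ {L L′ R R′ αs} → L ∈ A (suc m) → L′ ∈ A (suc m) → R ∈ sequences A j q →
            R′ ∈ sequences A j q →
            αs ∈ gluings m q L R → αs ∈ gluings m q L′ R′ → m ≡ m × ⊤ × L ≡ L′ × R ≡ R′
          glued-eq {L} {L′} {R} {R′} L∈ L′∈ R∈ R′∈ p p′ with ∈-map⁻ (λ t → glue m t L R) p | ∈-map⁻
            (λ t → glue m t L′ R′) p′
          ... | t , _ , refl | t′ , _ , eq = let (a , _ , b , c) = glue-injective (gW m<n L∈) (gW m<n L′∈) (gS R∈) (gS R′∈) eq in refl , tt , b , c
        disjoint : ∀ {αs} → ¬ (αs ∈ map ([] ∷_) (sequences A j n) × αs ∈ concatMap
          (λ m → nonemptyFirst A j m (n ∸ suc m)) (upTo n))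
        disjoint (p , p′) with ∈-map⁻ ([] ∷_) p | ∈-concatMap⁻′ (λ m → nonemptyFirst A j m (n ∸ suc m)) (upTo n) p′
        ... | R , _ , refl | m , m∈ , s = clash (nonemptyFirst⁻ j m _ s) refl
          where
          clash : ∀ {αs} → Glued j m (n ∸ suc m) αs → ¬ ([] ∷ R ≡ αs)
          clash (glued {L = []}    L∈ _ _ _) eq with goodWord-∈ {x = 1} (gW (m< m∈) L∈) (s≤s z≤n) (s≤s z≤n)
          ... | ()
          clash (glued {L = _ ∷ _} L∈ _ _ _) ()

    goodWords-correct : ∀ N → Correct (goodWords N) N
    goodWords-correct zero    = record { sound = λ () ; complete = λ () ; unique = λ () }
    goodWords-correct (suc N) = record { sound = snd ; complete = cmp ; unique = unq }
      where
      ih = goodWords-correct N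
      split : ∀ αs m → length αs ≡ suc (suc r) × Good (suc r) m αs → splitAll (suc m) (joinW (suc m) αs) ≡ αs
      split (α ∷ αs) m (_ , g) = splitAll-join (suc m) α αs (All.map (All.map ℕₚ.<⇒≢) (good-bounds g))
      snd : ∀ {m w} → m < suc N → w ∈ goodWords (suc N) (suc m) → GoodWord (suc r) (suc m) w
      snd {m} (s≤s m≤N) w∈ with ∈-map⁻ (joinW (suc m)) w∈
      ... | αs , αs∈ , refl = let (l , g) = sequences-sound ih (suc (suc r)) m m≤N αs∈ in good-join⁺ αs l g
      cmp : ∀ {m w} → m < suc N → GoodWord (suc r) (suc m) w → w ∈ goodWords (suc N) (suc m)
      cmp {m} {w} (s≤s m≤N) g = let (l , g′) = good-join⁻ w g in
        subst (_∈ goodWords (suc N) (suc m)) (join-splitAll (suc m) w)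
          (∈-map⁺ (joinW (suc m)) (sequences-complete ih (suc (suc r)) m _ l m≤N g′))
      unq : ∀ {m} → m < suc N → Unique (goodWords (suc N) (suc m))
      unq {m} (s≤s m≤N) = unique-map (joinW (suc m)) (sequences-unique ih (suc (suc r)) m m≤N)
        (λ {αs} {βs} p q eq → trans (sym (split αs m (sequences-sound ih (suc (suc r)) m m≤N p)))
          (trans (cong (splitAll (suc m)) eq) (split βs m (sequences-sound ih (suc (suc r)) m m≤N q))))

  -- Components and descents

  bit : Bool → ℕ
  bit b = if b then 1 else 0

  count : (ℕ → Bool) → ℕ → ℕ
  count P zero    = 0
  count P (suc n) = bit (P 0) + count (λ t → P (suc t)) n

  count-cong : ∀ n {P Q} → (∀ t → t < n → P t ≡ Q t) → count P n ≡ count Q n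
  count-cong zero    h = refl
  count-cong (suc n) h = cong₂ _+_ (cong bit (h 0 (s≤s z≤n))) (count-cong n (λ t t<n → h (suc t) (s≤s t<n)))

  count-+ : ∀ a b P → count P (a + b) ≡ count P a + count (λ t → P (a + t)) b
  count-+ zero    b P = refl
  count-+ (suc a) b P = trans (cong (bit (P 0) +_) (count-+ a b (λ t → P (suc t))))
    (sym (ℕₚ.+-assoc (bit (P 0)) _ _))

  count-false : ∀ n {P} → (∀ t → t < n → P t ≡ false) → count P n ≡ 0
  count-false zero    h = refl
  count-false (suc n) h = cong₂ _+_ (cong bit (h 0 (s≤s z≤n))) (count-false n (λ t t<n → h (suc t) (s≤s t<n)))

  -- The number of direct-sum components of a permutation v of [n].
  components : ℕ → Word → ℕ
  components n v = count (λ t → cutᵇ t v) n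

  cutᵇ-false : ∀ {t v} → ¬ Cut t v → cutᵇ t v ≡ false
  cutᵇ-false {t} {v} ¬c with cutᵇ t v in eq
  ... | true  = ⊥-elim (¬c (cutᵇ⇒Cut t v eq))
  ... | false = refl

  -- The largest letter, appended after sorting, forms a component of its own; the cuts below `n`
  -- are unaffected.
  components-join : ∀ {r n} αs → length αs ≡ suc (suc r) → Good (suc r) n αs →
    components (suc n) (Sᵣ (joinW (suc n) αs)) ≡ suc (components n (sortedLetters αs))
  components-join {r} {n} (α ∷ β ∷ γ) len g = trans
    (cong (λ v → components (suc n) v) (Sᵣ-join (suc n) α β γ (good-bounds g)))
    (trans (cong (count P) (ℕₚ.+-comm 1 n)) (trans (count-+ n 1 P) (trans
      (cong₂ (λ a b → a + (bit b + 0)) (count-cong n below-n) (Cut⇒cutᵇ at-n)) (ℕₚ.+-comm _ 1))))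
    where
    τ = sortedLetters (α ∷ β ∷ γ)
    P : ℕ → Bool
    P t = cutᵇ t (τ ++ [ suc n ])
    below-n : ∀ t → t < n → P t ≡ cutᵇ t τ
    below-n t t<n = cutᵇ-cong (λ c → proj₁ (cut-++⁻ τ c)) (λ c → cut-++⁺ c (ℕₚ.m<n⇒m<1+n t<n ∷ []))
    at-n : Cut (n + 0) (τ ++ [ suc n ])
    at-n rewrite ℕₚ.+-identityʳ n = cut-≤-++⁺ (All.map ℕₚ.≤-pred (concat-Sᵣ-< g)) (above (ℕₚ.≤-refl ∷ []))

  -- After sorting, the glued sequence reads `v`, `suc m + t`, `τ′`. Up to `m` it is cut where
  -- `Sᵣ L` is. The letter `suc m + t` then swallows all components of `R` in front of the cut `t`,
  -- so only the cuts of `R` from `t` on survive, moved by `suc m`.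
  components-glue : ∀ {r m q t L R} → GoodWord (suc r) (suc m) L → Good (suc r) q R → t ≤ q →
    components (suc m + q) (sortedLetters (glue m t L R))
      ≡ components (suc m) (Sᵣ L) + count (λ s → cutᵇ (t + s) (sortedLetters R)) (q ∸ t)
  components-glue {r} {m} {q} {t} {L} {R} gL gR t≤q with goodWord-Sᵣ gL
  ... | v , eq , v≤m = begin
    components (suc m + q) (sortedLetters (glue m t L R))
      ≡⟨ cong (components (suc m + q))
        (trans (glue-Sᵣ m t L R eq) (cong (_++ top ∷ τ′) (Listₚ.map-id-local (All.map shiftL-low v≤m)))) ⟩
    count P (suc m + q) ≡⟨ count-+ (suc m) q P ⟩
    count P (suc m) + count (λ s → P (suc m + s)) q
      ≡⟨ cong₂ _+_ (trans (count-cong (suc m) first) (cong (λ u → components (suc m) u) (sym eq))) second ⟩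
    components (suc m) (Sᵣ L) + count (λ s → cutᵇ (t + s) τ) (q ∸ t) ∎
    where
    open ≡.≡-Reasoning
    τ = sortedLetters R
    τ′ = map (shiftR m t) τ
    top = suc (m + t)
    P : ℕ → Bool
    P s = cutᵇ s (v ++ top ∷ τ′)
    boundR : ∀ {j} → j ∈ τ → 1 ≤ j
    boundR j∈ = proj₁ (bounds (g-letters gR) (concat-Sᵣ-∈⁻ R j∈))
    first : ∀ s → s < suc m → P s ≡ cutᵇ s (v ++ [ suc m ])
    first s s<m = cutᵇ-cong
      (λ c → cut-++⁺ (proj₁ (cut-++⁻ v c)) (s<m ∷ []))
      (λ c → cut-++⁺ (proj₁ (cut-++⁻ v c)) (ℕₚ.<-≤-trans s<m (s≤s (ℕₚ.m≤m+n m t)) ∷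
        Allₚ.map⁺ (All.tabulate λ j∈ → ℕₚ.≤-<-trans (ℕₚ.≤-pred s<m) (m<shiftR m t (boundR j∈)))))
    -- The letter 1 of `R` has become `suc m` and stands behind the larger `suc m + t`, so nothing
    -- in between is a cut.
    gap : ∀ s → s < t → P (suc m + s) ≡ false
    gap s s<t = cutᵇ-false λ c → ℕₚ.<⇒≱ (All.lookup (cut-after v (s≤s (ℕₚ.+-monoʳ-< m s<t)) c)
      (∈-map⁺ (shiftR m t) 1∈))
      (subst (_≤ suc m + s) (sym (trans (shiftR-low 1≤t) (ℕₚ.+-comm m 1))) (s≤s (ℕₚ.m≤m+n m s)))
      where
      1≤t : 1 ≤ t
      1≤t = ℕₚ.≤-trans (s≤s z≤n) s<t
      1∈ : 1 ∈ τ
      1∈ = concat-Sᵣ-∈⁺ R (occ-∈ (concat R)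
        (subst (1 ≤_) (sym (full (g-letters gR) ℕₚ.≤-refl (ℕₚ.≤-trans 1≤t t≤q))) (s≤s z≤n)))
    last : ∀ s → s < q ∸ t → P (suc m + (t + s)) ≡ cutᵇ (t + s) τ
    last s _ = cutᵇ-cong
      (λ c → cut-map⁻ τ (shiftR m t) (All.tabulate λ _ → low⁻) (All.tabulate λ _ → high⁻)
        (proj₂ (cut-++⁻ [ top ] (proj₂ (cut-++⁻ v c)))))
      (λ c → cut-≤-++⁺ (All.map (λ p → ℕₚ.≤-trans p (ℕₚ.≤-trans (ℕₚ.n≤1+n m) (ℕₚ.m≤m+n (suc m) _))) v≤m)
        (below (s≤s (ℕₚ.+-monoʳ-≤ m (ℕₚ.m≤m+n t s)))
          (cut-map (shiftR m t) (All.tabulate λ {j} _ p → ℕₚ.≤-trans (shiftR-≤ m t j) (s≤s (ℕₚ.+-monoʳ-≤ m p)))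
          (All.tabulate λ _ → high⁺) c)))
      where
      low⁻ : ∀ {j} → shiftR m t j ≤ suc m + (t + s) → j ≤ t + s
      low⁻ {j} p with ℕₚ.≤-<-connex j t
      ... | inj₁ a = ℕₚ.≤-trans a (ℕₚ.m≤m+n t s)
      ... | inj₂ a = ℕₚ.+-cancelˡ-≤ m _ _ (ℕₚ.≤-pred (subst (_≤ suc m + (t + s)) (shiftR-high a) p))
      high⁻ : ∀ {j} → suc m + (t + s) < shiftR m t j → t + s < j
      high⁻ {j} p = ℕₚ.+-cancelˡ-< (suc m) _ _ (ℕₚ.<-≤-trans p (shiftR-≤ m t j))
      high⁺ : ∀ {j} → t + s < j → suc m + (t + s) < shiftR m t j
      high⁺ {j} p = subst (suc m + (t + s) <_) (sym (shiftR-high (ℕₚ.≤-<-trans (ℕₚ.m≤m+n t s) p)))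
        (s≤s (ℕₚ.+-monoʳ-< m p))
    second : count (λ s → P (suc m + s)) q ≡ count (λ s → cutᵇ (t + s) τ) (q ∸ t)
    second = trans (cong (count (λ s → P (suc m + s))) (sym (ℕₚ.m+[n∸m]≡n t≤q)))
      (trans (count-+ t (q ∸ t) (λ s → P (suc m + s))) (cong₂ _+_ (count-false t gap) (count-cong (q ∸ t) last)))

  headSmaller : Word → ℕ → Bool
  headSmaller []      x = false
  headSmaller (y ∷ _) x = y <ᵇ x

  -- Whether the letter x is a descent of type i at a position preceded by s (read
  -- from right to left) and followed by w.
  descentAt : ℕ → Word → ℕ → Word → Bool
  descentAt zero    s x w = (occ x s ≡ᵇ 0) ∧ headSmaller s x
  descentAt (suc i) s x w = (occ x s ≡ᵇ i) ∧ headSmaller w x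

  descents : ℕ → Word → Word → ℕ
  descents i s []      = 0
  descents i s (x ∷ w) = bit (descentAt i s x w) + descents i (x ∷ s) w

  private
    -- The share of one letter `a` in `descents`. It mediates between `descCount`, which runs over
    -- letters, and `descents`, which runs over positions.
    letterDescents : ℕ → ℕ → Word → Word → ℕ
    letterDescents a i s []      = 0
    letterDescents a i s (x ∷ w) = (if a ≡ᵇ x then bit (descentAt i s x w) else 0) + letterDescents a i (x ∷ s) w

    bit-∧-false : ∀ {b c} → b ≡ false → bit (b ∧ c) ≡ 0
    bit-∧-false refl = refl

    occ-step : ∀ a x s → occ a s ≤ occ a (x ∷ s)
    occ-step a x s with a ≡ᵇ x
    ... | true  = ℕₚ.n≤1+n _
    ... | false = ℕₚ.≤-refl

    letterDescents-0 : ∀ a s w → 0 < occ a s → letterDescents a 0 s w ≡ 0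
    letterDescents-0 a s []      p = refl
    letterDescents-0 a s (x ∷ w) p with a ≡ᵇ x in eq | letterDescents-0 a (x ∷ s) w
      (ℕₚ.<-≤-trans p (occ-step a x s))
    ... | false | ih = ih
    ... | true  | ih = trans (cong (_+ letterDescents a 0 (x ∷ s) w)
      (bit-∧-false (zero-test (subst (λ y → 0 < occ y s) (≡ᵇ-true a x eq) p)))) ih
      where
      zero-test : ∀ {k} → 0 < k → (k ≡ᵇ 0) ≡ false
      zero-test (s≤s _) = refl

    letterDescents-later : ∀ a i s w → i < occ a s → letterDescents a (suc i) s w ≡ 0
    letterDescents-later a i s []      p = refl
    letterDescents-later a i s (x ∷ w) p with a ≡ᵇ x in eq | letterDescents-later a i (x ∷ s) w
      (ℕₚ.<-≤-trans p (occ-step a x s))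
    ... | false | ih = ih
    ... | true  | ih = trans (cong (_+ letterDescents a (suc i) (x ∷ s) w)
      (bit-∧-false (≢⇒≡ᵇ (λ e → ℕₚ.<⇒≢ (subst (λ y → i < occ y s) (≡ᵇ-true a x eq) p) (sym e))))) ih

    letterDescents-≡ : ∀ a i s w →
      letterDescents a i s (a ∷ w) ≡ bit (descentAt i s a w) + letterDescents a i (a ∷ s) w
    letterDescents-≡ a i s w rewrite ≡ᵇ-refl a = refl

    letterDescents-≢ : ∀ {a x} i s w → a ≢ x → letterDescents a i s (x ∷ w) ≡ letterDescents a i (x ∷ s) w
    letterDescents-≢ i s w a≢x rewrite ≢⇒≡ᵇ a≢x = refl

    isDescent-≢ : ∀ {a x} d w → a ≢ x → isDescent (x ∷ w) a (suc d) ≡ isDescent w a (suc d)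
    isDescent-≢ {a} d w a≢x rewrite ≢⇒≡ᵇ a≢x with nthOcc a (suc d) w
    ... | just p  = refl
    ... | nothing = refl

    isDescent-≡ : ∀ a d w → isDescent (a ∷ w) a (suc (suc d)) ≡ isDescent w a (suc d)
    isDescent-≡ a d w rewrite ≡ᵇ-refl a with nthOcc a (suc d) w
    ... | just p  = refl
    ... | nothing = refl

    isDescent-first : ∀ a w → isDescent (a ∷ w) a 1 ≡ headSmaller w a
    isDescent-first a w rewrite ≡ᵇ-refl a with w
    ... | []    = refl
    ... | _ ∷ _ = refl

    -- `descentAt` counts occurrences from the start of the word and `isDescent` within the
    -- remaining part; `occ a s` is the offset.
    letterDescents-suc : ∀ a d s w → letterDescents a (suc (occ a s + d)) s w ≡ bit (isDescent w a (suc d))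
    letterDescents-suc a d s []      = refl
    letterDescents-suc a d s (x ∷ w) with a ℕ.≟ x
    letterDescents-suc a zero s (x ∷ w) | yes refl = trans (letterDescents-≡ a _ s w) (trans
      (cong₂ _+_ (cong (λ b → bit (b ∧ headSmaller w x)) (trans (cong (occ x s ≡ᵇ_) (ℕₚ.+-identityʳ _))
        (≡ᵇ-refl (occ x s))))
        (letterDescents-later x (occ x s + 0) (x ∷ s) w (subst (occ x s + 0 <_) (sym (occ-cons-≡ x s))
          (s≤s (ℕₚ.≤-reflexive (ℕₚ.+-identityʳ _))))))
      (trans (ℕₚ.+-identityʳ _) (cong bit (sym (isDescent-first a w)))))
    letterDescents-suc a (suc d) s (x ∷ w) | yes refl = trans (letterDescents-≡ a _ s w) (trans
      (cong₂ _+_ (bit-∧-false (≢⇒≡ᵇ (ℕₚ.<⇒≢ (ℕₚ.m<m+n (occ x s) (s≤s z≤n)))))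
        (trans (cong (λ k → letterDescents x (suc k) (x ∷ s) w)
          (trans (ℕₚ.+-suc (occ x s) d) (cong (_+ d) (sym (occ-cons-≡ x s)))))
          (letterDescents-suc x d (x ∷ s) w)))
      (cong bit (sym (isDescent-≡ a d w))))
    letterDescents-suc a d s (x ∷ w) | no a≢x = trans (letterDescents-≢ _ s w a≢x) (trans
      (cong (λ k → letterDescents a (suc (k + d)) (x ∷ s) w) (sym (occ-cons-≢ s a≢x)))
      (trans (letterDescents-suc a d (x ∷ s) w) (cong bit (sym (isDescent-≢ d w a≢x)))))

    -- A type 0 descent looks to the left, possibly into the part already scanned; hence the context
    -- `s`.
    firstDescent : Word → ℕ → Word → Bool
    firstDescent s a w with nthOcc a 1 w
    ... | nothing      = false
    ... | just zero    = headSmaller s a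
    ... | just (suc p) = smallerThan (at w p) a

    firstDescent-≡ : ∀ s a w → firstDescent s a (a ∷ w) ≡ headSmaller s a
    firstDescent-≡ s a w rewrite ≡ᵇ-refl a = refl

    firstDescent-≢ : ∀ s {a x} w → a ≢ x → firstDescent s a (x ∷ w) ≡ firstDescent (x ∷ s) a w
    firstDescent-≢ s {a} w a≢x rewrite ≢⇒≡ᵇ a≢x with nthOcc a 1 w
    ... | nothing      = refl
    ... | just zero    = refl
    ... | just (suc p) = refl

    letterDescents-zero : ∀ a s w → occ a s ≡ 0 → letterDescents a 0 s w ≡ bit (firstDescent s a w)
    letterDescents-zero a s []      p = refl
    letterDescents-zero a s (x ∷ w) p with a ℕ.≟ x
    ... | yes refl = trans (letterDescents-≡ a 0 s w) (trans
      (cong₂ _+_ (cong (λ k → bit ((k ≡ᵇ 0) ∧ headSmaller s x)) p)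
        (letterDescents-0 x (x ∷ s) w (subst (0 <_) (sym (occ-cons-≡ x s)) (s≤s z≤n))))
      (trans (ℕₚ.+-identityʳ _) (cong bit (sym (firstDescent-≡ s a w)))))
    ... | no a≢x = trans (letterDescents-≢ 0 s w a≢x) (trans
      (letterDescents-zero a (x ∷ s) w (trans (occ-cons-≢ s a≢x) p)) (cong bit (sym (firstDescent-≢ s w a≢x))))

    letterDescents-isDescent : ∀ a i w → letterDescents a i [] w ≡ bit (isDescent w a i)
    letterDescents-isDescent a (suc i) w = letterDescents-suc a i [] w
    letterDescents-isDescent a zero    w = trans (letterDescents-zero a [] w refl) same
      where
      same : bit (firstDescent [] a w) ≡ bit (isDescent w a zero)
      same with nthOcc a 1 w
      ... | nothing      = refl
      ... | just zero    = refl
      ... | just (suc p) = refl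

  module _ {A : Set} where
    length-filterᵇ : ∀ (P : A → Bool) xs → length (filterᵇ P xs) ≡ sum (map (λ x → bit (P x)) xs)
    length-filterᵇ P []       = refl
    length-filterᵇ P (x ∷ xs) with P x
    ... | true  = cong suc (length-filterᵇ P xs)
    ... | false = length-filterᵇ P xs

    sum-map-+ : ∀ (f g : A → ℕ) xs → sum (map (λ x → f x + g x) xs) ≡ sum (map f xs) + sum (map g xs)
    sum-map-+ f g []       = refl
    sum-map-+ f g (x ∷ xs) = trans (cong (f x + g x +_) (sum-map-+ f g xs))
      (solve 4 (λ a b c d → (a :+ b) :+ (c :+ d) := (a :+ c) :+ (b :+ d)) refl (f x) (g x) _ _)
      where open ℕSolver.+-*-Solver

    sum-map-0 : ∀ (xs : List A) → sum (map (λ _ → 0) xs) ≡ 0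
    sum-map-0 []       = refl
    sum-map-0 (_ ∷ xs) = sum-map-0 xs

  private
    sum-miss : ∀ x k xs → All (x ≢_) xs → sum (map (λ a → if a ≡ᵇ x then k else 0) xs) ≡ 0
    sum-miss x k []       _        = refl
    sum-miss x k (y ∷ xs) (p ∷ ps) rewrite ≢⇒≡ᵇ (λ e → p (sym e)) = sum-miss x k xs ps

    sum-hit : ∀ x k xs → Unique xs → x ∈ xs → sum (map (λ a → if a ≡ᵇ x then k else 0) xs) ≡ k
    sum-hit x k (y ∷ xs) (p ∷ _) (here refl) rewrite ≡ᵇ-refl x = trans (cong (k +_) (sum-miss x k xs p))
      (ℕₚ.+-identityʳ k)
    sum-hit x k (y ∷ xs) (p ∷ u) (there x∈) rewrite ≢⇒≡ᵇ (All.lookup p x∈) = sum-hit x k xs u x∈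

  range-unique : ∀ n → Unique (range n)
  range-unique n = AllPairs.map ℕₚ.<⇒≢ (range-ascending n)

  length-occ : ∀ n w → (∀ {x} → x ∈ w → x ∈ range n) → length w ≡ sum (map (λ a → occ a w) (range n))
  length-occ n []      _ = sym (sum-map-0 (range n))
  length-occ n (x ∷ w) h = sym (trans (cong sum (Listₚ.map-cong split (range n))) (trans (sum-map-+ _ _ (range n))
    (cong₂ _+_ (sum-hit x 1 (range n) (range-unique n) (h (here refl)))
      (sym (length-occ n w (λ p → h (there p)))))))
    where
    split : ∀ a → occ a (x ∷ w) ≡ (if a ≡ᵇ x then 1 else 0) + occ a w
    split a with a ≡ᵇ x
    ... | true  = refl
    ... | false = refl

  descCount-descents : ∀ n w i → (∀ {x} → x ∈ w → x ∈ range n) → descCount n w i ≡ descents i [] w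
  descCount-descents n w i h = trans (length-filterᵇ (λ a → isDescent w a i) (range n))
    (trans (cong sum (Listₚ.map-cong (λ a → sym (letterDescents-isDescent a i w)) (range n))) (total [] w h))
    where
    total : ∀ s w → (∀ {x} → x ∈ w → x ∈ range n) → sum (map (λ a → letterDescents a i s w) (range n))
      ≡ descents i s w
    total s []      _ = sum-map-0 (range n)
    total s (x ∷ w) h = trans (sum-map-+ _ (λ a → letterDescents a i (x ∷ s) w) (range n))
      (cong₂ _+_ (sum-hit x (bit (descentAt i s x w)) (range n) (range-unique n) (h (here refl)))
        (total (x ∷ s) w (λ p → h (there p))))

  module _ {f : ℕ → ℕ} (f< : StrictlyMonotone f) where
    private
      <ᵇ-map : ∀ x y → (f x <ᵇ f y) ≡ (x <ᵇ y)
      <ᵇ-map x y with x <ᵇ y in eq | f x <ᵇ f y in eq′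
      ... | true  | true  = refl
      ... | false | false = refl
      ... | true  | false = trans (sym eq′) (T⇒≡true (ℕₚ.<⇒<ᵇ (f< (ℕₚ.<ᵇ⇒< x y (≡true⇒T eq)))))
      ... | false | true  = trans (sym
        (T⇒≡true (ℕₚ.<⇒<ᵇ (StrictlyMonotoneProperties.mono-cancel-< f< (ℕₚ.<ᵇ⇒< (f x) (f y) (≡true⇒T eq′)))))) eq

      headSmaller-map : ∀ s x → headSmaller (map f s) (f x) ≡ headSmaller s x
      headSmaller-map []      x = refl
      headSmaller-map (y ∷ s) x = <ᵇ-map y x

      descentAt-map : ∀ i s x w → descentAt i (map f s) (f x) (map f w) ≡ descentAt i s x w
      descentAt-map zero    s x w = cong₂ _∧_ (cong (_≡ᵇ 0) (occ-map f< x s)) (headSmaller-map s x)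
      descentAt-map (suc i) s x w = cong₂ _∧_ (cong (_≡ᵇ i) (occ-map f< x s)) (headSmaller-map w x)

    descents-map : ∀ i s w → descents i (map f s) (map f w) ≡ descents i s w
    descents-map i s []      = refl
    descents-map i s (x ∷ w) = cong₂ _+_ (cong bit (descentAt-map i s x w)) (descents-map i (x ∷ s) w)

  sequenceDescents : ℕ → List Word → ℕ
  sequenceDescents i αs = sum (map (descents i []) αs)

  nonempty : Word → ℕ
  nonempty []      = 0
  nonempty (_ ∷ _) = 1

  -- The type i descent of the largest letter: the i-th word between its occurrences
  -- (counted from 0) is nonempty.
  nonemptyAt : List Word → ℕ → ℕ
  nonemptyAt []       i       = 0
  nonemptyAt (α ∷ αs) zero    = nonempty α
  nonemptyAt (α ∷ αs) (suc i) = nonemptyAt αs i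

  private
    occ-ʳ++ : ∀ a u s → occ a (u ʳ++ s) ≡ occ a u + occ a s
    occ-ʳ++ a []      s = refl
    occ-ʳ++ a (x ∷ u) s rewrite occ-ʳ++ a u (x ∷ s) with a ≡ᵇ x
    ... | true  = ℕₚ.+-suc _ _
    ... | false = refl

    headSmaller-++ : ∀ p {s x} → headSmaller s x ≡ false → headSmaller (p ++ s) x ≡ headSmaller p x
    headSmaller-++ []      e = e
    headSmaller-++ (_ ∷ _) e = refl

    descentAt-context : ∀ i p s x u v → x ∉ s → headSmaller s x ≡ false → headSmaller v x ≡ false →
      descentAt i (p ++ s) x (u ++ v) ≡ descentAt i p x u
    descentAt-context i p s x u v x∉ e e′ = go i
      where
      occ≡ : occ x (p ++ s) ≡ occ x p
      occ≡ = trans (occ-++ x p s) (trans (cong (occ x p +_) (occ-∉ s x∉)) (ℕₚ.+-identityʳ _))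
      go : ∀ i → descentAt i (p ++ s) x (u ++ v) ≡ descentAt i p x u
      go zero    = cong₂ _∧_ (cong (_≡ᵇ 0) occ≡) (headSmaller-++ p e)
      go (suc i) = cong₂ _∧_ (cong (_≡ᵇ i) occ≡) (headSmaller-++ u e′)

    -- A prefix without the letters of `u` leaves occurrence numbers alone, and neighbours that are
    -- not smaller create no descents. Between occurrences of the largest letter a piece therefore
    -- keeps exactly its own descents.
    descents-context : ∀ i p s u v → (∀ {x} → x ∈ u → x ∉ s) → All (λ x → headSmaller s x ≡ false) u →
      All (λ x → headSmaller v x ≡ false) u →
      descents i (p ++ s) (u ++ v) ≡ descents i p u + descents i (u ʳ++ (p ++ s)) v
    descents-context i p s []      v _ _ _ = refl
    descents-context i p s (x ∷ u) v dis (e ∷ es) (e′ ∷ es′) = trans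
      (cong₂ _+_ (cong bit (descentAt-context i p s x u v (dis (here refl)) e e′))
        (descents-context i (x ∷ p) s u v (λ q → dis (there q)) es es′))
      (sym (ℕₚ.+-assoc (bit (descentAt i p x u)) _ _))

    -- The share of the largest letter in the descents of a joined word, when `c` of its occurrences
    -- lie further left.
    maxDescents : ℕ → ℕ → List Word → ℕ
    maxDescents i       c []            = 0
    maxDescents i       c (β ∷ [])     = 0
    maxDescents zero    c (β ∷ γ ∷ βs) = (if c ≡ᵇ 0 then nonempty β else 0) + maxDescents zero (suc c) (γ ∷ βs)
    maxDescents (suc i) c (β ∷ γ ∷ βs) = (if c ≡ᵇ i then nonempty γ else 0) + maxDescents (suc i) (suc c) (γ ∷ βs)

    maxDescents-zero : ∀ c βs → maxDescents zero (suc c) βs ≡ 0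
    maxDescents-zero c []            = refl
    maxDescents-zero c (β ∷ [])     = refl
    maxDescents-zero c (β ∷ γ ∷ βs) = maxDescents-zero (suc c) (γ ∷ βs)

    maxDescents-later : ∀ i c βs → i < c → maxDescents (suc i) c βs ≡ 0
    maxDescents-later i c []            _ = refl
    maxDescents-later i c (β ∷ [])     _ = refl
    maxDescents-later i c (β ∷ γ ∷ βs) p = trans
      (cong (λ b → (if b then nonempty γ else 0) + maxDescents (suc i) (suc c) (γ ∷ βs))
        (≢⇒≡ᵇ (λ e → ℕₚ.<⇒≢ p (sym e))))
      (maxDescents-later i (suc c) (γ ∷ βs) (ℕₚ.m<n⇒m<1+n p))

    maxDescents-suc : ∀ d c β βs → maxDescents (suc (c + d)) c (β ∷ βs) ≡ nonemptyAt βs d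
    maxDescents-suc d       c β []       = refl
    maxDescents-suc zero    c β (γ ∷ βs) rewrite ℕₚ.+-identityʳ c | ≡ᵇ-refl c =
      trans (cong (nonempty γ +_) (maxDescents-later c (suc c) (γ ∷ βs) ℕₚ.≤-refl)) (ℕₚ.+-identityʳ _)
    maxDescents-suc (suc d) c β (γ ∷ βs) = trans
      (cong (λ b → (if b then nonempty γ else 0) + maxDescents (suc (c + suc d)) (suc c) (γ ∷ βs))
        (≢⇒≡ᵇ (ℕₚ.<⇒≢ (ℕₚ.m<m+n c (s≤s z≤n)))))
      (trans (cong (λ k → maxDescents (suc k) (suc c) (γ ∷ βs)) (ℕₚ.+-suc c d)) (maxDescents-suc d (suc c) γ βs))

    maxDescents-0 : ∀ i β γ βs → maxDescents i 0 (β ∷ γ ∷ βs) ≡ nonemptyAt (β ∷ γ ∷ βs) i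
    maxDescents-0 zero    β γ βs = trans (cong (nonempty β +_) (maxDescents-zero 0 (γ ∷ βs))) (ℕₚ.+-identityʳ _)
    maxDescents-0 (suc i) β γ βs = maxDescents-suc i 0 β (γ ∷ βs)

    <ᵇ-false : ∀ {x m} → x < m → (m <ᵇ x) ≡ false
    <ᵇ-false {x} {m} p with m <ᵇ x in eq
    ... | true  = ⊥-elim (ℕₚ.<-asym p (ℕₚ.<ᵇ⇒< m x (≡true⇒T eq)))
    ... | false = refl

    module _ (m : ℕ) where
      -- s is empty or starts with m.
      Fresh : Word → Set
      Fresh s = ∀ {x} → x ≤ m → headSmaller s x ≡ false

      head-before : ∀ u s → All (_< m) u → Fresh s →
        headSmaller (u ʳ++ s) m ≡ (if nonempty u ≡ᵇ 0 then false else true)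
      head-before []      s _        fr = fr ℕₚ.≤-refl
      head-before (x ∷ u) s (p ∷ ps) fr = go u (x ∷ s) ps (T⇒≡true (ℕₚ.<⇒<ᵇ p))
        where
        go : ∀ u s → All (_< m) u → headSmaller s m ≡ true → headSmaller (u ʳ++ s) m ≡ true
        go []      s _        e = e
        go (y ∷ u) s (q ∷ qs) e = go u (y ∷ s) qs (T⇒≡true (ℕₚ.<⇒<ᵇ q))

      head-after : ∀ γ βs → All (_< m) γ →
        headSmaller (joinW m (γ ∷ βs)) m ≡ (if nonempty γ ≡ᵇ 0 then false else true)
      head-after []      []       _       = refl
      head-after []      (β ∷ βs) _       = <ᵇ-irrefl m
        where
        <ᵇ-irrefl : ∀ n → (n <ᵇ n) ≡ false
        <ᵇ-irrefl zero    = refl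
        <ᵇ-irrefl (suc n) = <ᵇ-irrefl n
      head-after (x ∷ γ) []       (p ∷ _) = T⇒≡true (ℕₚ.<⇒<ᵇ p)
      head-after (x ∷ γ) (β ∷ βs) (p ∷ _) = T⇒≡true (ℕₚ.<⇒<ᵇ p)

      bit-nonempty : ∀ b γ → bit (b ∧ (if nonempty γ ≡ᵇ 0 then false else true)) ≡ (if b then nonempty γ else 0)
      bit-nonempty false γ       = refl
      bit-nonempty true  []      = refl
      bit-nonempty true  (_ ∷ _) = refl

      descents-joinW : ∀ i s β βs → All (All (_< m)) (β ∷ βs) → Separated (β ∷ βs) → Fresh s →
        (∀ {x} → x ∈ concat (β ∷ βs) → x ∉ s) →
        descents i s (joinW m (β ∷ βs)) ≡ sequenceDescents i (β ∷ βs) + maxDescents i (occ m s) (β ∷ βs)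
      descents-joinW i s β [] (β<m ∷ []) _ fr dis = trans (cong (descents i s) (sym (Listₚ.++-identityʳ β)))
        (trans (descents-context i [] s β [] (λ p → dis (∈-++⁺ˡ p)) (All.map (λ p → fr (ℕₚ.<⇒≤ p)) β<m)
          (All.map (λ _ → refl) β<m))
          (sym (trans (ℕₚ.+-identityʳ _) refl)))
      descents-joinW i s β (γ ∷ βs) (β<m ∷ ps@(γ<m ∷ _)) (sep , seps) fr dis = begin
        descents i s (β ++ m ∷ w)
          ≡⟨ descents-context i [] s β (m ∷ w) (λ p → dis (∈-++⁺ˡ p)) (All.map (λ p → fr (ℕₚ.<⇒≤ p)) β<m)
            (All.map <ᵇ-false β<m) ⟩
        descents i [] β + (bit (descentAt i s′ m w) + descents i (m ∷ s′) w)
          ≡⟨ cong (descents i [] β +_) (cong₂ _+_ refl (trans (descents-joinW i (m ∷ s′) γ βs ps seps fresh dis′)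
               (cong (λ c → sequenceDescents i (γ ∷ βs) + maxDescents i c (γ ∷ βs))
                 (trans (occ-cons-≡ m s′) (cong suc occ-s′))))) ⟩
        descents i [] β + (bit (descentAt i s′ m w) + (sequenceDescents i (γ ∷ βs) + maxDescents i
          (suc c) (γ ∷ βs)))
          ≡⟨ solve 4 (λ a b c d → a :+ (b :+ (c :+ d)) := (a :+ c) :+ (b :+ d)) refl (descents i [] β)
            (bit (descentAt i s′ m w)) (sequenceDescents i (γ ∷ βs)) (maxDescents i (suc c) (γ ∷ βs)) ⟩
        sequenceDescents i (β ∷ γ ∷ βs) + (bit (descentAt i s′ m w) + maxDescents i (suc c) (γ ∷ βs))
          ≡⟨ cong (sequenceDescents i (β ∷ γ ∷ βs) +_) (top i) ⟩
        sequenceDescents i (β ∷ γ ∷ βs) + maxDescents i c (β ∷ γ ∷ βs) ∎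
        where
        open ≡.≡-Reasoning
        open ℕSolver.+-*-Solver
        w = joinW m (γ ∷ βs)
        s′ = β ʳ++ s
        c = occ m s
        occ-s′ : occ m s′ ≡ c
        occ-s′ = trans (occ-ʳ++ m β s) (cong (_+ c) (occ-∉ β (λ m∈ → ℕₚ.<-irrefl refl (All.lookup β<m m∈))))
        fresh : Fresh (m ∷ s′)
        fresh {x} x≤m with m <ᵇ x in eq
        ... | true  = ⊥-elim (ℕₚ.<⇒≱ (ℕₚ.<ᵇ⇒< m x (≡true⇒T eq)) x≤m)
        ... | false = refl
        dis′ : ∀ {x} → x ∈ concat (γ ∷ βs) → x ∉ m ∷ s′
        dis′ x∈ (here refl) with ∈-concat⁻′ (γ ∷ βs) x∈
        ... | δ , x∈δ , δ∈ = ℕₚ.<-irrefl refl (All.lookup (All.lookup ps δ∈) x∈δ)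
        dis′ {x} x∈ (there p) = absurd (∈-ʳ++⁻ β p)
          where
          ∈-ʳ++⁻ : ∀ u {s} → x ∈ u ʳ++ s → x ∈ u ⊎ x ∈ s
          ∈-ʳ++⁻ []      p = inj₂ p
          ∈-ʳ++⁻ (y ∷ u) p with ∈-ʳ++⁻ u p
          ... | inj₁ q           = inj₁ (there q)
          ... | inj₂ (here refl) = inj₁ (here refl)
          ... | inj₂ (there q)   = inj₂ q
          absurd : x ∈ β ⊎ x ∈ s → _
          absurd (inj₁ q) = sep q x∈
          absurd (inj₂ q) = dis (∈-++⁺ʳ β x∈) q
        top : ∀ i → bit (descentAt i s′ m w) + maxDescents i (suc c) (γ ∷ βs) ≡ maxDescents i c (β ∷ γ ∷ βs)
        top zero    = cong (_+ maxDescents zero (suc c) (γ ∷ βs))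
          (trans (cong₂ (λ k b → bit ((k ≡ᵇ 0) ∧ b)) occ-s′ (head-before β s β<m fr)) (bit-nonempty (c ≡ᵇ 0) β))
        top (suc i) = cong (_+ maxDescents (suc i) (suc c) (γ ∷ βs))
          (trans (cong₂ (λ k b → bit ((k ≡ᵇ i) ∧ b)) occ-s′ (head-after γ βs γ<m)) (bit-nonempty (c ≡ᵇ i) γ))

  descents-join : ∀ {r n} i αs → length αs ≡ suc (suc r) → Good (suc r) n αs →
    descents i [] (joinW (suc n) αs) ≡ nonemptyAt αs i + sequenceDescents i αs
  descents-join {n = n} i (α ∷ β ∷ αs) _ g = trans
    (descents-joinW (suc n) i [] α (β ∷ αs) (good-bounds g) (g-separated g) (λ _ → refl) (λ _ ()))
    (trans (cong (sequenceDescents i (α ∷ β ∷ αs) +_) (maxDescents-0 i α β αs))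
      (ℕₚ.+-comm _ (nonemptyAt (α ∷ β ∷ αs) i)))

  sequenceDescents-glue : ∀ i m t L R → sequenceDescents i (glue m t L R) ≡ descents i [] L + sequenceDescents i R
  sequenceDescents-glue i m t L R = cong₂ _+_ (descents-map (shiftL-mono m t) i [] L)
    (cong sum (trans (sym (Listₚ.map-∘ R)) (Listₚ.map-cong (descents-map (shiftR-mono m t) i []) R)))

  nonemptyAt-map : ∀ f R i → nonemptyAt (map (map f) R) i ≡ nonemptyAt R i
  nonemptyAt-map f []             i       = refl
  nonemptyAt-map f ([] ∷ R)       zero    = refl
  nonemptyAt-map f ((_ ∷ _) ∷ R) zero    = refl
  nonemptyAt-map f (_ ∷ R)       (suc i) = nonemptyAt-map f R i

open Words

-- Weighted enumeration

module ListSum (E : CommutativeRing 0ℓ 0ℓ) where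
  open CommutativeRing E renaming (refl to ≈-refl; sym to ≈-sym; trans to ≈-trans) hiding (zero)
  open IntegerSolver E

  wsum : ∀ {A : Set} → (A → Carrier) → List A → Carrier
  wsum f []       = 0#
  wsum f (a ∷ as) = f a + wsum f as

  module _ {A : Set} where
    wsum-cong : ∀ {f g : A → Carrier} as → (∀ {a} → a ∈ as → f a ≈ g a) → wsum f as ≈ wsum g as
    wsum-cong []       h = ≈-refl
    wsum-cong (a ∷ as) h = +-cong (h (here refl)) (wsum-cong as (λ p → h (there p)))

    wsum-++ : ∀ (f : A → Carrier) as bs → wsum f (as ++ bs) ≈ wsum f as + wsum f bs
    wsum-++ f []       bs = ≈-sym (+-identityˡ _)
    wsum-++ f (a ∷ as) bs = ≈-trans (+-congˡ (wsum-++ f as bs)) (≈-sym (+-assoc _ _ _))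

    wsum-scaleˡ : ∀ c (f : A → Carrier) as → wsum (λ a → c * f a) as ≈ c * wsum f as
    wsum-scaleˡ c f []       = ≈-sym (zeroʳ c)
    wsum-scaleˡ c f (a ∷ as) = ≈-trans (+-congˡ (wsum-scaleˡ c f as)) (≈-sym (distribˡ c _ _))

    wsum-scaleʳ : ∀ c (f : A → Carrier) as → wsum (λ a → f a * c) as ≈ wsum f as * c
    wsum-scaleʳ c f as = ≈-trans (wsum-cong as (λ _ → *-comm _ c)) (≈-trans (wsum-scaleˡ c f as) (*-comm c _))

    wsum-additive : ∀ (φ : Carrier → Carrier) → φ 0# ≈ 0# → (∀ x y → φ (x + y) ≈ φ x + φ y) →
      ∀ (f : A → Carrier) as → φ (wsum f as) ≈ wsum (λ a → φ (f a)) as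
    wsum-additive φ φ0 φ+ f []       = φ0
    wsum-additive φ φ0 φ+ f (a ∷ as) = ≈-trans (φ+ _ _) (+-congˡ (wsum-additive φ φ0 φ+ f as))

  module _ {A B : Set} where
    wsum-map : ∀ (f : B → Carrier) (g : A → B) as → wsum f (map g as) ≈ wsum (λ a → f (g a)) as
    wsum-map f g []       = ≈-refl
    wsum-map f g (a ∷ as) = +-congˡ (wsum-map f g as)

    wsum-concatMap : ∀ (f : B → Carrier) (g : A → List B) as →
      wsum f (concatMap g as) ≈ wsum (λ a → wsum f (g a)) as
    wsum-concatMap f g []       = ≈-refl
    wsum-concatMap f g (a ∷ as) = ≈-trans (wsum-++ f (g a) (concatMap g as)) (+-congˡ (wsum-concatMap f g as))

  wsum-applyUpTo : ∀ n (f : ℕ → Carrier) (g : ℕ → ℕ) → wsum f (applyUpTo g n) ≈ wsum (λ m → f (g m)) (upTo n)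
  wsum-applyUpTo n f g = ≈-trans (reindex n g) (≈-sym (reindex n (λ m → m) {λ m → f (g m)}))
    where
    total : (ℕ → Carrier) → ℕ → Carrier
    total f zero    = 0#
    total f (suc n) = f 0 + total (λ m → f (suc m)) n
    reindex : ∀ n g {f} → wsum f (applyUpTo g n) ≈ total (λ m → f (g m)) n
    reindex zero    g = ≈-refl
    reindex (suc n) g = +-congˡ (reindex n (λ m → g (suc m)))

  wsum-upTo-suc : ∀ n (f : ℕ → Carrier) → wsum f (upTo (suc n)) ≈ f 0 + wsum (λ m → f (suc m)) (upTo n)
  wsum-upTo-suc n f = +-congˡ (wsum-applyUpTo n f suc)

  open PowerSeries E using (_⊛_; δ)

  convolution : ∀ n a c → (a ⊛ c) n ≈ wsum (λ m → a m * c (n ∸ m)) (upTo (suc n))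
  convolution zero    a c = ≈-sym (+-identityʳ _)
  convolution (suc n) a c = ≈-trans (+-congˡ (convolution n (δ a) c))
    (≈-sym (wsum-upTo-suc (suc n) (λ m → a m * c (suc n ∸ m))))

  convolution₀ : ∀ n a c → a 0 ≈ 0# → (a ⊛ c) n ≈ wsum (λ m → a (suc m) * c (n ∸ suc m)) (upTo n)
  convolution₀ zero    a c a₀ = ≈-trans (*-congʳ a₀) (zeroˡ _)
  convolution₀ (suc n) a c a₀ = ≈-trans (+-cong (≈-trans (*-congʳ a₀) (zeroˡ _)) (convolution n (δ a) c))
    (+-identityˡ _)

module Weights (r : ℕ) (E : CommutativeRing 0ℓ 0ℓ) (U : CommutativeRing.Carrier E)
  (Ψ : CommutativeRing.Carrier E → CommutativeRing.Carrier E) where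
  open CommutativeRing E renaming (refl to ≈-refl; sym to ≈-sym; trans to ≈-trans) hiding (zero)
  open IntegerSolver E
  open Powers semiring using (_^_; ^-homo-*)
  open Recursion E U Ψ
  open Monomials E
  open ListSum E
  open Generate r
  open Correct
  open SetoidReasoning setoid

  -- In the application `Ψ` is linear over elements free of `ω`, such as the weights, but not over
  -- `U`.
  Scalar : Carrier → Set
  Scalar a = ∀ f → Ψ (a * f) ≈ a * Ψ f

  module _ (Ψ-cong : ∀ {f g} → f ≈ g → Ψ f ≈ Ψ g) (Ψ-+ : ∀ f g → Ψ (f + g) ≈ Ψ f + Ψ g)
    (Ψ-U^ : ∀ c → Ψ (U ^ c) ≈ geometric c) (weights : List Carrier) (weights-scalar : All Scalar weights) where

    scalar-1 : Scalar 1#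
    scalar-1 f = ≈-trans (Ψ-cong (*-identityˡ f)) (≈-sym (*-identityˡ _))

    scalar-* : ∀ {a c} → Scalar a → Scalar c → Scalar (a * c)
    scalar-* {a} {c} p q f = begin
      Ψ (a * c * f)   ≈⟨ Ψ-cong (*-assoc a c f) ⟩
      Ψ (a * (c * f)) ≈⟨ p (c * f) ⟩
      a * Ψ (c * f)   ≈⟨ *-congˡ (q f) ⟩
      a * (c * Ψ f)   ≈⟨ ≈-sym (*-assoc a c _) ⟩
      a * c * Ψ f     ∎

    scalar-^ : ∀ {a} n → Scalar a → Scalar (a ^ n)
    scalar-^ zero    p = scalar-1
    scalar-^ (suc n) p = scalar-* p (scalar-^ n p)

    scalar-monomial : ∀ {xs} e → All Scalar xs → Scalar (monomial xs e)
    scalar-monomial e []       = scalar-1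
    scalar-monomial e (p ∷ ps) = scalar-* (scalar-^ (e 0) p) (scalar-monomial (λ i → e (suc i)) ps)

    Ψ-0 : Ψ 0# ≈ 0#
    Ψ-0 = begin
      Ψ 0# ≈⟨ solve 1 (λ a → a := (a :+ a) :+ (:- a)) ≈-refl (Ψ 0#) ⟩
      (Ψ 0# + Ψ 0#) + - Ψ 0# ≈⟨ +-congʳ (≈-sym (≈-trans (Ψ-cong (≈-sym (+-identityˡ 0#))) (Ψ-+ 0# 0#))) ⟩
      Ψ 0# + - Ψ 0# ≈⟨ -‿inverseʳ _ ⟩
      0# ∎

    wordMonomial : Word → Carrier
    wordMonomial w = monomial weights (λ i → descents i [] w)

    wordWeight : ℕ → Word → Carrier
    wordWeight n w = wordMonomial w * U ^ components n (Sᵣ w)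

    -- `xs` has one weight per word: a nonempty word becomes a descent of the next larger letter and
    -- is charged for it in advance.
    sequenceMonomial : List Carrier → List Word → Carrier
    sequenceMonomial xs αs = monomial xs (nonemptyAt αs) * monomial weights (λ i → sequenceDescents i αs)

    sequenceWeight : List Carrier → ℕ → List Word → Carrier
    sequenceWeight xs n αs = sequenceMonomial xs αs * U ^ components n (sortedLetters αs)

    -- As `t` runs through the cuts, the last of which is `q`, the exponents run through
    -- `count P q, …, 1, 0`.
    geometric-cuts : ∀ q P → P q ≡ true → wsum (λ t → U ^ count (λ s → P (t ℕ.+ s)) (q ∸ t)) (cutList P q)
      ≈ geometric (count P q)
    geometric-cuts zero P Pq rewrite Pq = +-identityʳ _
    geometric-cuts (suc q) P Pq with P 0 in eq
    ... | true = begin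
      U ^ (bit (P 0) ℕ.+ c) + wsum f (map suc (cutList (λ t → P (suc t)) q))
        ≈⟨ +-cong (reflexive (cong (λ b → U ^ (bit b ℕ.+ c)) eq)) rest ⟩
      U ^ suc c + geometric c ∎
      where
      c = count (λ t → P (suc t)) q
      f : ℕ → Carrier
      f t = U ^ count (λ s → P (t ℕ.+ s)) (suc q ∸ t)
      rest : wsum f (map suc (cutList (λ t → P (suc t)) q)) ≈ geometric c
      rest = ≈-trans (wsum-map f suc (cutList (λ t → P (suc t)) q)) (geometric-cuts q (λ t → P (suc t)) Pq)
    ... | false = ≈-trans (wsum-map (λ t → U ^ count (λ s → P (t ℕ.+ s)) (suc q ∸ t))
      suc (cutList (λ t → P (suc t)) q))
                          (geometric-cuts q (λ t → P (suc t)) Pq)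

    module _ {A : ℕ → List Word} {N : ℕ} (correct : Correct A N) (a : ℕ → Carrier) (a₀ : a 0 ≈ 0#)
      (a-sum : ∀ m → m < N → wsum (wordWeight (suc m)) (A (suc m)) ≈ a (suc m)) where

      private
        q≤ : ∀ {m n} → n ≤ N → n ∸ suc m ≤ N
        q≤ {m} {n} n≤N = ℕₚ.≤-trans (ℕₚ.m∸n≤m n (suc m)) n≤N

        -- Descents and surviving cuts add up under gluing, so the weight factors; `x` pays for the
        -- first word being nonempty.
        glue-weight : ∀ x xs {m q t L R} → GoodWord (suc r) (suc m) L → Good (suc r) q R → t ≤ q →
          sequenceWeight (x ∷ xs) (suc m ℕ.+ q) (glue m t L R)
          ≈ x * (wordWeight (suc m) L * (sequenceMonomial xs R * U ^ count
            (λ s → cutᵇ (t ℕ.+ s) (sortedLetters R)) (q ∸ t)))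
        glue-weight x xs {m} {q} {t} {[]}       {R} gL gR t≤q with goodWord-∈ {x = 1} gL (s≤s z≤n) (s≤s z≤n)
        ... | ()
        glue-weight x xs {m} {q} {t} {L@(_ ∷ _)} {R} gL gR t≤q = begin
          (x ^ 1 * monomial xs (nonemptyAt (map (map (shiftR m t)) R))) * monomial weights
            (λ i → sequenceDescents i (glue m t L R))
              * U ^ components (suc m ℕ.+ q) (sortedLetters (glue m t L R))
            ≈⟨ *-cong (*-cong (*-cong (*-identityʳ x) (monomial-cong xs (nonemptyAt-map (shiftR m t) R)))
                 (≈-trans (monomial-cong weights (λ i → sequenceDescents-glue i m t L R))
                   (monomial-+ weights (λ i → descents i [] L) (λ i → sequenceDescents i R))))
                 (≈-trans (reflexive (cong (U ^_) (components-glue gL gR t≤q)))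
                   (^-homo-* U (components (suc m) (Sᵣ L)) k)) ⟩
          (x * monomial xs (nonemptyAt R)) * (wordMonomial L * monomial weights (λ i → sequenceDescents i R))
            * (U ^ components (suc m) (Sᵣ L) * U ^ k)
            ≈⟨ solve 6 (λ x s w d u v → (x :* s) :* (w :* d) :* (u :* v) := x :* ((w :* u) :* (s :* d :* v)))
              ≈-refl _ _ _ _ _ _ ⟩
          x * (wordWeight (suc m) L * (sequenceMonomial xs R * U ^ k)) ∎
          where k = count (λ s → cutᵇ (t ℕ.+ s) (sortedLetters R)) (q ∸ t)

      -- `sequences` and `gSeq` obey the same recursion. An empty first word gives the first
      -- summand; for a nonempty one, the sum over the cuts of `R` is `Ψ` of the weight of `R`, and
      -- the split of the letters between the two parts is the Cauchy product.
      sequences-weight : ∀ {xs} → All Scalar xs → ∀ n → n ≤ N →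
        wsum (sequenceWeight xs n) (sequences A (length xs) n) ≈ gSeq a xs n
      sequences-weight {[]} [] zero    _ =
        ≈-trans (+-identityʳ _) (≈-trans (*-identityʳ _) (≈-trans (*-identityˡ _) (monomial-0 weights)))
      sequences-weight {[]} [] (suc n) _ = ≈-refl
      sequences-weight {x ∷ xs} (sx ∷ ss) n n≤N = begin
        wsum W (map ([] ∷_) (sequences A j n) ++ concatMap (λ m → nonemptyFirst A j m (n ∸ suc m)) (upTo n))
          ≈⟨ wsum-++ W (map ([] ∷_) (sequences A j n)) _ ⟩
        wsum W (map ([] ∷_) (sequences A j n)) + wsum W (concatMap (λ m → nonemptyFirst A j m (n ∸ suc m)) (upTo n))
          ≈⟨ +-cong empty-first nonempty-first ⟩
        gSeq a xs n + x * (a PS.⊛ (λ m → Ψ (gSeq a xs m))) n ∎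
        where
        module PS = PowerSeries E
        j = length xs
        W = sequenceWeight (x ∷ xs) n
        empty-first : wsum W (map ([] ∷_) (sequences A j n)) ≈ gSeq a xs n
        empty-first = ≈-trans (wsum-map W ([] ∷_) (sequences A j n))
          (≈-trans (wsum-cong (sequences A j n) (λ _ → *-congʳ (*-congʳ (*-identityˡ _))))
            (sequences-weight ss n n≤N))
        module _ (m : ℕ) (m<n : m < n) where
          q = n ∸ suc m
          cuts-total : ∀ {L R} → L ∈ A (suc m) → R ∈ sequences A j q →
            wsum W (gluings m q L R) ≈ x * (wordWeight (suc m) L * Ψ (sequenceWeight xs q R))
          cuts-total {L} {R} L∈ R∈ = begin
            wsum W (gluings m q L R) ≈⟨ wsum-map W (λ t → glue m t L R) (cutList P q) ⟩
            wsum (λ t → W (glue m t L R)) (cutList P q)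
              ≈⟨ wsum-cong (cutList P q) (λ {t} t∈ → ≈-trans
                   (reflexive (cong (λ k → sequenceWeight (x ∷ xs) k (glue m t L R)) (sym (ℕₚ.m+[n∸m]≡n m<n))))
                   (glue-weight x xs gL gR (proj₁ (∈-cutList⁻ P q t∈)))) ⟩
            wsum (λ t → x * (wordWeight (suc m) L * (sequenceMonomial xs R * U ^ count (λ s → P (t ℕ.+ s))
              (q ∸ t)))) (cutList P q)
              ≈⟨ ≈-trans (wsum-scaleˡ x _ (cutList P q))
                (*-congˡ (≈-trans (wsum-scaleˡ (wordWeight (suc m) L) _ (cutList P q))
                   (*-congˡ (wsum-scaleˡ (sequenceMonomial xs R) _ (cutList P q))))) ⟩
            x * (wordWeight (suc m) L * (sequenceMonomial xs R * wsum (λ t → U ^ count (λ s → P (t ℕ.+ s)) (q ∸ t))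
              (cutList P q)))
              ≈⟨ *-congˡ (*-congˡ (*-congˡ (≈-trans (geometric-cuts q P P-q) (≈-sym (Ψ-U^ (count P q)))))) ⟩
            x * (wordWeight (suc m) L * (sequenceMonomial xs R * Ψ (U ^ count P q)))
              ≈⟨ *-congˡ (*-congˡ (≈-sym (scalar-* (scalar-monomial (nonemptyAt R) ss)
                (scalar-monomial _ weights-scalar) (U ^ count P q)))) ⟩
            x * (wordWeight (suc m) L * Ψ (sequenceWeight xs q R)) ∎
            where
            P : ℕ → Bool
            P t = cutᵇ t (sortedLetters R)
            gL : GoodWord (suc r) (suc m) L
            gL = sound correct (ℕₚ.<-≤-trans m<n n≤N) L∈
            gR : Good (suc r) q R
            gR = proj₂ (sequences-sound correct j q (q≤ n≤N) R∈)
            P-q : P q ≡ true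
            P-q = Cut⇒cutᵇ (cut-≤ (All.tabulate λ x∈ → proj₂ (bounds (g-letters gR) (concat-Sᵣ-∈⁻ R x∈))))
          nonemptyFirst-weight : wsum W (nonemptyFirst A j m q) ≈ x * (a (suc m) * Ψ (gSeq a xs q))
          nonemptyFirst-weight = begin
            wsum W (nonemptyFirst A j m q)
              ≈⟨ wsum-concatMap W (λ L → concatMap (gluings m q L) (sequences A j q)) (A (suc m)) ⟩
            wsum (λ L → wsum W (concatMap (gluings m q L) (sequences A j q))) (A (suc m))
              ≈⟨ wsum-cong (A (suc m)) (λ {L} L∈ → ≈-trans (wsum-concatMap W (gluings m q L) (sequences A j q))
                   (≈-trans (wsum-cong (sequences A j q) (λ R∈ → cuts-total L∈ R∈))
                   (≈-trans (wsum-scaleˡ x _ (sequences A j q))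
                     (*-congˡ (wsum-scaleˡ (wordWeight (suc m) L) _ (sequences A j q)))))) ⟩
            wsum (λ L → x * (wordWeight (suc m) L * tails)) (A (suc m))
              ≈⟨ ≈-trans (wsum-scaleˡ x _ (A (suc m)))
                (*-congˡ (wsum-scaleʳ tails (wordWeight (suc m)) (A (suc m)))) ⟩
            x * (wsum (wordWeight (suc m)) (A (suc m)) * tails)
              ≈⟨ *-congˡ (*-cong (a-sum m (ℕₚ.<-≤-trans m<n n≤N))
                (≈-trans (≈-sym (wsum-additive Ψ Ψ-0 Ψ-+ (sequenceWeight xs q) (sequences A j q)))
                   (Ψ-cong (sequences-weight ss q (q≤ n≤N))))) ⟩
            x * (a (suc m) * Ψ (gSeq a xs q)) ∎
            where tails = wsum (λ R → Ψ (sequenceWeight xs q R)) (sequences A j q)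
        nonempty-first : wsum W (concatMap (λ m → nonemptyFirst A j m (n ∸ suc m)) (upTo n))
          ≈ x * (a PS.⊛ (λ m → Ψ (gSeq a xs m))) n
        nonempty-first = begin
          wsum W (concatMap (λ m → nonemptyFirst A j m (n ∸ suc m)) (upTo n))
            ≈⟨ wsum-concatMap W (λ m → nonemptyFirst A j m (n ∸ suc m)) (upTo n) ⟩
          wsum (λ m → wsum W (nonemptyFirst A j m (n ∸ suc m))) (upTo n)
            ≈⟨ wsum-cong (upTo n) (λ {m} m∈ → nonemptyFirst-weight m (m< m∈)) ⟩
          wsum (λ m → x * (a (suc m) * Ψ (gSeq a xs (n ∸ suc m)))) (upTo n) ≈⟨ wsum-scaleˡ x _ (upTo n) ⟩
          x * wsum (λ m → a (suc m) * Ψ (gSeq a xs (n ∸ suc m))) (upTo n)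
            ≈⟨ *-congˡ (≈-sym (convolution₀ n a (λ m → Ψ (gSeq a xs m)) a₀)) ⟩
          x * (a PS.⊛ (λ m → Ψ (gSeq a xs m))) n ∎
          where
          m< : ∀ {m} → m ∈ upTo n → m < n
          m< m∈ with ∈-applyUpTo⁻ (λ x → x) m∈
          ... | _ , p , refl = p

    module _ (arity : length weights ≡ suc (suc r)) where
      fSeq-0 : ∀ N → fSeq weights N 0 ≈ 0#
      fSeq-0 zero    = ≈-refl
      fSeq-0 (suc N) = ≈-refl

      goodWords-weight : ∀ N m → m < N → wsum (wordWeight (suc m)) (goodWords N (suc m)) ≈ fSeq weights N (suc m)
      goodWords-weight (suc N) m (s≤s m≤N) = begin
        wsum (wordWeight (suc m)) (map (joinW (suc m)) (sequences (goodWords N) (suc (suc r)) m))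
          ≈⟨ wsum-map (wordWeight (suc m)) (joinW (suc m)) (sequences (goodWords N) (suc (suc r)) m) ⟩
        wsum (λ αs → wordWeight (suc m) (joinW (suc m) αs)) (sequences (goodWords N) (suc (suc r)) m)
          ≈⟨ wsum-cong (sequences (goodWords N) (suc (suc r)) m) (λ {αs} αs∈ → let lg = sequences-sound correct (suc (suc r)) m m≤N αs∈ in join-weight αs (proj₁ lg) (proj₂ lg)) ⟩
        wsum (λ αs → U * sequenceWeight weights m αs) (sequences (goodWords N) (suc (suc r)) m)
          ≈⟨ wsum-scaleˡ U (sequenceWeight weights m) (sequences (goodWords N) (suc (suc r)) m) ⟩
        U * wsum (sequenceWeight weights m) (sequences (goodWords N) (suc (suc r)) m)
          ≈⟨ *-congˡ (≈-trans (reflexive (cong (λ k → wsum (sequenceWeight weights m) (sequences (goodWords N) k m))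
            (sym arity)))
               (sequences-weight correct (fSeq weights N) (fSeq-0 N) (goodWords-weight N) weights-scalar m m≤N)) ⟩
        U * gSeq (fSeq weights N) weights m ∎
        where
        correct = goodWords-correct N
        join-weight : ∀ αs → length αs ≡ suc (suc r) → Good (suc r) m αs →
          wordWeight (suc m) (joinW (suc m) αs) ≈ U * sequenceWeight weights m αs
        join-weight αs len g = begin
          monomial weights (λ i → descents i [] (joinW (suc m) αs)) * U ^ components (suc m) (Sᵣ (joinW (suc m) αs))
            ≈⟨ *-cong (≈-trans (monomial-cong weights (λ i → descents-join i αs len g))
              (monomial-+ weights (nonemptyAt αs) (λ i → sequenceDescents i αs)))
                 (reflexive (cong (U ^_) (components-join αs len g))) ⟩
          sequenceMonomial weights αs * (U * U ^ components m (sortedLetters αs))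
            ≈⟨ solve 3 (λ s u v → s :* (u :* v) := u :* (s :* v)) ≈-refl _ _ _ ⟩
          U * sequenceWeight weights m αs ∎

open import Data.Nat using (_+_; _*_; _^_)

-- Counting

module Enumeration (r : ℕ) where
  private
    m : ℕ
    m = suc (suc r)
    K L E : CommutativeRing 0ℓ 0ℓ
    K = polynomials m
    L = PowerSeries.ring⟦⟧ K
    E = PowerSeries.ring⟦⟧ L
    module K = CommutativeRing K
    module L = CommutativeRing L
    module E = CommutativeRing E
  open Branches K using (Branch; branch; branch-b₀; module Specialised; x; b)
  open Generate r

  ξs : List K.Carrier
  ξs = variables m

  branches : List Branch
  branches = map branch ξs

  private
    constant : All (λ p → Lagrange.D K (x p) L.≈ L.0#) branches
    constant = Allₚ.map⁺ {xs = ξs} {f = branch} (All.tabulate λ {ξ} _ → Lagrange.D-const K ξ)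

    small : All (λ p → b p 0 K.≈ K.0#) branches
    small = Allₚ.map⁺ {xs = ξs} {f = branch} (All.tabulate λ {ξ} _ → branch-b₀ ξ)

  module Sp = Specialised (torsionFree m) branches constant small

  module W = Weights r E Sp.S.U Sp.W.Ψ

  weights : List E.Carrier
  weights = Sp.xs branches

  length-variables : ∀ m → length (variables m) ≡ m
  length-variables zero    = refl
  length-variables (suc m) = cong suc (trans (Listₚ.length-map _ (variables m)) (length-variables m))

  arity : length weights ≡ m
  arity = trans (Listₚ.length-map _ branches) (trans (Listₚ.length-map _ ξs) (length-variables m))

  weights-scalar : All W.Scalar weights
  weights-scalar = Allₚ.map⁺ {xs = branches} {f = λ p → PowerSeries.const L (x p)}
    (All.tabulate λ {p} _ → Sp.Ψ-const (x p))

  monomialᴷ : Word → K.Carrier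
  monomialᴷ w = Monomials.monomial K ξs (λ i → descents i [] w)

  polynomial : ℕ → ℕ → K.Carrier
  polynomial N n = ListSum.wsum K monomialᴷ (goodWords N n)

  private
    -- At `ω = 0`, where `U` is 1, the number of components is forgotten and only the descents
    -- remain.
    at0-^ : ∀ n → Powers._^_ E.semiring Sp.S.U n 0 L.≈ L.1#
    at0-^ zero    = L.refl
    at0-^ (suc n) = L.trans (L.*-cong Sp.S.U₀ (at0-^ n)) (L.*-identityˡ _)

    weights₀ : map (λ f → f 0) weights ≡ map (PowerSeries.const K) ξs
    weights₀ = trans (sym (Listₚ.map-∘ branches)) (sym (Listₚ.map-∘ ξs))

    monomial₀ : ∀ w → Monomials.monomial E weights (λ i → descents i [] w) 0 L.≈ PowerSeries.const K (monomialᴷ w)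
    monomial₀ w = L.trans (MonomialMap.monomial-map E L (λ f → f 0) (λ _ _ → L.refl) L.refl weights e)
      (L.trans (L.reflexive (cong (λ ys → Monomials.monomial L ys e) weights₀))
        (L.sym (MonomialMap.monomial-map K L (PowerSeries.const K) (PowerSeries.const-* K) L.refl ξs e)))
      where
      e : ℕ → ℕ
      e i = descents i [] w

    wsum₀ : ∀ (f : Word → E.Carrier) (g : Word → K.Carrier) ws → (∀ w → f w 0 L.≈ PowerSeries.const K (g w)) →
      ListSum.wsum E f ws 0 L.≈ PowerSeries.const K (ListSum.wsum K g ws)
    wsum₀ f g []       h = L.refl
    wsum₀ f g (w ∷ ws) h = L.trans (L.+-cong (h w) (wsum₀ f g ws h)) (L.sym (PowerSeries.const-+ K _ _))

    fSeq-polynomial : ∀ N n → n ≤ N → Sp.fSeq weights N n 0 L.≈ PowerSeries.const K (polynomial N n)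
    fSeq-polynomial N zero n≤N = L.trans
      (PowerSeries.coeff (W.fSeq-0 Sp.Ψ-cong Sp.Ψ-+ Sp.Ψ-U^ weights weights-scalar arity N) 0)
      (L.reflexive (cong (PowerSeries.const K) (sym (none N))))
      where
      none : ∀ N → polynomial N 0 ≡ K.0#
      none zero    = refl
      none (suc N) = refl
    fSeq-polynomial N (suc n) n≤N = L.trans
      (L.sym (PowerSeries.coeff (W.goodWords-weight Sp.Ψ-cong Sp.Ψ-+ Sp.Ψ-U^ weights weights-scalar
        arity N n n≤N) 0))
      (wsum₀ (W.wordWeight Sp.Ψ-cong Sp.Ψ-+ Sp.Ψ-U^ weights weights-scalar (suc n)) monomialᴷ (goodWords N (suc n))
        (λ w → L.trans (L.*-cong (monomial₀ w) (at0-^ (components (suc n) (Sᵣ w)))) (L.*-identityʳ _)))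

  coefficient-wsum : ∀ κ ws → coefficient m κ (ListSum.wsum K monomialᴷ ws)
                     ≡ ℤ.+ length (filterᵇ (λ w → matches m κ (λ i → descents i [] w)) ws)
  coefficient-wsum κ []       = coefficient-0 m κ
  coefficient-wsum κ (w ∷ ws) = trans (coefficient-+ m κ (monomialᴷ w) (ListSum.wsum K monomialᴷ ws))
    (trans (cong₂ ℤ._+_ (coefficient-monomial m κ (λ i → descents i [] w)) (coefficient-wsum κ ws)) step)
    where
    step : (if matches m κ (λ i → descents i [] w) then ℤ.+ 1 else ℤ.+ 0) ℤ.+ ℤ.+ length
      (filterᵇ (λ w → matches m κ (λ i → descents i [] w)) ws)
           ≡ ℤ.+ length (filterᵇ (λ w → matches m κ (λ i → descents i [] w)) (w ∷ ws))
    step with matches m κ (λ i → descents i [] w)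
    ... | true  = refl
    ... | false = refl

  enumeration : ∀ (κ : Fin m → ℕ) → let N = sum (tabulate κ) in
    suc N * (suc N * length (filterᵇ (λ w → matches m κ (λ i → descents i [] w)) (goodWords (suc N) (suc N))))
      ≡ product (tabulate (λ i → lucas (2 * suc N) (κ i)))
  enumeration κ = ℤₚ.+-injective (begin
    ℤ.+ (suc N * (suc N * c))
      ≡⟨ trans (ℤₚ.pos-* (suc N) (suc N * c)) (cong (ℤ.+ suc N ℤ.*_) (ℤₚ.pos-* (suc N) c)) ⟩
    ℤ.+ suc N ℤ.* (ℤ.+ suc N ℤ.* ℤ.+ c)
      ≡⟨ cong (λ y → ℤ.+ suc N ℤ.* (ℤ.+ suc N ℤ.* y)) (sym (coefficient-wsum κ (goodWords (suc N) (suc N)))) ⟩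
    ℤ.+ suc N ℤ.* (ℤ.+ suc N ℤ.* coefficient m κ p)
      ≡⟨ cong (ℤ.+ suc N ℤ.*_) (sym (coefficient-num m κ (suc N) p)) ⟩
    ℤ.+ suc N ℤ.* coefficient m κ (num (suc N) K.* p)
      ≡⟨ sym (coefficient-num m κ (suc N) (num (suc N) K.* p)) ⟩
    coefficient m κ (num (suc N) K.* (num (suc N) K.* p))
      -- Lagrange inversion yields a coefficient in degree `N`, which is below `2 (N + 1)`, so there
      -- the powers of `B` may be replaced by Lucas polynomials.
      ≡⟨ coefficient-cong m κ (K.trans (Sp.coefficients N (polynomial (suc N)) (fSeq-polynomial (suc N)))
           (BranchPowers.C^-lucas K ξs (suc N) N (ℕₚ.m≤m+n (suc N) _))) ⟩
    coefficient m κ (BranchPowers.lucasProduct K ξs (2 * suc N) N) ≡⟨ lucasProduct-coefficient m κ (2 * suc N) ⟩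
    ℤ.+ product (tabulate (λ i → lucas (2 * suc N) (κ i))) ∎)
    where
    open ≡.≡-Reasoning
    open Lagrange K using (num)
    N = sum (tabulate κ)
    c = length (filterᵇ (λ w → matches m κ (λ i → descents i [] w)) (goodWords (suc N) (suc N)))
    p = polynomial (suc N) (suc N)

-- The generated words among all words

∈-filterᵇ⁻ : ∀ {A : Set} (P : A → Bool) {xs v} → v ∈ filterᵇ P xs → v ∈ xs × P v ≡ true
∈-filterᵇ⁻ P {xs} p = let (a , b) = ∈-filter⁻ (λ x → T? (P x)) {xs = xs} p in a , T⇒≡true b

∈-filterᵇ⁺ : ∀ {A : Set} (P : A → Bool) {xs v} → v ∈ xs → P v ≡ true → v ∈ filterᵇ P xs
∈-filterᵇ⁺ P v∈ e = ∈-filter⁺ (λ x → T? (P x)) v∈ (≡true⇒T e)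

unique-filterᵇ : ∀ {A : Set} (P : A → Bool) {xs} → Unique xs → Unique (filterᵇ P xs)
unique-filterᵇ P = Uniqueₚ.filter⁺ (λ x → T? (P x))

same-length : ∀ {A : Set} {xs ys : List A} → Unique xs → Unique ys → (∀ {v} → v ∈ xs → v ∈ ys) →
  (∀ {v} → v ∈ ys → v ∈ xs) →
  length xs ≡ length ys
same-length u u′ f g = ↭-length (∼bag⇒↭ (unique∧set⇒bag u u′ (mk⇔ f g)))

∈-words⁺ : ∀ n w → (∀ {x} → x ∈ w → x ∈ range n) → w ∈ words n (length w)
∈-words⁺ n []      _ = here refl
∈-words⁺ n (x ∷ w) h = ∈-concatMap⁺′ (λ a → map (a ∷_) (words n (length w))) (h (here refl))
  (∈-map⁺ (x ∷_) (∈-words⁺ n w (λ p → h (there p))))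

unique-words : ∀ n l → Unique (words n l)
unique-words n zero    = [] ∷ []
unique-words n (suc l) = unique-concatMap (λ a → map (a ∷_) (words n l)) (range-unique n)
  (λ _ → Uniqueₚ.map⁺ Listₚ.∷-injectiveʳ (unique-words n l))
  (λ {a} {c} _ _ p q → heads a c p q)
  where
  heads : ∀ a c {w} → w ∈ map (a ∷_) (words n l) → w ∈ map (c ∷_) (words n l) → a ≡ c
  heads a c p q with ∈-map⁻ (a ∷_) p | ∈-map⁻ (c ∷_) q
  ... | _ , _ , refl | _ , _ , eq = Listₚ.∷-injectiveˡ eq

goodWord-range : ∀ {r n w} → GoodWord (suc r) n w → ∀ {x} → x ∈ w → x ∈ range n
goodWord-range {n = n} g x∈ = let (a , c) = bounds (w-letters g) x∈ in ∈-range⁺ n a c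

goodWord-length : ∀ {r n w} → GoodWord (suc r) n w → length w ≡ suc r * n
goodWord-length {r} {n} {w} g = trans (length-occ n w (goodWord-range g))
  (trans (cong sum (Listₚ.map-cong-local (All.tabulate λ {a} a∈ → let (p , q) = ∈-range⁻ n a∈ in full (w-letters g) p q)))
    (trans (sum-const (range n)) (cong (suc r *_) (trans (Listₚ.length-map suc (upTo n)) (Listₚ.length-upTo n)))))
  where
  sum-const : ∀ (xs : List ℕ) → sum (map (λ _ → suc r) xs) ≡ suc r * length xs
  sum-const []       = sym (ℕₚ.*-zeroʳ (suc r))
  sum-const (_ ∷ xs) = trans (cong (λ l → suc r + l) (sum-const xs)) (sym (ℕₚ.*-suc (suc r) (length xs)))

module _ (r : ℕ) (κ : Fin (suc (suc r)) → ℕ) where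
  private
    N = sum (tabulate κ)
    n = nOf (suc r) κ
    Q : Word → Bool
    Q w = matches (suc (suc r)) κ (λ i → descents i [] w)
  open Generate r
  open Correct (goodWords-correct n)

  private
    Q-descCount : ∀ w → GoodWord (suc r) n w → all (λ i → descCount n w (toℕ i) ≡ᵇ κ i) (allFin (suc (suc r))) ≡ Q w
    Q-descCount w g = all-tabulate _ (λ i → i)
      (λ i → cong (_≡ᵇ κ i) (descCount-descents n w (toℕ i) (goodWord-range g)))

    counted⁻ : ∀ w → counted (suc r) κ w ≡ true → GoodWord (suc r) n w × Q w ≡ true
    counted⁻ w p = g , trans (sym (Q-descCount w g)) (proj₂ split)
      where
      split = ∧-true⁻ {eqW (S (Sᵣ w)) (range n)} (proj₂ (∧-true⁻ {isRPerm (suc r) n w} p))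
      g : GoodWord (suc r) n w
      g = goodWord⁻ w (proj₁ (∧-true⁻ {isRPerm (suc r) n w} p)) (proj₁ split)

    counted⁺ : ∀ w → GoodWord (suc r) n w → Q w ≡ true → counted (suc r) κ w ≡ true
    counted⁺ w g q = let (a , c) = goodWord⁺ w g in ∧-true⁺ a (∧-true⁺ c (trans (Q-descCount w g) q))

  -- Neither list has repetitions, and both have the same members, because a good word has the
  -- length over which `words` ranges.
  countPerms-goodWords : countPerms (suc r) κ ≡ length (filterᵇ Q (goodWords n n))
  countPerms-goodWords = same-length
    (unique-filterᵇ (counted (suc r) κ) (unique-words n (suc r * n)))
    (unique-filterᵇ Q (unique ℕₚ.≤-refl))
    (λ {w} w∈ → let (g , q) = counted⁻ w (proj₂ (∈-filterᵇ⁻ (counted (suc r) κ) {words n (suc r * n)} w∈)) in ∈-filterᵇ⁺ Q (complete ℕₚ.≤-refl g) q)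
    (λ {w} w∈ → let (w∈′ , q) = ∈-filterᵇ⁻ Q {goodWords n n} w∈
                    g = sound ℕₚ.≤-refl w∈′
                in ∈-filterᵇ⁺ (counted (suc r) κ) (subst (λ l → w ∈ words n l) (goodWord-length g)
                  (∈-words⁺ n w (goodWord-range g))) (counted⁺ w g q))

-- The product formula

product-* : ∀ {l} (f g : Fin l → ℕ) → product (tabulate f) * product (tabulate g)
  ≡ product (tabulate (λ i → f i * g i))
product-* {zero}  f g = refl
product-* {suc l} f g = trans
  (solve 4 (λ a c d e → (a :* c) :* (d :* e) := (a :* d) :* (c :* e)) refl (f zero) _ (g zero) _)
  (cong (f zero * g zero *_) (product-* (λ i → f (suc i)) (λ i → g (suc i))))
  where open ℕSolver.+-*-Solver

product-const : ∀ l n → product (tabulate {n = l} (λ _ → n)) ≡ n ^ l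
product-const zero    n = refl
product-const (suc l) n = cong (n *_) (product-const l n)

≤-sum-tabulate : ∀ {l} (κ : Fin l → ℕ) i → κ i ≤ sum (tabulate κ)
≤-sum-tabulate κ zero    = ℕₚ.m≤m+n _ _
≤-sum-tabulate κ (suc i) = ℕₚ.≤-trans (≤-sum-tabulate (λ j → κ (suc j)) i) (ℕₚ.m≤n+m _ (κ zero))

-- The formula is cleared of denominators. Since each `k i` is at most the sum of all and hence
-- below `n`, the factors `n ^ 2` and `n ∸ k i` are positive, and the equation determines the count.
theorem4 : (r : ℕ) → 1 ≤ r → (k : Fin (suc r) → ℕ) →
    countPerms r k * (nOf r k ^ 2) * product (tabulate (λ i → nOf r k ∸ k i))
    ≡ nOf r k ^ suc r * product (tabulate (λ i → (2 * nOf r k ∸ 1 ∸ k i) C k i))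
theorem4 (suc r) _ k = begin
  countPerms (suc r) k * n ^ 2 * P
    ≡⟨ cong (λ c → c * n ^ 2 * P) (countPerms-goodWords r k) ⟩
  c * n ^ 2 * P
    ≡⟨ cong (_* P) (solve 2 (λ c n → c :* (n :* (n :* con 1)) := n :* (n :* c)) refl c n) ⟩
  n * (n * c) * P
    ≡⟨ cong (_* P) (Enumeration.enumeration r k) ⟩
  product (tabulate (λ i → lucas (2 * n) (k i))) * P
    ≡⟨ product-* (λ i → lucas (2 * n) (k i)) (λ i → n ∸ k i) ⟩
  product (tabulate (λ i → lucas (2 * n) (k i) * (n ∸ k i)))
    ≡⟨ cong product (Listₚ.tabulate-cong (λ i → lucas-closed n (k i) (s≤s (≤-sum-tabulate k i)))) ⟩
  product (tabulate (λ i → n * ((2 * n ∸ 1 ∸ k i) C k i)))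
    ≡⟨ sym (product-* (λ _ → n) (λ i → (2 * n ∸ 1 ∸ k i) C k i)) ⟩
  product (tabulate {n = suc (suc r)} (λ _ → n)) * product (tabulate (λ i → (2 * n ∸ 1 ∸ k i) C k i))
    ≡⟨ cong (_* product (tabulate (λ i → (2 * n ∸ 1 ∸ k i) C k i))) (product-const (suc (suc r)) n) ⟩
  n ^ suc (suc r) * product (tabulate (λ i → (2 * n ∸ 1 ∸ k i) C k i)) ∎
  where
  open ≡.≡-Reasoning
  open ℕSolver.+-*-Solver using (solve; _:*_; _:=_; con)
  n = nOf (suc r) k
  P = product (tabulate (λ i → n ∸ k i))
  c = length (filterᵇ (λ w → matches (suc (suc r)) k (λ i → descents i [] w)) (Generate.goodWords r n n))
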